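{- Let $b>1$ be an integer and $d\in\{0,\dots,b-1\}$. For every $k\ge1$, and also for $k=0$ if $d=0$, $b^{ -1}I(b,d,k)$ is exactly represented by the absolutely convergent series $$b^{ -1}I(b,d,k)=\sum_{j=1}^\infty c_j(b,d)\,F_j(b,d)\,\lambda_j^{k+1}.$$ Further, for $k=0$ and $d>0$, with $(b,d)\neq(2,1)$, there holds, with the same $c_j(b,d)$, $$b^{ -1}I(b,d,0)=\sum_{j=1}^\infty c_j(b,d)\,F_j^*(b,d)\,\lambda_j,$$ again with an absolutely convergent series.
   Context: For an integer $n>0$, $k_d(n)$ is the number of digits equal to $d$ in the base-$b$ representation of $n$ without leading zeros, and $I(b,d,k)=\sum_{n>0,\,k_d(n)=k}\frac1n$. For $j\ge1$, $\lambda_j=(b^j-b+1)^{ -1}$, and $\nu_j=\nu_{b,d,j}$ is the probability measure on $[0,1)$ which is the law of $\sum_{i\ge1}d_ib^{ -i}$, where the digits $d_i\in\{0,\dots,b-1\}$ are independent and identically distributed with probability $(b^j-b+1)b^{ -j}$ to equal $d$ and probability $b^{ -j}$ to equal any given $a\ne d$. Define $$F_j(b,d)=\int_{[b^{ -1},1)}\frac{d\nu_j(x)}{x^j},\qquad F_j^*(b,d)=\int_{[b^{ -1},1)\setminus[db^{ -1},(d+1)b^{ -1})}\frac{d\nu_j(x)}{x^j}.$$ Let $Q=(q_{ij})_{i,j\ge1}$ be the infinite unipotent upper-triangular matrix with $q_{ij}=0$ for $j<i$ and $q_{ij}=(-1)^{j-i}\binom{j-1}{i-1}\int_{[0,1)}(d+x)^{j-i}\,d\nu_i(x)$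 for $j\ge i$. Then $c_j(b,d)$ is the $j$-th entry of the first row of $Q^{ -1}$: $c_j(b,d)=(Q^{ -1})_{1,j}$. -}

module Defs where

open import Algebra.Bundles using (CommutativeRing)
open import Algebra.Structures using (IsCommutativeRing)
import Algebra.Properties.Semiring.Exp as Exp
import Algebra.Properties.Semiring.Sum as Sum
open import Data.Bool.Base using (Bool; true; false; T; if_then_else_; _∧_; not)
open import Data.Digit using (Expansion; fromDigits)
open import Data.Empty using (⊥)
open import Data.Fin.Base as Fin using (Fin; toℕ)
import Data.Fin.Properties as Fin
open import Data.Integer.Base as ℤ using (+_)
import Data.Integer.Properties as ℤ
open import Data.List.Base as List using ([]; _∷_)
open import Data.Maybe.Base using (just)
open import Data.Nat.Base as ℕ using (ℕ; zero; suc; pred; NonZero; NonTrivial)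
open import Data.Nat.Combinatorics using (_C_; nCn≡1)
open import Data.Nat.Induction using (<-rec)
open import Data.Nat.DivMod as ℕ using (_mod_)
import Data.Nat.Properties as ℕ
open import Data.Product.Base using (∃; _×_; _,_; proj₁; proj₂)
open import Data.Rational.Base as ℚ using (ℚ; 0ℚ; 1ℚ; ½; _/_)
import Data.Rational.Properties as ℚ
open import Data.Rational.Solver using (module +-*-Solver)
import Data.Rational.Unnormalised.Base as ℚᵘ
import Data.Rational.Unnormalised.Properties as ℚᵘ
open import Data.Sum.Base using (inj₁; inj₂)
open import Data.Vec.Base using (Vec; []; _∷_; _++_)
open import Function.Base using (_∘_; const)
open import Function.Bundles using (mk⇔)
open import Level using (0ℓ)
open import Relation.Binary.PropositionalEquality hiding (setoid; [_])
open import Relation.Nullary using (yes; no; does; contradiction; ¬_)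
open import Relation.Nullary.Decidable using (dec-true; dec-false; does-⇔)

-- ℕ × ℕ matrices; indices start at 0.

module UpperTriangularMatrices {c ℓ} (R : CommutativeRing c ℓ) where

  private
    open module R = CommutativeRing R using (0#; 1#)
      renaming (Carrier to A; _≈_ to _≋_; _+_ to _⊕_; _-_ to _⊖_; _*_ to _⊗_)
    open import Relation.Binary.Reasoning.Setoid R.setoid

  Σ< : ℕ → (ℕ → A) → A
  Σ< zero    f = 0#
  Σ< (suc n) f = Σ< n f ⊕ f n

  Matrix : Set c
  Matrix = ℕ → ℕ → A

  δ : Matrix
  δ i j = if does (i ℕ.≟ j) then 1# else 0#

  IsUpperTriangular : Matrix → Set ℓ
  IsUpperTriangular M = ∀ {i j} → j ℕ.< i → M i j ≋ 0#

  IsUnipotent : Matrix → Set ℓ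
  IsUnipotent M = IsUpperTriangular M × (∀ i → M i i ≋ 1#)

  -- The sum defining the (i, j) entry of a product is finite when the right
  -- factor is upper triangular, since then N k j vanishes for k > j.
  _·_ : Matrix → Matrix → Matrix
  (M · N) i j = Σ< (suc j) λ k → M i k ⊗ N k j

  record IsInverse (M N : Matrix) : Set ℓ where
    field
      upperTriangular : IsUpperTriangular N
      inverseˡ        : ∀ i j → (N · M) i j ≋ δ i j
      inverseʳ        : ∀ i j → (M · N) i j ≋ δ i j

  -- row M i n holds the first n entries of the i-th row of the inverse.
  row : Matrix → ℕ → ℕ → ℕ → A
  row M i zero    j = 0#
  row M i (suc n) j = if does (j ℕ.<? n) then row M i n j
                      else δ i n ⊖ Σ< n λ k → row M i n k ⊗ M k n

  inverse : Matrix → Matrix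
  inverse M i j = row M i (suc j) j

  Σ<-cong : ∀ n {f g} → (∀ k → k ℕ.< n → f k ≋ g k) → Σ< n f ≋ Σ< n g
  Σ<-cong zero    f≋g = R.refl
  Σ<-cong (suc n) f≋g =
    R.+-cong (Σ<-cong n λ k k<n → f≋g k (ℕ.m<n⇒m<1+n k<n)) (f≋g n ℕ.≤-refl)

  Σ<-zero : ∀ n {f} → (∀ k → k ℕ.< n → f k ≋ 0#) → Σ< n f ≋ 0#
  Σ<-zero zero    f≋0 = R.refl
  Σ<-zero (suc n) f≋0 = R.trans
    (R.+-cong (Σ<-zero n λ k k<n → f≋0 k (ℕ.m<n⇒m<1+n k<n)) (f≋0 n ℕ.≤-refl))
    (R.+-identityˡ 0#)

  interchange : ∀ w x y z → (w ⊕ x) ⊕ (y ⊕ z) ≋ (w ⊕ y) ⊕ (x ⊕ z)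
  interchange w x y z = begin
    (w ⊕ x) ⊕ (y ⊕ z)  ≈⟨ R.+-assoc w x (y ⊕ z) ⟩
    w ⊕ (x ⊕ (y ⊕ z))  ≈⟨ R.+-congˡ (R.+-assoc x y z) ⟨
    w ⊕ ((x ⊕ y) ⊕ z)  ≈⟨ R.+-congˡ (R.+-congʳ (R.+-comm x y)) ⟩
    w ⊕ ((y ⊕ x) ⊕ z)  ≈⟨ R.+-congˡ (R.+-assoc y x z) ⟩
    w ⊕ (y ⊕ (x ⊕ z))  ≈⟨ R.+-assoc w y (x ⊕ z) ⟨
    (w ⊕ y) ⊕ (x ⊕ z)  ∎

  Σ<-+ : ∀ n f g → Σ< n (λ k → f k ⊕ g k) ≋ Σ< n f ⊕ Σ< n g
  Σ<-+ zero    f g = R.sym (R.+-identityˡ 0#)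
  Σ<-+ (suc n) f g = R.trans (R.+-congʳ (Σ<-+ n f g)) (interchange _ _ _ _)

  Σ<-comm : ∀ m n (f : ℕ → ℕ → A) →
            Σ< m (λ i → Σ< n (f i)) ≋ Σ< n (λ j → Σ< m λ i → f i j)
  Σ<-comm zero    n f = R.sym (Σ<-zero n λ _ _ → R.refl)
  Σ<-comm (suc m) n f = R.trans (R.+-congʳ (Σ<-comm m n f))
    (R.sym (Σ<-+ n (λ j → Σ< m λ i → f i j) (f m)))

  Σ<-*ˡ : ∀ n x f → x ⊗ Σ< n f ≋ Σ< n λ k → x ⊗ f k
  Σ<-*ˡ zero    x f = R.zeroʳ x
  Σ<-*ˡ (suc n) x f = R.trans (R.distribˡ x _ _) (R.+-congʳ (Σ<-*ˡ n x f))

  Σ<-*ʳ : ∀ n x f → Σ< n f ⊗ x ≋ Σ< n λ k → f k ⊗ x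
  Σ<-*ʳ zero    x f = R.zeroˡ x
  Σ<-*ʳ (suc n) x f = R.trans (R.distribʳ x _ _) (R.+-congʳ (Σ<-*ʳ n x f))

  Σ<-extend : ∀ {m n} f → m ℕ.≤′ n → (∀ k → m ℕ.≤ k → f k ≋ 0#) → Σ< m f ≋ Σ< n f
  Σ<-extend f ℕ.≤′-refl         f≋0 = R.refl
  Σ<-extend f (ℕ.≤′-step m≤′n) f≋0 = R.trans (Σ<-extend f m≤′n f≋0) (R.sym
    (R.trans (R.+-congˡ (f≋0 _ (ℕ.≤′⇒≤ m≤′n))) (R.+-identityʳ _)))

  ·-assoc : ∀ L {M N} → IsUpperTriangular M → ∀ i j →
            ((L · M) · N) i j ≋ (L · (M · N)) i j
  ·-assoc L {M} {N} upper i j = begin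
    Σ< (suc j) (λ k → Σ< (suc k) (λ l → L i l ⊗ M l k) ⊗ N k j)
      ≈⟨ Σ<-cong (suc j) (λ k k≤j → R.*-congʳ (Σ<-extend _ (ℕ.≤⇒≤′ k≤j)
           λ l k<l → R.trans (R.*-congˡ (upper k<l)) (R.zeroʳ _))) ⟩
    Σ< (suc j) (λ k → Σ< (suc j) (λ l → L i l ⊗ M l k) ⊗ N k j)
      ≈⟨ Σ<-cong (suc j) (λ k _ → Σ<-*ʳ (suc j) (N k j) _) ⟩
    Σ< (suc j) (λ k → Σ< (suc j) (λ l → L i l ⊗ M l k ⊗ N k j))
      ≈⟨ Σ<-comm (suc j) (suc j) _ ⟩
    Σ< (suc j) (λ l → Σ< (suc j) (λ k → L i l ⊗ M l k ⊗ N k j))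
      ≈⟨ Σ<-cong (suc j) (λ l _ → Σ<-cong (suc j) λ k _ → R.*-assoc _ _ _) ⟩
    Σ< (suc j) (λ l → Σ< (suc j) (λ k → L i l ⊗ (M l k ⊗ N k j)))
      ≈⟨ Σ<-cong (suc j) (λ l _ → Σ<-*ˡ (suc j) (L i l) _) ⟨
    Σ< (suc j) (λ l → L i l ⊗ Σ< (suc j) (λ k → M l k ⊗ N k j))
      ∎

  δ-diagonal : ∀ i → δ i i ≡ 1#
  δ-diagonal i rewrite dec-true (i ℕ.≟ i) refl = refl

  δ-off : ∀ {i j} → ¬ i ≡ j → δ i j ≡ 0#
  δ-off {i} {j} i≢j rewrite dec-false (i ℕ.≟ j) i≢j = refl

  ·-identityʳ : ∀ M i j → (M · δ) i j ≋ M i j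
  ·-identityʳ M i j = begin
    Σ< j (λ k → M i k ⊗ δ k j) ⊕ M i j ⊗ δ j j
      ≈⟨ R.+-cong (Σ<-zero j λ k k<j → R.trans
           (R.*-congˡ (R.reflexive (δ-off (ℕ.<⇒≢ k<j)))) (R.zeroʳ _))
           (R.trans (R.*-congˡ (R.reflexive (δ-diagonal j))) (R.*-identityʳ _)) ⟩
    0# ⊕ M i j  ≈⟨ R.+-identityˡ _ ⟩
    M i j       ∎

  ·-identityˡ : ∀ {M} → IsUpperTriangular M → ∀ i j → (δ · M) i j ≋ M i j
  ·-identityˡ {M} upper i j = helper (suc j) λ k j<k → upper j<k
    where
    below : ∀ n → n ℕ.≤ i → Σ< n (λ k → δ i k ⊗ M k j) ≋ 0#
    below n n≤i = Σ<-zero n λ k k<n → R.trans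
      (R.*-congʳ (R.reflexive (δ-off (ℕ.<⇒≢ (ℕ.<-≤-trans k<n n≤i) ∘ sym)))) (R.zeroˡ _)
    upTo : Σ< (suc i) (λ k → δ i k ⊗ M k j) ≋ M i j
    upTo = R.trans (R.+-cong (below i ℕ.≤-refl)
      (R.trans (R.*-congʳ (R.reflexive (δ-diagonal i))) (R.*-identityˡ _)))
      (R.+-identityˡ _)
    helper : ∀ n → (∀ k → n ℕ.≤ k → M k j ≋ 0#) → Σ< n (λ k → δ i k ⊗ M k j) ≋ M i j
    helper n zeros with n ℕ.≤? i
    ... | yes n≤i = R.trans (below n n≤i) (R.sym (zeros i n≤i))
    ... | no  n≰i = R.trans (R.sym (Σ<-extend _ (ℕ.≤⇒≤′ (ℕ.≰⇒> n≰i)) λ k i<k → R.trans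
      (R.*-congʳ (R.reflexive (δ-off (ℕ.<⇒≢ i<k)))) (R.zeroˡ _))) upTo

  row-stable : ∀ M i n j → j ℕ.< n → row M i n j ≡ inverse M i j
  row-stable M i (suc n) j j<1+n with j ℕ.<? n
  ... | yes j<n rewrite dec-true (j ℕ.<? n) j<n = row-stable M i n j j<n
  ... | no  j≮n with refl ← ℕ.≤-antisym (ℕ.≤-pred j<1+n) (ℕ.≮⇒≥ j≮n)
      rewrite dec-false (j ℕ.<? j) (ℕ.<-irrefl refl) = refl

  inverse-rec : ∀ M i j →
    inverse M i j ≋ δ i j ⊖ Σ< j λ k → inverse M i k ⊗ M k j
  inverse-rec M i j rewrite dec-false (j ℕ.<? j) (ℕ.<-irrefl refl) =
    R.+-congˡ (R.-‿cong (Σ<-cong j λ k k<j →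
      R.*-congʳ (R.reflexive (row-stable M i j k k<j))))

  x-y+y : ∀ x y → y ⊕ (x ⊖ y) ≋ x
  x-y+y x y = begin
    y ⊕ (x ⊖ y)      ≈⟨ R.+-comm y (x ⊖ y) ⟩
    x ⊖ y ⊕ y        ≈⟨ R.+-assoc x _ y ⟩
    x ⊕ (R.- y ⊕ y)  ≈⟨ R.+-congˡ (R.-‿inverseˡ y) ⟩
    x ⊕ 0# ≈⟨ R.+-identityʳ x ⟩
    x                ∎

  inverse-left : ∀ {M} → IsUnipotent M → ∀ i j → (inverse M · M) i j ≋ δ i j
  inverse-left {M} (_ , unit) i j = begin
    Σ< j (λ k → inverse M i k ⊗ M k j) ⊕ inverse M i j ⊗ M j j
      ≈⟨ R.+-congˡ (R.trans (R.*-congˡ (unit j)) (R.*-identityʳ _)) ⟩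
    Σ< j (λ k → inverse M i k ⊗ M k j) ⊕ inverse M i j
      ≈⟨ R.+-congˡ (inverse-rec M i j) ⟩
    Σ< j (λ k → inverse M i k ⊗ M k j) ⊕ (δ i j ⊖ Σ< j (λ k → inverse M i k ⊗ M k j))
      ≈⟨ x-y+y _ _ ⟩
    δ i j ∎

  ⊖-zero : ∀ x {y} → y ≋ 0# → x ⊖ y ≋ x
  ⊖-zero x {y} y≋0 = begin
    x ⊖ y   ≈⟨ R.+-identityˡ (x ⊖ y) ⟨
    0# ⊕ (x ⊖ y)  ≈⟨ R.+-congʳ (R.sym y≋0) ⟩
    y ⊕ (x ⊖ y)   ≈⟨ x-y+y x y ⟩
    x       ∎

  inverse-upper : ∀ M → IsUpperTriangular (inverse M)
  inverse-upper M {i} {j} = <-rec (λ j → j ℕ.< i → inverse M i j ≋ 0#) step j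
    where
    step : ∀ j → (∀ {k} → k ℕ.< j → k ℕ.< i → inverse M i k ≋ 0#) →
           j ℕ.< i → inverse M i j ≋ 0#
    step j rec j<i = R.trans (inverse-rec M i j) (R.trans
      (⊖-zero (δ i j) (Σ<-zero j λ k k<j → R.trans
        (R.*-congʳ (rec k<j (ℕ.<-trans k<j j<i))) (R.zeroˡ _)))
      (R.reflexive (δ-off (λ i≡j → ℕ.<⇒≢ j<i (sym i≡j)))))

  inverse-unipotent : ∀ M → IsUnipotent (inverse M)
  inverse-unipotent M = inverse-upper M , λ i → R.trans (inverse-rec M i i) (R.trans
    (⊖-zero (δ i i) (Σ<-zero i λ k k<i → R.trans
      (R.*-congʳ (inverse-upper M k<i)) (R.zeroˡ _)))
    (R.reflexive (δ-diagonal i)))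

  ·-congˡ : ∀ L {M N} → (∀ i j → M i j ≋ N i j) → ∀ i j → (L · M) i j ≋ (L · N) i j
  ·-congˡ L M≋N i j = Σ<-cong (suc j) λ k _ → R.*-congˡ (M≋N k j)

  ·-congʳ : ∀ L {M N} → (∀ i j → M i j ≋ N i j) → ∀ i j → (M · L) i j ≋ (N · L) i j
  ·-congʳ L M≋N i j = Σ<-cong (suc j) λ k _ → R.*-congʳ (M≋N i k)

  inverse-isInverse : ∀ {M} → IsUnipotent M → IsInverse M (inverse M)
  inverse-isInverse {M} M-unipotent@(M-upper , _) = record
    { upperTriangular = inverse-upper M
    ; inverseˡ        = inverse-left M-unipotent
    ; inverseʳ        = λ i j → R.trans (·-congʳ N (λ i j → R.sym (L≋M i j)) i j)
                          (inverse-left (inverse-unipotent M) i j)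
    }
    where
    N = inverse M
    L = inverse N
    L≋M : ∀ i j → L i j ≋ M i j
    L≋M i j = begin
      L i j              ≈⟨ ·-identityʳ L i j ⟨
      (L · δ) i j        ≈⟨ ·-congˡ L (inverse-left M-unipotent) i j ⟨
      (L · (N · M)) i j  ≈⟨ ·-assoc L {N} {M} (inverse-upper M) i j ⟨
      ((L · N) · M) i j  ≈⟨ ·-congʳ M (inverse-left (inverse-unipotent M)) i j ⟩
      (δ · M) i j        ≈⟨ ·-identityˡ M-upper i j ⟩
      M i j              ∎

private
  +-*-semiring = CommutativeRing.semiring ℚ.+-*-commutativeRing

  module ℚΣ = Sum +-*-semiring

open Exp +-*-semiring public using () renaming (_^_ to _^ℚ_)

-- Cauchy sequences of rationals, to be compared by _≈_ below.

record ℝ : Set where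
  no-eta-equality
  constructor mkℝ
  field
    seq    : ℕ → ℚ
    cauchy : ∀ ε → 0ℚ ℚ.< ε → ∃ λ N → ∀ m n → N ℕ.≤ m → N ℕ.≤ n →
             ℚ.∣ seq m ℚ.- seq n ∣ ℚ.< ε

open ℝ public

infix 4 _≈_ _≤_

record _≈_ (x y : ℝ) : Set where
  constructor mk≈
  field
    eventually-close : ∀ ε → 0ℚ ℚ.< ε → ∃ λ N → ∀ n → N ℕ.≤ n →
                       ℚ.∣ seq x n ℚ.- seq y n ∣ ℚ.< ε

record _≤_ (x y : ℝ) : Set where
  constructor mk≤
  field
    eventually-≤ : ∀ ε → 0ℚ ℚ.< ε → ∃ λ N → ∀ n → N ℕ.≤ n →
                   seq x n ℚ.≤ seq y n ℚ.+ ε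

open _≈_ public
open _≤_ public

open +-*-Solver using (solve; con; _:=_; _:+_; _:*_; _:-_; :-_)

½+½ : ∀ ε → ½ ℚ.* ε ℚ.+ ½ ℚ.* ε ≡ ε
½+½ = solve 1 (λ ε → con ½ :* ε :+ con ½ :* ε := ε) refl

½>0 : ∀ {ε} → 0ℚ ℚ.< ε → 0ℚ ℚ.< ½ ℚ.* ε
½>0 {ε} 0<ε = subst (ℚ._< ½ ℚ.* ε) (ℚ.*-zeroʳ ½) (ℚ.*-monoʳ-<-pos ½ 0<ε)

∣p-p∣<ε : ∀ p {ε} → 0ℚ ℚ.< ε → ℚ.∣ p ℚ.- p ∣ ℚ.< ε
∣p-p∣<ε p 0<ε rewrite ℚ.+-inverseʳ p = 0<ε

∣p-q∣≡∣q-p∣ : ∀ p q → ℚ.∣ p ℚ.- q ∣ ≡ ℚ.∣ q ℚ.- p ∣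
∣p-q∣≡∣q-p∣ p q = trans (sym (ℚ.∣-p∣≡∣p∣ (p ℚ.- q)))
  (cong ℚ.∣_∣ (solve 2 (λ p q → :- (p :- q) := q :- p) refl p q))

resp-∣-∣≤ : ∀ {p q r} → p ≡ q → ℚ.∣ p ∣ ℚ.≤ r → ℚ.∣ q ∣ ℚ.≤ r
resp-∣-∣≤ refl h = h

triangle : ∀ p q r → ℚ.∣ p ℚ.- r ∣ ℚ.≤ ℚ.∣ p ℚ.- q ∣ ℚ.+ ℚ.∣ q ℚ.- r ∣
triangle p q r = resp-∣-∣≤
  ((solve 3 (λ p q r → (p :- q) :+ (q :- r) := p :- r) refl p q r))
  (ℚ.∣p+q∣≤∣p∣+∣q∣ (p ℚ.- q) (q ℚ.- r))

close-trans : ∀ p q r {ε} → ℚ.∣ p ℚ.- q ∣ ℚ.< ½ ℚ.* ε → ℚ.∣ q ℚ.- r ∣ ℚ.< ½ ℚ.* ε →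
              ℚ.∣ p ℚ.- r ∣ ℚ.< ε
close-trans p q r {ε} a b = ℚ.≤-<-trans (triangle p q r)
  (subst (_ ℚ.<_) (½+½ ε) (ℚ.+-mono-< a b))

close-+ : ∀ p q r s {ε} → ℚ.∣ p ℚ.- r ∣ ℚ.< ½ ℚ.* ε → ℚ.∣ q ℚ.- s ∣ ℚ.< ½ ℚ.* ε →
          ℚ.∣ (p ℚ.+ q) ℚ.- (r ℚ.+ s) ∣ ℚ.< ε
close-+ p q r s {ε} a b = ℚ.≤-<-trans
  (resp-∣-∣≤ (
    (solve 4 (λ p q r s → (p :- r) :+ (q :- s) := (p :+ q) :- (r :+ s)) refl p q r s))
    (ℚ.∣p+q∣≤∣p∣+∣q∣ (p ℚ.- r) (q ℚ.- s)))
  (subst (_ ℚ.<_) (½+½ ε) (ℚ.+-mono-< a b))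

∣-p--q∣ : ∀ p q → ℚ.∣ ℚ.- p ℚ.- ℚ.- q ∣ ≡ ℚ.∣ p ℚ.- q ∣
∣-p--q∣ p q = trans
  (cong ℚ.∣_∣ (solve 2 (λ p q → :- p :- :- q := q :- p) refl p q))
  (∣p-q∣≡∣q-p∣ q p)

∣p∣≤∣q∣+ : ∀ p q → ℚ.∣ p ∣ ℚ.≤ ℚ.∣ q ∣ ℚ.+ ℚ.∣ p ℚ.- q ∣
∣p∣≤∣q∣+ p q = resp-∣-∣≤
  ((solve 2 (λ p q → q :+ (p :- q) := p) refl p q))
  (ℚ.∣p+q∣≤∣p∣+∣q∣ q (p ℚ.- q))

p≤q+r⇒p-q≤r : ∀ {p q r} → p ℚ.≤ q ℚ.+ r → p ℚ.- q ℚ.≤ r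
p≤q+r⇒p-q≤r {p} {q} {r} h = subst (p ℚ.- q ℚ.≤_)
  (solve 2 (λ q r → q :+ r :- q := r) refl q r) (ℚ.+-monoˡ-≤ (ℚ.- q) h)

∣∣p∣-∣q∣∣ : ∀ p q → ℚ.∣ ℚ.∣ p ∣ ℚ.- ℚ.∣ q ∣ ∣ ℚ.≤ ℚ.∣ p ℚ.- q ∣
∣∣p∣-∣q∣∣ p q with ℚ.∣p∣≡p∨∣p∣≡-p (ℚ.∣ p ∣ ℚ.- ℚ.∣ q ∣)
... | inj₁ e rewrite e = p≤q+r⇒p-q≤r (∣p∣≤∣q∣+ p q)
... | inj₂ e rewrite e = subst₂ ℚ._≤_
  (solve 2 (λ p q → q :- p := :- (p :- q)) refl ℚ.∣ p ∣ ℚ.∣ q ∣)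
  (∣p-q∣≡∣q-p∣ q p) (p≤q+r⇒p-q≤r (∣p∣≤∣q∣+ q p))

∣-∣-mono-* : ∀ {p q r s} → ℚ.∣ p ∣ ℚ.≤ r → ℚ.∣ q ∣ ℚ.≤ s → ℚ.∣ p ℚ.* q ∣ ℚ.≤ r ℚ.* s
∣-∣-mono-* {p} {q} {r} {s} p≤r q≤s rewrite ℚ.∣p*q∣≡∣p∣*∣q∣ p q = ℚ.≤-trans
  (ℚ.*-monoʳ-≤-nonNeg ℚ.∣ q ∣ {{ℚ.∣-∣-nonNeg q}} p≤r)
  (ℚ.*-monoˡ-≤-nonNeg r {{ℚ.nonNegative (ℚ.≤-trans (ℚ.0≤∣p∣ p) p≤r)}} q≤s)

close-* : ∀ p q r s {A B δ η} → ℚ.∣ p ∣ ℚ.≤ A → ℚ.∣ s ∣ ℚ.≤ B →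
          ℚ.∣ p ℚ.- r ∣ ℚ.≤ δ → ℚ.∣ q ℚ.- s ∣ ℚ.≤ η →
          ℚ.∣ p ℚ.* q ℚ.- r ℚ.* s ∣ ℚ.≤ A ℚ.* η ℚ.+ δ ℚ.* B
close-* p q r s {A} {B} {δ} {η} a b c d = ℚ.≤-trans
  (resp-∣-∣≤ (
    (solve 4 (λ p q r s → p :* (q :- s) :+ (p :- r) :* s := p :* q :- r :* s) refl p q r s))
    (ℚ.∣p+q∣≤∣p∣+∣q∣ (p ℚ.* (q ℚ.- s)) ((p ℚ.- r) ℚ.* s)))
  (ℚ.+-mono-≤ (∣-∣-mono-* {p} {q ℚ.- s} a d) (∣-∣-mono-* {p ℚ.- r} {s} c b))

-- A positive δ with  A * δ + δ * B < ε.
share : ∀ A B ε → 0ℚ ℚ.≤ A → 0ℚ ℚ.≤ B → 0ℚ ℚ.< ε →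
        ∃ λ δ → 0ℚ ℚ.< δ × A ℚ.* δ ℚ.+ δ ℚ.* B ℚ.< ε
share A B ε 0≤A 0≤B 0<ε = δ , 0<δ , subst (A ℚ.* δ ℚ.+ δ ℚ.* B ℚ.<_) Kδ≡ε
  (subst (ℚ._< K ℚ.* δ)
    (solve 3 (λ A B δ → con 0ℚ :+ (A :+ B) :* δ := A :* δ :+ δ :* B) refl A B δ)
    (subst (0ℚ ℚ.+ (A ℚ.+ B) ℚ.* δ ℚ.<_)
      (solve 3 (λ A B δ → δ :+ (A :+ B) :* δ := (con 1ℚ :+ (A :+ B)) :* δ) refl A B δ)
      (ℚ.+-monoˡ-< ((A ℚ.+ B) ℚ.* δ) 0<δ)))
  where
  K = 1ℚ ℚ.+ (A ℚ.+ B)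
  0<K : 0ℚ ℚ.< K
  0<K = ℚ.+-mono-<-≤ (ℚ.positive⁻¹ 1ℚ) (ℚ.+-mono-≤ 0≤A 0≤B)
  instance
    K>0 = ℚ.positive 0<K
    K≢0 = ℚ.pos⇒nonZero K
    ε>0 = ℚ.positive 0<ε
    1/K>0 = ℚ.1/pos⇒pos K
  δ = ℚ.1/ K ℚ.* ε
  0<δ : 0ℚ ℚ.< δ
  0<δ = ℚ.positive⁻¹ δ {{ℚ.pos*pos⇒pos (ℚ.1/ K) ε}}
  Kδ≡ε : K ℚ.* δ ≡ ε
  Kδ≡ε = trans (sym (ℚ.*-assoc K (ℚ.1/ K) ε))
    (trans (cong (ℚ._* ε) (ℚ.*-inverseʳ K)) (ℚ.*-identityˡ ε))

bounded : (x : ℝ) → ∃ λ M → 0ℚ ℚ.≤ M × ∃ λ N → ∀ n → N ℕ.≤ n → ℚ.∣ seq x n ∣ ℚ.≤ M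
bounded x =
  let N , h = cauchy x 1ℚ (ℚ.positive⁻¹ 1ℚ)
      a     = seq x N
  in ℚ.∣ a ∣ ℚ.+ 1ℚ , ℚ.+-mono-≤ (ℚ.0≤∣p∣ a) (ℚ.nonNegative⁻¹ 1ℚ) , N , λ n N≤n →
     ℚ.≤-trans (∣p∣≤∣q∣+ (seq x n) a)
       (ℚ.+-monoʳ-≤ ℚ.∣ a ∣ (ℚ.<⇒≤ (h n N N≤n ℕ.≤-refl)))

⊔ˡ : ∀ {m n o} → m ℕ.⊔ n ℕ.≤ o → m ℕ.≤ o
⊔ˡ {m} {n} = ℕ.m⊔n≤o⇒m≤o m n

⊔ʳ : ∀ {m n o} → m ℕ.⊔ n ℕ.≤ o → n ℕ.≤ o
⊔ʳ {m} {n} = ℕ.m⊔n≤o⇒n≤o m n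

⊔⁴ : ∀ k l m n {o} → (k ℕ.⊔ l) ℕ.⊔ (m ℕ.⊔ n) ℕ.≤ o →
     k ℕ.≤ o × l ℕ.≤ o × m ℕ.≤ o × n ℕ.≤ o
⊔⁴ k l m n p =
  let q = ℕ.m⊔n≤o⇒m≤o (k ℕ.⊔ l) (m ℕ.⊔ n) p
      r = ℕ.m⊔n≤o⇒n≤o (k ℕ.⊔ l) (m ℕ.⊔ n) p
  in ℕ.m⊔n≤o⇒m≤o k l q , ℕ.m⊔n≤o⇒n≤o k l q , ℕ.m⊔n≤o⇒m≤o m n r , ℕ.m⊔n≤o⇒n≤o m n r

fromℚ : ℚ → ℝ
fromℚ p = mkℝ (const p) λ ε 0<ε → 0 , λ _ _ _ _ → ∣p-p∣<ε p 0<ε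

0ℝ 1ℝ : ℝ
0ℝ = fromℚ 0ℚ
1ℝ = fromℚ 1ℚ

infixl 7 _*_
infixl 6 _+_ _-_
infix  8 -_

_+_ : ℝ → ℝ → ℝ
seq    (x + y) n = seq x n ℚ.+ seq y n
cauchy (x + y) ε 0<ε =
  let M , h = cauchy x (½ ℚ.* ε) (½>0 0<ε)
      N , k = cauchy y (½ ℚ.* ε) (½>0 0<ε)
  in M ℕ.⊔ N , λ m n M≤m M≤n →
     close-+ (seq x m) (seq y m) (seq x n) (seq y n)
       (h m n (⊔ˡ M≤m) (⊔ˡ M≤n)) (k m n (⊔ʳ M≤m) (⊔ʳ M≤n))

-_ : ℝ → ℝ
seq    (- x) n = ℚ.- seq x n
cauchy (- x) ε 0<ε =
  let N , h = cauchy x ε 0<ε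
  in N , λ m n N≤m N≤n →
     subst (ℚ._< ε) (sym (∣-p--q∣ (seq x m) (seq x n))) (h m n N≤m N≤n)

_-_ : ℝ → ℝ → ℝ
x - y = x + (- y)

_*_ : ℝ → ℝ → ℝ
seq    (x * y) n = seq x n ℚ.* seq y n
cauchy (x * y) ε 0<ε =
  let A , 0≤A , N₁ , a = bounded x
      B , 0≤B , N₂ , b = bounded y
      δ , 0<δ , small  = share A B ε 0≤A 0≤B 0<ε
      N₃ , h = cauchy x δ 0<δ
      N₄ , k = cauchy y δ 0<δ
  in (N₁ ℕ.⊔ N₂) ℕ.⊔ (N₃ ℕ.⊔ N₄) , λ m n p q →
     let p₁ , p₂ , p₃ , p₄ = ⊔⁴ N₁ N₂ N₃ N₄ p
         q₁ , q₂ , q₃ , q₄ = ⊔⁴ N₁ N₂ N₃ N₄ q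
     in ℚ.≤-<-trans
          (close-* (seq x m) (seq y m) (seq x n) (seq y n) (a m p₁) (b n q₂)
            (ℚ.<⇒≤ (h m n p₃ q₃)) (ℚ.<⇒≤ (k m n p₄ q₄)))
          small

∣_∣ : ℝ → ℝ
seq    ∣ x ∣ n = ℚ.∣ seq x n ∣
cauchy ∣ x ∣ ε 0<ε =
  let N , h = cauchy x ε 0<ε
  in N , λ m n N≤m N≤n →
     ℚ.≤-<-trans (∣∣p∣-∣q∣∣ (seq x m) (seq x n)) (h m n N≤m N≤n)

pointwise : ∀ {x y} → (∀ n → seq x n ≡ seq y n) → x ≈ y
pointwise {x} {y} x≗y = mk≈ λ ε 0<ε → 0 , λ n _ →
  subst (λ p → ℚ.∣ p ℚ.- seq y n ∣ ℚ.< ε) (sym (x≗y n)) (∣p-p∣<ε (seq y n) 0<ε)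

ℝ-isCommutativeRing : IsCommutativeRing _≈_ _+_ _*_ -_ 0ℝ 1ℝ
ℝ-isCommutativeRing = record
  { isRing = record
    { +-isAbelianGroup = record
      { isGroup = record
        { isMonoid = record
          { isSemigroup = record
            { isMagma = record
              { isEquivalence = record
                { refl  = λ {x} → pointwise λ _ → refl
                ; sym   = λ {x} {y} x≈y → mk≈ λ ε 0<ε →
                    let N , h = eventually-close x≈y ε 0<ε in N , λ n N≤n →
                    subst (ℚ._< ε) (∣p-q∣≡∣q-p∣ (seq x n) (seq y n)) (h n N≤n)
                ; trans = λ {x} {y} {z} x≈y y≈z → mk≈ λ ε 0<ε →
                    let M , h = eventually-close x≈y (½ ℚ.* ε) (½>0 0<ε)
                        N , k = eventually-close y≈z (½ ℚ.* ε) (½>0 0<ε)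
                    in M ℕ.⊔ N , λ n p →
                       close-trans (seq x n) (seq y n) (seq z n) (h n (⊔ˡ p)) (k n (⊔ʳ p))
                }
              ; ∙-cong = λ {x} {y} {u} {v} x≈y u≈v → mk≈ λ ε 0<ε →
                  let M , h = eventually-close x≈y (½ ℚ.* ε) (½>0 0<ε)
                      N , k = eventually-close u≈v (½ ℚ.* ε) (½>0 0<ε)
                  in M ℕ.⊔ N , λ n p →
                     close-+ (seq x n) (seq u n) (seq y n) (seq v n) (h n (⊔ˡ p)) (k n (⊔ʳ p))
              }
            ; assoc = λ x y z → pointwise
                λ n → ℚ.+-assoc (seq x n) (seq y n) (seq z n)
            }
          ; identity = (λ x → pointwise λ n → ℚ.+-identityˡ (seq x n))
                     , (λ x → pointwise λ n → ℚ.+-identityʳ (seq x n))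
          }
        ; inverse = (λ x → pointwise λ n → ℚ.+-inverseˡ (seq x n))
                  , (λ x → pointwise λ n → ℚ.+-inverseʳ (seq x n))
        ; ⁻¹-cong = λ {x} {y} x≈y → mk≈ λ ε 0<ε →
            let N , h = eventually-close x≈y ε 0<ε in N , λ n N≤n →
            subst (ℚ._< ε) (sym (∣-p--q∣ (seq x n) (seq y n))) (h n N≤n)
        }
      ; comm = λ x y → pointwise λ n → ℚ.+-comm (seq x n) (seq y n)
      }
    ; *-cong = λ {x} {y} {u} {v} x≈y u≈v → mk≈ λ ε 0<ε →
        let A , 0≤A , N₁ , a = bounded x
            B , 0≤B , N₂ , b = bounded v
            δ , 0<δ , small  = share A B ε 0≤A 0≤B 0<ε
            N₃ , h = eventually-close x≈y δ 0<δ
            N₄ , k = eventually-close u≈v δ 0<δ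
        in (N₁ ℕ.⊔ N₂) ℕ.⊔ (N₃ ℕ.⊔ N₄) , λ n p →
           let p₁ , p₂ , p₃ , p₄ = ⊔⁴ N₁ N₂ N₃ N₄ p
           in ℚ.≤-<-trans
                (close-* (seq x n) (seq u n) (seq y n) (seq v n) (a n p₁) (b n p₂)
                  (ℚ.<⇒≤ (h n p₃)) (ℚ.<⇒≤ (k n p₄)))
                small
    ; *-assoc = λ x y z → pointwise
        λ n → ℚ.*-assoc (seq x n) (seq y n) (seq z n)
    ; *-identity = (λ x → pointwise λ n → ℚ.*-identityˡ (seq x n))
                 , (λ x → pointwise λ n → ℚ.*-identityʳ (seq x n))
    ; distrib = (λ x y z → pointwise
                   λ n → ℚ.*-distribˡ-+ (seq x n) (seq y n) (seq z n))
              , (λ x y z → pointwise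
                   λ n → ℚ.*-distribʳ-+ (seq x n) (seq y n) (seq z n))
    }
  ; *-comm = λ x y → pointwise λ n → ℚ.*-comm (seq x n) (seq y n)
  }

ℝ-commutativeRing : CommutativeRing 0ℓ 0ℓ
ℝ-commutativeRing = record { isCommutativeRing = ℝ-isCommutativeRing }

open Exp (CommutativeRing.semiring ℝ-commutativeRing) public using (_^_)

open UpperTriangularMatrices ℝ-commutativeRing public

infix 4 _⟶_

_⟶_ : (ℕ → ℝ) → ℝ → Set
x ⟶ l = ∀ ε → 0ℚ ℚ.< ε → ∃ λ N → ∀ n → N ℕ.≤ n → ∣ x n - l ∣ ≤ fromℚ ε

HasSum : (ℕ → ℝ) → ℝ → Set
HasSum a s = (λ n → Σ< n a) ⟶ s

AbsolutelyConvergent : (ℕ → ℝ) → Set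
AbsolutelyConvergent a = ∃ λ s → HasSum (λ n → ∣ a n ∣) s

HasAbsoluteSum : (ℕ → ℝ) → ℝ → Set
HasAbsoluteSum a s = AbsolutelyConvergent a × HasSum a s

[_,_⟩ : ℚ → ℚ → ℚ → Bool
[ p , q ⟩ x = does (p ℚ.≤? x) ∧ does (x ℚ.<? q)

_∖_ : (ℚ → Bool) → (ℚ → Bool) → ℚ → Bool
(A ∖ B) x = A x ∧ not (B x)

𝟙 : (ℚ → Bool) → ℚ → ℚ
𝟙 A x = if A x then 1ℚ else 0ℚ

-- Total, with the value 0 at 0.
recip : ℚ → ℚ
recip p with p ℚ.≟ 0ℚ
... | yes _  = 0ℚ
... | no p≢0 = (ℚ.1/ p) {{ℚ.≢-nonZero p≢0}}

fromℕ : ℕ → ℚ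
fromℕ n = + n / 1

toℚᵘ-/ : ∀ i n .{{_ : NonZero n}} → ℚ.toℚᵘ (i / n) ℚᵘ.≃ i ℚᵘ./ n
toℚᵘ-/ i (suc n) = ℚ.toℚᵘ-fromℚᵘ (ℚᵘ.mkℚᵘ i n)

fromℕ-mono : ∀ {m n} → m ℕ.≤ n → fromℕ m ℚ.≤ fromℕ n
fromℕ-mono {m} {n} m≤n = ℚ.toℚᵘ-cancel-≤ (ℚᵘ.≤-respˡ-≃ (ℚᵘ.≃-sym (toℚᵘ-/ (+ m) 1))
  (ℚᵘ.≤-respʳ-≃ (ℚᵘ.≃-sym (toℚᵘ-/ (+ n) 1))
    (ℚᵘ.*≤* (ℤ.*-monoʳ-≤-nonNeg (+ 1) (ℤ.+≤+ m≤n)))))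

fromℕ-+ : ∀ m n → fromℕ m ℚ.+ fromℕ n ≡ fromℕ (m ℕ.+ n)
fromℕ-+ m n = ℚ.toℚᵘ-injective (ℚᵘ.≃-trans (ℚ.toℚᵘ-homo-+ (fromℕ m) (fromℕ n))
  (ℚᵘ.≃-trans (ℚᵘ.+-cong (toℚᵘ-/ (+ m) 1) (toℚᵘ-/ (+ n) 1))
  (ℚᵘ.≃-trans (ℚᵘ.*≡* (cong (ℤ._* + 1)
      (cong₂ ℤ._+_ (ℤ.*-identityʳ (+ m)) (ℤ.*-identityʳ (+ n)))))
    (ℚᵘ.≃-sym (toℚᵘ-/ (+ (m ℕ.+ n)) 1)))))

fromℕ-suc : ∀ n → fromℕ (suc n) ≡ fromℕ n ℚ.+ 1ℚ
fromℕ-suc n = trans (cong fromℕ (ℕ.+-comm 1 n)) (sym (fromℕ-+ n 1))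

/≡* : ∀ m n .{{_ : NonZero n}} → + m / n ≡ fromℕ m ℚ.* (+ 1 / n)
/≡* m n@(suc _) = ℚ.toℚᵘ-injective (ℚᵘ.≃-trans (toℚᵘ-/ (+ m) n)
  (ℚᵘ.≃-sym (ℚᵘ.≃-trans (ℚ.toℚᵘ-homo-* (fromℕ m) (+ 1 / n))
  (ℚᵘ.≃-trans (ℚᵘ.*-cong (toℚᵘ-/ (+ m) 1) (toℚᵘ-/ (+ 1) n))
    (ℚᵘ.*≡* (cong₂ ℤ._*_ (ℤ.*-identityʳ (+ m)) (cong +_ (sym (ℕ.+-identityʳ n)))))))))

n/n≡1 : ∀ n .{{_ : NonZero n}} → + n / n ≡ 1ℚ
n/n≡1 n@(suc _) = ℚ.toℚᵘ-injective (ℚᵘ.≃-trans (toℚᵘ-/ (+ n) n)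
  (ℚᵘ.*≡* (ℤ.*-comm (+ n) (+ 1))))

1/n>0 : ∀ n .{{_ : NonZero n}} → ℚ.Positive (+ 1 / n)
1/n>0 n = ℚ.normalize-pos 1 n

≤-fromℕ : ∀ p → p ℚ.≤ fromℕ (ℤ.∣ ℚ.↥ p ∣)
≤-fromℕ p@(ℚ.mkℚ n d-1 _) = ℚ.toℚᵘ-cancel-≤
  (ℚᵘ.≤-respʳ-≃ (ℚᵘ.≃-sym (toℚᵘ-/ (+ ℤ.∣ n ∣) 1)) (ℚᵘ.*≤* (helper n)))
  where
  helper : ∀ i → i ℤ.* + 1 ℤ.≤ + ℤ.∣ i ∣ ℤ.* + suc d-1
  helper (+ m)        = subst₂ ℤ._≤_ (sym (ℤ.*-identityʳ (+ m))) (ℤ.pos-* m (suc d-1))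
    (ℤ.+≤+ (ℕ.m≤m*n m (suc d-1)))
  helper ℤ.-[1+ m ] = ℤ.-≤+

archimedean : ∀ p {ε} → 0ℚ ℚ.< ε → ∃ λ n → p ℚ.< ε ℚ.* fromℕ (suc n)
archimedean p {ε} 0<ε = n , subst (ℚ._< ε ℚ.* fromℕ (suc n)) εr≡p
  (ℚ.*-monoʳ-<-pos ε r<1+n)
  where
  instance
    ε>0 = ℚ.positive 0<ε
    ε≢0 = ℚ.pos⇒nonZero ε
  r = ℚ.1/ ε ℚ.* p
  n = ℤ.∣ ℚ.↥ r ∣
  r<1+n : r ℚ.< fromℕ (suc n)
  r<1+n = ℚ.≤-<-trans (≤-fromℕ r) (subst₂ ℚ._<_ (ℚ.+-identityʳ (fromℕ n))
    (sym (fromℕ-suc n)) (ℚ.+-monoʳ-< (fromℕ n) (ℚ.positive⁻¹ 1ℚ)))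
  εr≡p : ε ℚ.* r ≡ p
  εr≡p = trans (sym (ℚ.*-assoc ε (ℚ.1/ ε) p))
    (trans (cong (ℚ._* p) (ℚ.*-inverseʳ ε)) (ℚ.*-identityˡ p))

sum-const : ∀ n x → ℚΣ.sum {n} (λ _ → x) ≡ fromℕ n ℚ.* x
sum-const zero    x = sym (ℚ.*-zeroˡ x)
sum-const (suc n) x = trans (cong (x ℚ.+_) (sum-const n x))
  (trans (solve 2 (λ n x → x :+ n :* x := (n :+ con 1ℚ) :* x) refl (fromℕ n) x)
    (cong (ℚ._* x) (sym (fromℕ-suc n))))

sum-if : ∀ {n} (d : Fin n) x y →
  ℚΣ.sum (λ a → if does (a Fin.≟ d) then x else y) ≡ x ℚ.+ fromℕ (pred n) ℚ.* y
sum-if {suc n}        Fin.zero    x y = cong (x ℚ.+_) (sum-const n y)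
sum-if {suc n@(suc m)} (Fin.suc d) x y = trans (cong (y ℚ.+_) (sum-if d x y))
  (trans (solve 3 (λ x y m → y :+ (x :+ m :* y) := x :+ (m :+ con 1ℚ) :* y)
           refl x y (fromℕ m))
    (cong (λ z → x ℚ.+ z ℚ.* y) (sym (fromℕ-suc m))))

record DigitLaw (b : ℕ) : Set where
  field
    prob        : Fin b → ℚ
    nonNegative : ∀ a → 0ℚ ℚ.≤ prob a
    total       : ℚΣ.sum prob ≡ 1ℚ

open DigitLaw

-- The expectation of a function of l independent digits of law μ.
𝔼 : ∀ {b} → DigitLaw b → ∀ l → (Vec (Fin b) l → ℚ) → ℚ
𝔼 μ zero    g = g []
𝔼 μ (suc l) g = ℚΣ.sum λ a → prob μ a ℚ.* 𝔼 μ l (g ∘ (a ∷_))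

weighted : ∀ {n} (p x y : Fin n → ℚ) {ε} → (∀ a → 0ℚ ℚ.≤ p a) →
  (∀ a → ℚ.∣ x a ℚ.- y a ∣ ℚ.≤ ε) →
  ℚ.∣ ℚΣ.sum (λ a → p a ℚ.* x a) ℚ.- ℚΣ.sum (λ a → p a ℚ.* y a) ∣
    ℚ.≤ ℚΣ.sum p ℚ.* ε
weighted {zero}  p x y {ε} 0≤p h = ℚ.≤-reflexive (sym (ℚ.*-zeroˡ ε))
weighted {suc n} p x y {ε} 0≤p h = resp-∣-∣≤
  (solve 5 (λ p x y s t → p :* (x :- y) :+ (s :- t) := p :* x :+ s :- (p :* y :+ t)) refl
    (p Fin.zero) (x Fin.zero) (y Fin.zero) _ _)
  (ℚ.≤-trans (ℚ.∣p+q∣≤∣p∣+∣q∣ (p Fin.zero ℚ.* (x Fin.zero ℚ.- y Fin.zero)) _)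
    (subst (_ ℚ.≤_)
      (sym (ℚ.*-distribʳ-+ ε (p Fin.zero) (ℚΣ.sum (p ∘ Fin.suc))))
      (ℚ.+-mono-≤
        (∣-∣-mono-* {p Fin.zero} {x Fin.zero ℚ.- y Fin.zero}
          (ℚ.≤-reflexive (ℚ.0≤p⇒∣p∣≡p (0≤p Fin.zero))) (h Fin.zero))
        (weighted (p ∘ Fin.suc) (x ∘ Fin.suc) (y ∘ Fin.suc) (0≤p ∘ Fin.suc) (h ∘ Fin.suc)))))

module _ {b} (μ : DigitLaw b) where

  average : ∀ x → ℚΣ.sum (λ a → prob μ a ℚ.* x) ≡ x
  average x = trans (sym (ℚΣ.*-distribʳ-sum x (prob μ)))
    (trans (cong (ℚ._* x) (total μ)) (ℚ.*-identityˡ x))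

  weighted-μ : ∀ (x y : Fin b → ℚ) {ε} → (∀ a → ℚ.∣ x a ℚ.- y a ∣ ℚ.≤ ε) →
    ℚ.∣ ℚΣ.sum (λ a → prob μ a ℚ.* x a) ℚ.- ℚΣ.sum (λ a → prob μ a ℚ.* y a) ∣ ℚ.≤ ε
  weighted-μ x y {ε} h = subst (_ ℚ.≤_)
    (trans (cong (ℚ._* ε) (total μ)) (ℚ.*-identityˡ ε))
    (weighted (prob μ) x y (nonNegative μ) h)

  𝔼-const : ∀ l x → 𝔼 μ l (const x) ≡ x
  𝔼-const zero    x = refl
  𝔼-const (suc l) x = trans (ℚΣ.sum-cong-≗ (λ a → cong (prob μ a ℚ.*_) (𝔼-const l x)))
    (average x)

  𝔼-near : ∀ l (g : Vec (Fin b) l → ℚ) x {ε} → (∀ v → ℚ.∣ g v ℚ.- x ∣ ℚ.≤ ε) →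
           ℚ.∣ 𝔼 μ l g ℚ.- x ∣ ℚ.≤ ε
  𝔼-near zero    g x h = h []
  𝔼-near (suc l) g x {ε} h = subst (λ z → ℚ.∣ 𝔼 μ (suc l) g ℚ.- z ∣ ℚ.≤ ε) (average x)
    (weighted-μ _ (const x) λ a → 𝔼-near l (g ∘ (a ∷_)) x λ v → h (a ∷ v))

  𝔼-refine : ∀ l m (g : Vec (Fin b) (l ℕ.+ m) → ℚ) (h : Vec (Fin b) l → ℚ) {ε} →
    (∀ u v → ℚ.∣ g (u ++ v) ℚ.- h u ∣ ℚ.≤ ε) → ℚ.∣ 𝔼 μ (l ℕ.+ m) g ℚ.- 𝔼 μ l h ∣ ℚ.≤ ε
  𝔼-refine zero    m g h k = 𝔼-near m g (h []) (k [])
  𝔼-refine (suc l) m g h k = weighted-μ _ _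
    λ a → 𝔼-refine l m (g ∘ (a ∷_)) (h ∘ (a ∷_)) λ u → k (a ∷ u)

module Base (b : ℕ) .{{_ : NonTrivial b}} where

  private
    instance
      b≢0 : NonZero b
      b≢0 = ℕ.nonTrivial⇒nonZero b

  digitsWithin : ℕ → ℕ → Expansion b
  digitsWithin zero    n       = []
  digitsWithin (suc l) zero    = []
  digitsWithin (suc l) (suc n) = (suc n mod b) ∷ digitsWithin l (suc n ℕ./ b)

  -- The base-b digits of n, the least significant one first, without leading
  -- zeros. The expansion has at most n digits.
  digits : ℕ → Expansion b
  digits n = digitsWithin n n

  toℕ-mod : ∀ n → toℕ (n mod b) ≡ n ℕ.% b
  toℕ-mod n = Fin.toℕ-fromℕ< (ℕ.m%n<n n b)

  quotient≤ : ∀ {l} n → suc n ℕ.≤ suc l → suc n ℕ./ b ℕ.≤ l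
  quotient≤ n n≤l = ℕ.≤-pred (ℕ.≤-trans (ℕ.m/n<m (suc n) b (ℕ.nonTrivial⇒n>1 b)) n≤l)

  fromDigits-digitsWithin : ∀ l n → n ℕ.≤ l → fromDigits (digitsWithin l n) ≡ n
  fromDigits-digitsWithin zero    zero    _   = refl
  fromDigits-digitsWithin (suc l) zero    _   = refl
  fromDigits-digitsWithin (suc l) (suc n) n≤l = trans
    (cong₂ (λ r q → r ℕ.+ q ℕ.* b) (toℕ-mod (suc n))
      (fromDigits-digitsWithin l (suc n ℕ./ b) (quotient≤ n n≤l)))
    (sym (ℕ.m≡m%n+[m/n]*n (suc n) b))

  fromDigits-digits : ∀ n → fromDigits (digits n) ≡ n
  fromDigits-digits n = fromDigits-digitsWithin n n ℕ.≤-refl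

  leading≢0-within : ∀ l n → n ℕ.≤ l → ∀ {a} → List.last (digitsWithin l n) ≡ just a → toℕ a ≢ 0
  leading≢0-within (suc l) (suc n) n≤l eq a≡0
    with digitsWithin l (suc n ℕ./ b)
       | fromDigits-digitsWithin l (suc n ℕ./ b) (quotient≤ n n≤l)
       | leading≢0-within l (suc n ℕ./ b) (quotient≤ n n≤l)
  leading≢0-within (suc l) (suc n) n≤l refl a≡0 | [] | 0≡q | _ = contra
    where
    contra : ⊥
    contra with () ← trans (ℕ.m≡m%n+[m/n]*n (suc n) b)
      (cong₂ (λ r q → r ℕ.+ q ℕ.* b) (trans (sym (toℕ-mod (suc n))) a≡0) (sym 0≡q))
  ... | _ ∷ _ | _ | rec = rec eq a≡0

  leading-digit≢0 : ∀ n {a} → List.last (digits n) ≡ just a → toℕ a ≢ 0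
  leading-digit≢0 n = leading≢0-within n n ℕ.≤-refl

  b⁻¹ : ℚ
  b⁻¹ = + 1 / b

  -- The number with base-b expansion 0.a₁a₂…aₗ.
  value : ∀ {l} → Vec (Fin b) l → ℚ
  value []      = 0ℚ
  value (a ∷ w) = (fromℕ (toℕ a) ℚ.+ value w) ℚ.* b⁻¹

  -- f is bounded on the b-adic rationals of [0,1), and its oscillation over the
  -- b-adic intervals [m/bˡ, (m+1)/bˡ) tends to 0, uniformly in m, as l → ∞.
  record IsIntegrable (f : ℚ → ℚ) : Set where
    field
      bound       : ℚ
      ∣f∣≤bound   : ∀ {l} (w : Vec (Fin b) l) → ℚ.∣ f (value w) ∣ ℚ.≤ bound
      oscillation : ∀ ε → 0ℚ ℚ.< ε → ∃ λ L → ∀ {l m} → L ℕ.≤ l →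
                      (u : Vec (Fin b) l) (v : Vec (Fin b) m) →
                      ℚ.∣ f (value (u ++ v)) ℚ.- f (value u) ∣ ℚ.≤ ε

  open IsIntegrable

  -- The integral of f against the law of X = Σᵢ dᵢ b⁻ⁱ, the dᵢ being independent
  -- of law μ, as the limit of the expectations of f (Xₗ) for the partial sums Xₗ
  -- of X. Unless X = 1, Xₗ is the left endpoint of the b-adic interval of length
  -- b⁻ˡ containing X. So these are Riemann-Stieltjes sums, 𝔼 μ l weighing each
  -- interval by its measure, and by the bound on the oscillation of f any other
  -- choice of points in the intervals gives the same limit.
  ∫ : (f : ℚ → ℚ) → IsIntegrable f → DigitLaw b → ℝ
  seq    (∫ f _   μ) l = 𝔼 μ l (f ∘ value)
  cauchy (∫ f f-i μ) ε 0<ε =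
    let η     = ½ ℚ.* ε
        0<η   = ½>0 0<ε
        θ     = ½ ℚ.* η
        0<θ   = ½>0 0<η
        l , h = oscillation f-i θ 0<θ
        near  = λ n l≤n → ℚ.≤-<-trans (refine l θ (h ℕ.≤-refl) n l≤n) (½<1 0<η)
    in l , λ m n l≤m l≤n → close-trans (E m) (E l) (E n)
       (near m l≤m) (subst (ℚ._< η) (∣p-q∣≡∣q-p∣ (E n) (E l)) (near n l≤n))
    where
    E : ℕ → ℚ
    E l = 𝔼 μ l (f ∘ value)
    ½<1 : ∀ {η} → 0ℚ ℚ.< η → ½ ℚ.* η ℚ.< η
    ½<1 {η} 0<η = subst₂ ℚ._<_ (ℚ.+-identityʳ (½ ℚ.* η)) (½+½ η)
      (ℚ.+-monoʳ-< (½ ℚ.* η) (½>0 0<η))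
    refine : ∀ l θ → (∀ {m} (u : Vec (Fin b) l) (v : Vec (Fin b) m) →
               ℚ.∣ f (value (u ++ v)) ℚ.- f (value u) ∣ ℚ.≤ θ) →
             ∀ n → l ℕ.≤ n → ℚ.∣ E n ℚ.- E l ∣ ℚ.≤ θ
    refine l θ h n l≤n = subst (λ n → ℚ.∣ E n ℚ.- E l ∣ ℚ.≤ θ) (ℕ.m+[n∸m]≡n l≤n)
      (𝔼-refine μ l (n ℕ.∸ l) (f ∘ value) (f ∘ value) λ u v → h u v)

  0<b⁻¹ : 0ℚ ℚ.< b⁻¹
  0<b⁻¹ = ℚ.positive⁻¹ b⁻¹ {{1/n>0 b}}

  instance
    b⁻¹>0 : ℚ.Positive b⁻¹
    b⁻¹>0 = 1/n>0 b

    b⁻¹≥0 : ℚ.NonNegative b⁻¹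
    b⁻¹≥0 = ℚ.pos⇒nonNeg b⁻¹

  *b⁻¹-mono : ∀ {p q} → p ℚ.≤ q → p ℚ.* b⁻¹ ℚ.≤ q ℚ.* b⁻¹
  *b⁻¹-mono = ℚ.*-monoʳ-≤-nonNeg b⁻¹

  b*b⁻¹≡1 : fromℕ b ℚ.* b⁻¹ ≡ 1ℚ
  b*b⁻¹≡1 = trans (sym (/≡* b b)) (n/n≡1 b)

  0≤fromℕ : ∀ n → 0ℚ ℚ.≤ fromℕ n
  0≤fromℕ n = fromℕ-mono {0} {n} ℕ.z≤n

  0≤value : ∀ {l} (w : Vec (Fin b) l) → 0ℚ ℚ.≤ value w
  0≤value []      = ℚ.≤-refl
  0≤value (a ∷ w) = subst (ℚ._≤ value (a ∷ w)) (ℚ.*-zeroˡ b⁻¹)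
    (*b⁻¹-mono (ℚ.+-mono-≤ (0≤fromℕ (toℕ a)) (0≤value w)))

  head≤ : ∀ {l c} (a : Fin b) (w : Vec (Fin b) l) → c ℕ.≤ toℕ a → + c / b ℚ.≤ value (a ∷ w)
  head≤ {c = c} a w c≤a = subst (ℚ._≤ value (a ∷ w)) (sym (/≡* c b)) (*b⁻¹-mono
    (subst (ℚ._≤ fromℕ (toℕ a) ℚ.+ value w) (ℚ.+-identityʳ (fromℕ c))
      (ℚ.+-mono-≤ (fromℕ-mono c≤a) (0≤value w))))

  value<1 : ∀ {l} (w : Vec (Fin b) l) → value w ℚ.< 1ℚ

  head< : ∀ {l c} (a : Fin b) (w : Vec (Fin b) l) → toℕ a ℕ.< c → value (a ∷ w) ℚ.< + c / b
  head< {c = c} a w a<c = subst (value (a ∷ w) ℚ.<_) (sym (/≡* c b)) (ℚ.*-monoˡ-<-pos b⁻¹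
    (ℚ.<-≤-trans (ℚ.+-monoʳ-< (fromℕ (toℕ a)) (value<1 w))
      (subst (ℚ._≤ fromℕ c) (fromℕ-suc (toℕ a)) (fromℕ-mono a<c))))

  value<1 []      = ℚ.positive⁻¹ 1ℚ
  value<1 (a ∷ w) = subst (value (a ∷ w) ℚ.<_) (n/n≡1 b) (head< a w (Fin.toℕ<n a))

  does-≤? : ∀ {l} c (a : Fin b) (w : Vec (Fin b) l) →
    does ((+ c / b) ℚ.≤? value (a ∷ w)) ≡ does (c ℕ.≤? toℕ a)
  does-≤? c a w = does-⇔ (mk⇔
    (λ h → ℕ.≮⇒≥ λ a<c → ℚ.<-irrefl refl (ℚ.≤-<-trans h (head< a w a<c)))
    (head≤ a w)) ((+ c / b) ℚ.≤? value (a ∷ w)) (c ℕ.≤? toℕ a)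

  does-<? : ∀ {l} c (a : Fin b) (w : Vec (Fin b) l) →
    does (value (a ∷ w) ℚ.<? (+ c / b)) ≡ does (toℕ a ℕ.<? c)
  does-<? c a w = does-⇔ (mk⇔
    (λ h → ℕ.≰⇒> λ c≤a → ℚ.<-irrefl refl (ℚ.≤-<-trans (head≤ a w c≤a) h))
    (head< a w)) (value (a ∷ w) ℚ.<? (+ c / b)) (toℕ a ℕ.<? c)

  value-++ : ∀ {l m} (u : Vec (Fin b) l) (v : Vec (Fin b) m) →
    ℚ.∣ value (u ++ v) ℚ.- value u ∣ ℚ.≤ b⁻¹ ^ℚ l
  value-++ []      v = resp-∣-∣≤ (sym (ℚ.+-identityʳ (value v)))
    (subst (ℚ._≤ 1ℚ) (sym (ℚ.0≤p⇒∣p∣≡p (0≤value v))) (ℚ.<⇒≤ (value<1 v)))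
  value-++ {suc l} (a ∷ u) v = resp-∣-∣≤
    (solve 4 (λ a x y q → q :* (x :- y) := (a :+ x) :* q :- (a :+ y) :* q) refl
      (fromℕ (toℕ a)) (value (u ++ v)) (value u) b⁻¹)
    (∣-∣-mono-* {b⁻¹} {value (u ++ v) ℚ.- value u}
      (ℚ.≤-reflexive (ℚ.0≤p⇒∣p∣≡p (ℚ.<⇒≤ 0<b⁻¹))) (value-++ u v))

  0≤b⁻¹^ : ∀ l → 0ℚ ℚ.≤ b⁻¹ ^ℚ l
  0≤b⁻¹^ zero    = ℚ.nonNegative⁻¹ 1ℚ
  0≤b⁻¹^ (suc l) = subst (ℚ._≤ b⁻¹ ^ℚ suc l) (ℚ.*-zeroʳ b⁻¹)
    (ℚ.*-monoˡ-≤-nonNeg b⁻¹ (0≤b⁻¹^ l))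

  b⁻¹^-decay : ∀ l → b⁻¹ ^ℚ l ℚ.* fromℕ (suc l) ℚ.≤ 1ℚ
  b⁻¹^-decay zero    = ℚ.≤-refl
  b⁻¹^-decay (suc l) = ℚ.≤-trans
    (subst (ℚ._≤ r ℚ.* L)
      (trans (solve 3 (λ q r L → r :* (q :* (L :+ con 1ℚ)) := (q :* r) :* (L :+ con 1ℚ))
               refl b⁻¹ r L)
        (cong ((b⁻¹ ℚ.* r) ℚ.*_) (sym (fromℕ-suc (suc l)))))
      (ℚ.*-monoˡ-≤-nonNeg r {{ℚ.nonNegative (0≤b⁻¹^ l)}} step))
    (b⁻¹^-decay l)
    where
    r = b⁻¹ ^ℚ l
    L = fromℕ (suc l)
    1≤L : 1ℚ ℚ.≤ L
    1≤L = fromℕ-mono {1} {suc l} (ℕ.s≤s ℕ.z≤n)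
    2*b⁻¹≤1 : fromℕ 2 ℚ.* b⁻¹ ℚ.≤ 1ℚ
    2*b⁻¹≤1 = subst (fromℕ 2 ℚ.* b⁻¹ ℚ.≤_) b*b⁻¹≡1 (*b⁻¹-mono {fromℕ 2} {fromℕ b} (fromℕ-mono {2} {b} (ℕ.nonTrivial⇒n>1 b)))
    step : b⁻¹ ℚ.* (L ℚ.+ 1ℚ) ℚ.≤ L
    step = ℚ.≤-trans (ℚ.*-monoˡ-≤-nonNeg b⁻¹ (ℚ.+-monoʳ-≤ L 1≤L))
      (subst₂ ℚ._≤_
        (solve 2 (λ q L → (con (fromℕ 2) :* q) :* L := q :* (L :+ L)) refl b⁻¹ L)
        (ℚ.*-identityˡ L)
        (ℚ.*-monoʳ-≤-nonNeg L {{ℚ.nonNegative (0≤fromℕ (suc l))}} 2*b⁻¹≤1))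

  small-power : ∀ K ε → 0ℚ ℚ.≤ K → 0ℚ ℚ.< ε →
                ∃ λ L → ∀ {l} → L ℕ.≤ l → K ℚ.* b⁻¹ ^ℚ l ℚ.≤ ε
  small-power K ε 0≤K 0<ε =
    let L , h = archimedean K 0<ε
    in L , λ {l} L≤l → ℚ.*-cancelʳ-≤-pos (fromℕ (suc l)) {{ℚ.normalize-pos (suc l) 1}}
       (ℚ.≤-trans
         (subst₂ ℚ._≤_ (sym (ℚ.*-assoc K (b⁻¹ ^ℚ l) (fromℕ (suc l)))) (ℚ.*-identityʳ K)
           (ℚ.*-monoˡ-≤-nonNeg K {{ℚ.nonNegative 0≤K}} (b⁻¹^-decay l)))
         (ℚ.≤-trans (ℚ.<⇒≤ h)
           (ℚ.*-monoˡ-≤-nonNeg ε {{ℚ.nonNegative (ℚ.<⇒≤ 0<ε)}} (fromℕ-mono (ℕ.s≤s L≤l)))))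

  0≤bound : ∀ {f} (f-i : IsIntegrable f) → 0ℚ ℚ.≤ bound f-i
  0≤bound {f} f-i = ℚ.≤-trans (ℚ.0≤∣p∣ (f 0ℚ)) (∣f∣≤bound f-i [])

  integrable-≗ : ∀ {f g} → (∀ x → f x ≡ g x) → IsIntegrable f → IsIntegrable g
  integrable-≗ f≗g f-i = record
    { bound          = bound f-i
    ; ∣f∣≤bound      = λ w → resp-∣-∣≤ (f≗g (value w)) (∣f∣≤bound f-i w)
    ; oscillation    = λ ε 0<ε → let L , h = oscillation f-i ε 0<ε in
        L , λ L≤l u v → resp-∣-∣≤
          (cong₂ ℚ._-_ (f≗g (value (u ++ v))) (f≗g (value u))) (h L≤l u v)
    }

  integrable-const : ∀ c → IsIntegrable (const c)
  integrable-const c = record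
    { bound          = ℚ.∣ c ∣
    ; ∣f∣≤bound      = λ _ → ℚ.≤-refl
    ; oscillation    = λ ε 0<ε → 0 , λ _ _ _ → ℚ.<⇒≤ (∣p-p∣<ε c 0<ε)
    }

  integrable-* : ∀ {f g} → IsIntegrable f → IsIntegrable g →
                 IsIntegrable (λ x → f x ℚ.* g x)
  integrable-* {f} {g} f-i g-i = record
    { bound          = bound f-i ℚ.* bound g-i
    ; ∣f∣≤bound      = λ w → ∣-∣-mono-* {f (value w)} (∣f∣≤bound f-i w) (∣f∣≤bound g-i w)
    ; oscillation    = λ ε 0<ε →
        let δ , 0<δ , small = share (bound f-i) (bound g-i) ε (0≤bound f-i) (0≤bound g-i) 0<ε
            M , h = oscillation f-i δ 0<δ
            N , k = oscillation g-i δ 0<δ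
        in M ℕ.⊔ N , λ p u v → ℚ.≤-trans
           (close-* (f (value (u ++ v))) (g (value (u ++ v))) (f (value u)) (g (value u))
             (∣f∣≤bound f-i (u ++ v)) (∣f∣≤bound g-i u) (h (⊔ˡ p) u v) (k (⊔ʳ p) u v))
           (ℚ.<⇒≤ small)
    }

  integrable-^ : ∀ {f} n → IsIntegrable f → IsIntegrable (λ x → f x ^ℚ n)
  integrable-^ zero    f-i = integrable-const 1ℚ
  integrable-^ (suc n) f-i = integrable-* f-i (integrable-^ n f-i)

  ∣value∣≤1 : ∀ {l} (w : Vec (Fin b) l) → ℚ.∣ value w ∣ ℚ.≤ 1ℚ
  ∣value∣≤1 w = subst (ℚ._≤ 1ℚ) (sym (ℚ.0≤p⇒∣p∣≡p (0≤value w))) (ℚ.<⇒≤ (value<1 w))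

  integrable-shift : ∀ c → IsIntegrable (c ℚ.+_)
  integrable-shift c = record
    { bound          = ℚ.∣ c ∣ ℚ.+ 1ℚ
    ; ∣f∣≤bound      = λ w → ℚ.≤-trans (ℚ.∣p+q∣≤∣p∣+∣q∣ c (value w))
                              (ℚ.+-monoʳ-≤ ℚ.∣ c ∣ (∣value∣≤1 w))
    ; oscillation    = λ ε 0<ε →
        let L , h = small-power 1ℚ ε (ℚ.nonNegative⁻¹ 1ℚ) 0<ε
        in L , λ {l} L≤l u v → resp-∣-∣≤
           (solve 3 (λ c x y → x :- y := c :+ x :- (c :+ y)) refl
             c (value (u ++ v)) (value u))
           (ℚ.≤-trans (value-++ u v)
             (subst (ℚ._≤ ε) (ℚ.*-identityˡ (b⁻¹ ^ℚ l)) (h L≤l)))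
    }

  -- A ⊆ [b⁻¹,1) is a union of intervals [a/b, (a+1)/b).
  record FirstDigitSet (A : ℚ → Bool) : Set where
    field
      member  : Fin b → Bool
      correct : ∀ {l} a (w : Vec (Fin b) l) → A (value (a ∷ w)) ≡ member a
      zero∉A  : A 0ℚ ≡ false
      nonzero : ∀ a → member a ≡ true → 1 ℕ.≤ toℕ a

  open FirstDigitSet

  recip-≢0 : ∀ {p} (p≢0 : ℚ.NonZero p) → recip p ≡ (ℚ.1/ p) {{p≢0}}
  recip-≢0 {p} p≢0 with p ℚ.≟ 0ℚ
  ... | yes refl = contradiction p≢0 λ ()
  ... | no  _    = refl

  recip-bound : ∀ {p} → b⁻¹ ℚ.≤ p → p ℚ.* recip p ≡ 1ℚ × ℚ.∣ recip p ∣ ℚ.≤ fromℕ b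
  recip-bound {p} b⁻¹≤p = subst (λ r → p ℚ.* r ≡ 1ℚ × ℚ.∣ r ∣ ℚ.≤ fromℕ b)
    (sym (recip-≢0 p≢0)) (ℚ.*-inverseʳ p , subst (ℚ._≤ fromℕ b) (sym (ℚ.0≤p⇒∣p∣≡p (ℚ.<⇒≤ 0<1/p)))
      (ℚ.*-cancelˡ-≤-pos b⁻¹ (subst₂ ℚ._≤_ refl
        (trans (sym b*b⁻¹≡1) (ℚ.*-comm (fromℕ b) b⁻¹))
        (subst (b⁻¹ ℚ.* ℚ.1/ p ℚ.≤_) (ℚ.*-inverseʳ p)
          (ℚ.*-monoʳ-≤-nonNeg (ℚ.1/ p) {{ℚ.nonNegative (ℚ.<⇒≤ 0<1/p)}} b⁻¹≤p)))))
    where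
    instance
      p>0 = ℚ.positive (ℚ.<-≤-trans 0<b⁻¹ b⁻¹≤p)
      p≢0 = ℚ.pos⇒nonZero p
    0<1/p : 0ℚ ℚ.< ℚ.1/ p
    0<1/p = ℚ.positive⁻¹ (ℚ.1/ p) {{ℚ.1/pos⇒pos p}}

  recip-close : ∀ {p q δ} → b⁻¹ ℚ.≤ p → b⁻¹ ℚ.≤ q → ℚ.∣ p ℚ.- q ∣ ℚ.≤ δ →
    ℚ.∣ recip p ℚ.- recip q ∣ ℚ.≤ (fromℕ b ℚ.* fromℕ b) ℚ.* δ
  recip-close {p} {q} {δ} hp hq h =
    let p*p′ , p′≤b = recip-bound hp
        q*q′ , q′≤b = recip-bound hq
        p′ = recip p
        q′ = recip q
    in resp-∣-∣≤
         (trans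
           (solve 4 (λ p q p′ q′ → (p′ :* q′) :* (q :- p) :=
              p′ :* (q :* q′) :- q′ :* (p :* p′)) refl p q p′ q′)
           (trans (cong₂ (λ s t → p′ ℚ.* s ℚ.- q′ ℚ.* t) q*q′ p*p′)
             (cong₂ ℚ._-_ (ℚ.*-identityʳ p′) (ℚ.*-identityʳ q′))))
         (∣-∣-mono-* {p′ ℚ.* q′} {q ℚ.- p}
           (∣-∣-mono-* {p′} {q′} p′≤b q′≤b)
           (subst (ℚ._≤ δ) (∣p-q∣≡∣q-p∣ p q) h))

  integrable-𝟙 : ∀ {A} → FirstDigitSet A → IsIntegrable (𝟙 A)
  integrable-𝟙 {A} A-fd = record
    { bound          = 1ℚ
    ; ∣f∣≤bound      = λ w → bound-𝟙 (A (value w))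
    ; oscillation    = λ ε 0<ε → 1 , λ where
        (ℕ.s≤s _) (a ∷ u) v → ℚ.≤-trans (same a u v) (ℚ.<⇒≤ 0<ε)
    }
    where
    bound-𝟙 : ∀ t → ℚ.∣ if t then 1ℚ else 0ℚ ∣ ℚ.≤ 1ℚ
    bound-𝟙 true  = ℚ.≤-refl
    bound-𝟙 false = ℚ.nonNegative⁻¹ 1ℚ
    same : ∀ {l m} a (u : Vec (Fin b) l) (v : Vec (Fin b) m) →
      ℚ.∣ 𝟙 A (value (a ∷ u ++ v)) ℚ.- 𝟙 A (value (a ∷ u)) ∣ ℚ.≤ 0ℚ
    same a u v = ℚ.≤-reflexive (cong ℚ.∣_∣ (trans
      (cong (λ t → (if t then 1ℚ else 0ℚ) ℚ.- 𝟙 A (value (a ∷ u)))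
        (trans (correct A-fd a (u ++ v)) (sym (correct A-fd a u))))
      (ℚ.+-inverseʳ (𝟙 A (value (a ∷ u))))))

  integrable-𝟙/ : ∀ {A} → FirstDigitSet A → IsIntegrable (λ x → 𝟙 A x ℚ.* recip x)
  integrable-𝟙/ {A} A-fd = record
    { bound          = fromℕ b
    ; ∣f∣≤bound      = bounded-f
    ; oscillation    = λ ε 0<ε →
        let L , h = small-power (fromℕ b ℚ.* fromℕ b) ε 0≤b*b 0<ε
        in suc L , λ where
          p@(ℕ.s≤s _) (a ∷ u) v → near 0<ε a u v (h (ℕ.≤-trans (ℕ.n≤1+n L) p))
    }
    where
    0≤b*b : 0ℚ ℚ.≤ fromℕ b ℚ.* fromℕ b
    0≤b*b = subst (ℚ._≤ fromℕ b ℚ.* fromℕ b) (ℚ.*-zeroˡ (fromℕ b))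
      (ℚ.*-monoʳ-≤-nonNeg (fromℕ b) {{ℚ.nonNegative (0≤fromℕ b)}} (0≤fromℕ b))
    ∣if∣ : ∀ {p c} t → 0ℚ ℚ.≤ c → (t ≡ true → ℚ.∣ p ∣ ℚ.≤ c) →
      ℚ.∣ (if t then 1ℚ else 0ℚ) ℚ.* p ∣ ℚ.≤ c
    ∣if∣ {p} false 0≤c h = resp-∣-∣≤ (sym (ℚ.*-zeroˡ p)) 0≤c
    ∣if∣ {p} true  0≤c h = resp-∣-∣≤ (sym (ℚ.*-identityˡ p)) (h refl)
    bounded-f : ∀ {l} (w : Vec (Fin b) l) →
      ℚ.∣ 𝟙 A (value w) ℚ.* recip (value w) ∣ ℚ.≤ fromℕ b
    bounded-f [] = ∣if∣ (A 0ℚ) (0≤fromℕ b) λ h →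
      contradiction (trans (sym h) (zero∉A A-fd)) λ ()
    bounded-f (a ∷ w) = ∣if∣ (A (value (a ∷ w))) (0≤fromℕ b) λ h →
      proj₂ (recip-bound (head≤ a w (nonzero A-fd a (trans (sym (correct A-fd a w)) h))))
    near : ∀ {ε l m} → 0ℚ ℚ.< ε → ∀ a (u : Vec (Fin b) l) (v : Vec (Fin b) m) →
      (fromℕ b ℚ.* fromℕ b) ℚ.* b⁻¹ ^ℚ (suc l) ℚ.≤ ε →
      ℚ.∣ 𝟙 A (value (a ∷ u ++ v)) ℚ.* recip (value (a ∷ u ++ v)) ℚ.-
          𝟙 A (value (a ∷ u)) ℚ.* recip (value (a ∷ u)) ∣ ℚ.≤ ε
    near {ε} 0<ε a u v h = resp-∣-∣≤
      (trans (solve 3 (λ t x y → t :* (x :- y) := t :* x :- t :* y) refl t x y)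
        (cong₂ (λ s s′ → (if s then 1ℚ else 0ℚ) ℚ.* x ℚ.- (if s′ then 1ℚ else 0ℚ) ℚ.* y)
          (sym (correct A-fd a (u ++ v))) (sym (correct A-fd a u))))
      (∣if∣ (member A-fd a) (ℚ.<⇒≤ 0<ε) λ eq → ℚ.≤-trans
        (recip-close (head≤ a (u ++ v) (nonzero A-fd a eq)) (head≤ a u (nonzero A-fd a eq))
          (value-++ (a ∷ u) v))
        h)
      where
      t = if member A-fd a then 1ℚ else 0ℚ
      x = recip (value (a ∷ u ++ v))
      y = recip (value (a ∷ u))

  integrable-recip^ : ∀ {A} → FirstDigitSet A → ∀ j →
                      IsIntegrable (λ x → 𝟙 A x ℚ.* recip x ^ℚ j)
  integrable-recip^ {A} A-fd j = integrable-≗ pointwise-≡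
    (integrable-* (integrable-𝟙 A-fd) (integrable-^ j (integrable-𝟙/ A-fd)))
    where
    pointwise-≡ : ∀ x → 𝟙 A x ℚ.* (𝟙 A x ℚ.* recip x) ^ℚ j ≡ 𝟙 A x ℚ.* recip x ^ℚ j
    pointwise-≡ x with A x
    ... | false = trans (ℚ.*-zeroˡ ((0ℚ ℚ.* recip x) ^ℚ j)) (sym (ℚ.*-zeroˡ (recip x ^ℚ j)))
    ... | true  = cong (λ y → 1ℚ ℚ.* y ^ℚ j) (ℚ.*-identityˡ (recip x))

  [b⁻¹,1⟩-firstDigit : FirstDigitSet [ b⁻¹ , 1ℚ ⟩
  [b⁻¹,1⟩-firstDigit = record
    { member  = λ a → does (1 ℕ.≤? toℕ a) ∧ does (toℕ a ℕ.<? b)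
    ; correct = λ a w → cong₂ _∧_ (does-≤? 1 a w)
        (trans (cong (λ t → does (value (a ∷ w) ℚ.<? t)) (sym (n/n≡1 b))) (does-<? b a w))
    ; zero∉A  = cong (_∧ does (0ℚ ℚ.<? 1ℚ)) (dec-false (b⁻¹ ℚ.≤? 0ℚ) λ h →
        ℚ.<-irrefl refl (ℚ.<-≤-trans 0<b⁻¹ h))
    ; nonzero = λ a h → ℕ.≤ᵇ⇒≤ 1 (toℕ a) (∧-left h)
    }
    where
    ∧-left : ∀ {s t} → s ∧ t ≡ true → T s
    ∧-left {true} _ = _

  ∖-firstDigit : ∀ {A} → FirstDigitSet A → ∀ c →
                 FirstDigitSet (A ∖ [ + c / b , + suc c / b ⟩)
  ∖-firstDigit A-fd c = record
    { member  = λ a → member A-fd a ∧ not (does (c ℕ.≤? toℕ a) ∧ does (toℕ a ℕ.<? suc c))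
    ; correct = λ a w → cong₂ (λ s t → s ∧ not t) (correct A-fd a w)
        (cong₂ _∧_ (does-≤? c a w) (does-<? (suc c) a w))
    ; zero∉A  = cong (_∧ not _) (zero∉A A-fd)
    ; nonzero = λ a h → nonzero A-fd a (∧-left h)
    }
    where
    ∧-left : ∀ {s t} → s ∧ t ≡ true → s ≡ true
    ∧-left {true} _ = refl

  -- 1 / (bʲ - b + 1); the subtraction is not truncated, as j ≥ 1.
  λℚ : (j : ℕ) .{{_ : NonZero j}} → ℚ
  λℚ j = + 1 / suc (b ℕ.^ j ℕ.∸ b)

  module _ (d : Fin b) where

    ν : (j : ℕ) .{{_ : NonZero j}} → DigitLaw b
    ν j = record
      { prob        = p
      ; nonNegative = λ a → 0≤p (does (a Fin.≟ d))
      ; total       = trans (sum-if d (+ suc (b ℕ.^ j ℕ.∸ b) / b ℕ.^ j) q) p-total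
      }
      where
      instance
        b^j≢0 : NonZero (b ℕ.^ j)
        b^j≢0 = ℕ.m^n≢0 b j
      q = + 1 / b ℕ.^ j
      p : Fin b → ℚ
      p a = if does (a Fin.≟ d) then + suc (b ℕ.^ j ℕ.∸ b) / b ℕ.^ j else + 1 / b ℕ.^ j
      0≤p : ∀ t → 0ℚ ℚ.≤ (if t then + suc (b ℕ.^ j ℕ.∸ b) / b ℕ.^ j else + 1 / b ℕ.^ j)
      0≤p true  = ℚ.nonNegative⁻¹ _ {{ℚ.normalize-nonNeg (suc (b ℕ.^ j ℕ.∸ b)) (b ℕ.^ j)}}
      0≤p false = ℚ.nonNegative⁻¹ _ {{ℚ.normalize-nonNeg 1 (b ℕ.^ j)}}
      b≤b^ : ∀ j .{{_ : NonZero j}} → b ℕ.≤ b ℕ.^ j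
      b≤b^ (suc j) = ℕ.m≤m*n b (b ℕ.^ j) {{ℕ.m^n≢0 b j}}
      count : suc (b ℕ.^ j ℕ.∸ b) ℕ.+ pred b ≡ b ℕ.^ j
      count = trans (sym (ℕ.+-suc (b ℕ.^ j ℕ.∸ b) (pred b)))
        (trans (cong (b ℕ.^ j ℕ.∸ b ℕ.+_) (ℕ.suc-pred b)) (ℕ.m∸n+n≡m (b≤b^ j)))
      p-total : + suc (b ℕ.^ j ℕ.∸ b) / b ℕ.^ j ℚ.+ fromℕ (pred b) ℚ.* q ≡ 1ℚ
      p-total = trans
        (cong (ℚ._+ fromℕ (pred b) ℚ.* q) (/≡* (suc (b ℕ.^ j ℕ.∸ b)) (b ℕ.^ j)))
        (trans (sym (ℚ.*-distribʳ-+ q (fromℕ (suc (b ℕ.^ j ℕ.∸ b))) (fromℕ (pred b))))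
        (trans (cong (ℚ._* q) (trans (fromℕ-+ (suc (b ℕ.^ j ℕ.∸ b)) (pred b)) (cong fromℕ count)))
        (trans (sym (/≡* (b ℕ.^ j) (b ℕ.^ j))) (n/n≡1 (b ℕ.^ j)))))

    F F* : (j : ℕ) .{{_ : NonZero j}} → ℝ
    F  j = ∫ (λ x → 𝟙 [ b⁻¹ , 1ℚ ⟩ x ℚ.* recip x ^ℚ j)
             (integrable-recip^ [b⁻¹,1⟩-firstDigit j) (ν j)
    F* j = ∫ (λ x → 𝟙 ([ b⁻¹ , 1ℚ ⟩ ∖ [ + toℕ d / b , + suc (toℕ d) / b ⟩) x ℚ.* recip x ^ℚ j)
             (integrable-recip^ (∖-firstDigit [b⁻¹,1⟩-firstDigit (toℕ d)) j) (ν j)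

    -- ∫ (d + x)ᵐ dνᵢ(x)
    moment : (m i : ℕ) .{{_ : NonZero i}} → ℝ
    moment m i = ∫ (λ x → (fromℕ (toℕ d) ℚ.+ x) ^ℚ m)
                   (integrable-^ m (integrable-shift (fromℕ (toℕ d)))) (ν i)

    q : (i j : ℕ) .{{_ : NonZero i}} → ℝ
    q i j = if does (i ℕ.≤? j)
            then (- 1ℝ) ^ (j ℕ.∸ i) * fromℚ (fromℕ (pred j C pred i)) * moment (j ℕ.∸ i) i
            else 0ℝ

    Q : Matrix
    Q i j = q (suc i) (suc j)

    Q-unipotent : IsUnipotent Q
    Q-unipotent = upper , unit
      where
      module R = CommutativeRing ℝ-commutativeRing
      entry : ℕ → ℕ → ℕ → ℝ
      entry m n i = (- 1ℝ) ^ m * fromℚ (fromℕ n) * moment m (suc i)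
      upper : IsUpperTriangular Q
      upper {i} {j} j<i = R.reflexive
        (cong (λ t → if t then entry (j ℕ.∸ i) (j C i) i else 0ℝ)
          (dec-false (suc i ℕ.≤? suc j) (ℕ.<⇒≱ (ℕ.s≤s j<i))))
      diagonal : ∀ i → Q i i ≡ entry 0 1 i
      diagonal i = trans
        (cong (λ t → if t then entry (i ℕ.∸ i) (i C i) i else 0ℝ)
          (dec-true (suc i ℕ.≤? suc i) ℕ.≤-refl))
        (cong₂ (λ m n → entry m n i) (ℕ.n∸n≡0 i) (nCn≡1 i))
      unit : ∀ i → Q i i ≈ 1ℝ
      unit i = subst (_≈ 1ℝ) (sym (diagonal i)) (pointwise {entry 0 1 i} {1ℝ} λ l →
        trans (ℚ.*-identityˡ (seq (moment 0 (suc i)) l)) (𝔼-const (ν (suc i)) l 1ℚ))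

    Q⁻¹ : Matrix
    Q⁻¹ = inverse Q

    Q⁻¹-isInverse : IsInverse Q Q⁻¹
    Q⁻¹-isInverse = inverse-isInverse Q-unipotent

    c : (j : ℕ) .{{_ : NonZero j}} → ℝ
    c j = Q⁻¹ 0 (pred j)

    occurrences : ℕ → ℕ
    occurrences n = List.length (List.filter (Fin._≟ d) (digits n))

    irwinTerm : ℕ → (n : ℕ) .{{_ : NonZero n}} → ℚ
    irwinTerm k n = if does (occurrences n ℕ.≟ k) then + 1 / n else 0ℚ

    IsIrwinSum : ℕ → ℝ → Set
    IsIrwinSum k = HasSum λ n → fromℚ (irwinTerm k (suc n))

{-# OPTIONS --safe #-}
module Submission where

-- Let Eᵢ be the expectation under νᵢ and Hᵢ(y) = Eᵢ (y + x)⁻ⁱ. Self-similarity of νᵢ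
-- gives Hᵢ(n) = Σₐ Hᵢ(bn + a), the term a = d being multiplied by λᵢ⁻¹. Summing over
-- the n with k digits d and telescoping, one finds that Σₙ Hᵢ(bn + d) is Fᵢ λᵢᵏ⁺¹, or
-- Fᵢ* λᵢ for k = 0. So it suffices that Σᵢ cᵢ Hᵢ(bn + d) = 1/(bn), with enough uniformity
-- to be summed over n.
--
-- The cᵢ are characterized by Λ((s - z)ʲ) = 0ʲ, where z = d + x and Λ is the functional
-- sⁱ⁻¹ f(x) ↦ cᵢ Eᵢ f on polynomials in s; hence Λ((s - z + e)ʲ) = eʲ for all e. Expanding
-- 1/(y + z - s) in powers of s - z + e with e = d + 1, and applying Λ, gives the
-- identity, given a bound for the cᵢ. The latter is obtained for e = d + 0.ddd…:
-- since νᵢ is concentrated near 0.ddd…, the recursion eʲ = Λ((s - z + e)ʲ) for the cᵢ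
-- then has coefficients which are small off the diagonal.
--
-- A real is a Cauchy sequence of rationals whose l-th term is computed from the laws
-- of the first l digits. For each l all identities above hold exactly, except for
-- self-similarity, which relates the levels l and l + 1.

open import Algebra.Bundles using (CommutativeRing)
import Algebra.Properties.CommutativeSemiring.Exp as Exp
import Algebra.Properties.Semiring.Sum as Sum
open import Data.Bool.Base using (Bool; true; false; if_then_else_; _∧_; not)
open import Data.Bool.Properties using (∧-zeroʳ)
open import Data.Fin.Base as Fin using (Fin; toℕ)
import Data.Fin.Properties as Fin
import Data.Integer.Base as ℤ
open import Data.List.Base as List using () renaming (_∷_ to _∷ˡ_)
open import Data.Nat.Base as ℕ using (ℕ; zero; suc; pred; NonZero; NonTrivial)
open import Data.Nat.Combinatorics using (_C_)
import Data.Nat.Combinatorics as ℕ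
import Data.Nat.DivMod as ℕ
import Data.Nat.Properties as ℕ
open import Data.Product.Base using (∃; _×_; _,_; proj₁; proj₂)
open import Data.Rational.Base as ℚ using (ℚ; 0ℚ; 1ℚ; ½; _/_)
import Data.Rational.Properties as ℚ
open import Data.Rational.Solver using (module +-*-Solver)
open import Data.Sum.Base using (_⊎_; inj₁; inj₂)
open import Data.Unit.Base using (tt)
open import Data.Vec.Base using (Vec; []; _∷_; _++_)
open import Function.Base using (_∘_; const)
open import Function.Bundles using (mk⇔)
open import Relation.Binary.PropositionalEquality hiding (setoid; [_])
open import Relation.Nullary using (Dec; yes; no; does; contradiction; ¬_)
open import Relation.Nullary.Decidable using (_×-dec_; dec-true; dec-false; does-⇔; from-yes)
open import Defs hiding
  ( _+_; _*_; _-_; -_; _≤_; ∣_∣; Matrix; Σ<; Σ<-cong; Σ<-zero; Σ<-+; Σ<-comm; Σ<-*ˡ; Σ<-*ʳ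
  ; Σ<-extend; module UpperTriangularMatrices)
import Defs

open +-*-Solver using (solve; con; _:=_; _:+_; _:*_; _:-_; :-_)

-- The quantitative obstacle is the growth of the `cⱼ`. For n ≥ 1, `Hⱼ(bn + d) ≤ (b + d)⁻ʲ`, so the
-- series is under control once `|cⱼ| ≤ K rʲ` with r < b + d. The margin is thin for b = 2, and the
-- constants are adjusted to b = 2, d = 0, where r = 7/4 against b + d = 2. Two centres e occur
-- because they serve opposite purposes. For e = d + 1 the number `e - z = 1 - x` lies in [0,1], so
-- the remainders are nonnegative and can be majorized; but the recursion centred there may have
-- large coefficients, as for d = 0, where x is mostly near 0. For e = d + 0.ddd... the moments of
-- `e - z` are small, but `e - z` need not be nonnegative. Three parameters tend to infinity: the
-- number J of terms, the length N of the integers n, and the level l. The bound for the `cⱼ` at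
-- level l is available for the first J of them only once l is large, and self-similarity over n <
-- bᴺ has an error that vanishes as l grows with N fixed. Hence J is chosen first, then N, then l,
-- and K must not depend on any of them.

module ℚΣ = Sum (CommutativeRing.semiring ℚ.+-*-commutativeRing)
module ℚ^ = Exp (CommutativeRing.commutativeSemiring ℚ.+-*-commutativeRing)
module ℚM = Defs.UpperTriangularMatrices ℚ.+-*-commutativeRing

open ℚM using (Σ<; Σ<-cong; Σ<-zero; Σ<-+; Σ<-comm; Σ<-*ˡ; Σ<-*ʳ; Σ<-extend)

-- Inequalities for rationals and their powers.

module _ where
  open import Data.Rational.Base using (_+_; _*_; _-_; -_; _≤_; _<_; ∣_∣)

  ≤-by : ∀ {p q r} → 0ℚ ≤ r → q ≡ p + r → p ≤ q
  ≤-by {p} {q} {r} 0≤r refl = subst (_≤ p + r) (ℚ.+-identityʳ p) (ℚ.+-monoʳ-≤ p 0≤r)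

  0≤- : ∀ {p q} → p ≤ q → 0ℚ ≤ q - p
  0≤- {p} {q} p≤q = subst (_≤ q - p) (ℚ.+-inverseʳ p) (ℚ.+-monoˡ-≤ (- p) p≤q)

  0≤+ : ∀ {p q} → 0ℚ ≤ p → 0ℚ ≤ q → 0ℚ ≤ p + q
  0≤+ = ℚ.+-mono-≤

  *-mono-≤ : ∀ {p q r s} → 0ℚ ≤ p → p ≤ q → 0ℚ ≤ r → r ≤ s → p * r ≤ q * s
  *-mono-≤ {p} {q} {r} {s} 0≤p p≤q 0≤r r≤s = ℚ.≤-trans
    (ℚ.*-monoʳ-≤-nonNeg r {{ℚ.nonNegative 0≤r}} p≤q)
    (ℚ.*-monoˡ-≤-nonNeg q {{ℚ.nonNegative (ℚ.≤-trans 0≤p p≤q)}} r≤s)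

  *-monoˡ-≤ : ∀ {p q} r → 0ℚ ≤ r → p ≤ q → r * p ≤ r * q
  *-monoˡ-≤ r 0≤r = ℚ.*-monoˡ-≤-nonNeg r {{ℚ.nonNegative 0≤r}}

  *-monoʳ-≤ : ∀ {p q} r → 0ℚ ≤ r → p ≤ q → p * r ≤ q * r
  *-monoʳ-≤ r 0≤r = ℚ.*-monoʳ-≤-nonNeg r {{ℚ.nonNegative 0≤r}}

  0≤* : ∀ {p q} → 0ℚ ≤ p → 0ℚ ≤ q → 0ℚ ≤ p * q
  0≤* {p} {q} 0≤p 0≤q = subst (_≤ p * q) (ℚ.*-zeroʳ p) (*-monoˡ-≤ p 0≤p 0≤q)

  0<* : ∀ {p q} → 0ℚ < p → 0ℚ < q → 0ℚ < p * q
  0<* {p} {q} 0<p 0<q = subst (_< p * q) (ℚ.*-zeroʳ p)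
    (ℚ.*-monoʳ-<-pos p {{ℚ.positive 0<p}} 0<q)

  p*q≤p : ∀ {p q} → 0ℚ ≤ p → q ≤ 1ℚ → p * q ≤ p
  p*q≤p {p} {q} 0≤p q≤1 = subst (p * q ≤_) (ℚ.*-identityʳ p) (*-monoˡ-≤ p 0≤p q≤1)

  0≤1 : 0ℚ ≤ 1ℚ
  0≤1 = ℚ.nonNegative⁻¹ 1ℚ

  0<1 : 0ℚ < 1ℚ
  0<1 = ℚ.positive⁻¹ 1ℚ

  1^≡1 : ∀ n → 1ℚ ^ℚ n ≡ 1ℚ
  1^≡1 zero    = refl
  1^≡1 (suc n) = trans (ℚ.*-identityˡ (1ℚ ^ℚ n)) (1^≡1 n)

  0≤^ : ∀ {p} n → 0ℚ ≤ p → 0ℚ ≤ p ^ℚ n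
  0≤^ zero    0≤p = 0≤1
  0≤^ (suc n) 0≤p = 0≤* 0≤p (0≤^ n 0≤p)

  ^-mono : ∀ {p q} n → 0ℚ ≤ p → p ≤ q → p ^ℚ n ≤ q ^ℚ n
  ^-mono zero    0≤p p≤q = ℚ.≤-refl
  ^-mono (suc n) 0≤p p≤q = *-mono-≤ 0≤p p≤q (0≤^ n 0≤p) (^-mono n 0≤p p≤q)

  ^≤1 : ∀ {p} n → 0ℚ ≤ p → p ≤ 1ℚ → p ^ℚ n ≤ 1ℚ
  ^≤1 zero    0≤p p≤1 = ℚ.≤-refl
  ^≤1 (suc n) 0≤p p≤1 = *-mono-≤ 0≤p p≤1 (0≤^ n 0≤p) (^≤1 n 0≤p p≤1)

  1≤^ : ∀ {p} n → 1ℚ ≤ p → 1ℚ ≤ p ^ℚ n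
  1≤^ zero    1≤p = ℚ.≤-refl
  1≤^ (suc n) 1≤p = *-mono-≤ 0≤1 1≤p 0≤1 (1≤^ n 1≤p)

  ^-antimono : ∀ {p m n} → 0ℚ ≤ p → p ≤ 1ℚ → m ℕ.≤ n → p ^ℚ n ≤ p ^ℚ m
  ^-antimono {n = n} 0≤p p≤1 ℕ.z≤n       = ^≤1 n 0≤p p≤1
  ^-antimono         0≤p p≤1 (ℕ.s≤s m≤n) = *-monoˡ-≤ _ 0≤p (^-antimono 0≤p p≤1 m≤n)

  ∣^∣ : ∀ p n → ∣ p ^ℚ n ∣ ≡ ∣ p ∣ ^ℚ n
  ∣^∣ p zero    = refl
  ∣^∣ p (suc n) = trans (ℚ.∣p*q∣≡∣p∣*∣q∣ p (p ^ℚ n)) (cong (∣ p ∣ *_) (∣^∣ p n))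

  ∣^-^∣ : ∀ {p q} n → ∣ p ∣ ≤ 1ℚ → ∣ q ∣ ≤ 1ℚ →
          ∣ p ^ℚ n - q ^ℚ n ∣ ≤ fromℕ n * ∣ p - q ∣
  ∣^-^∣ {p} {q} zero    p≤1 q≤1 = ℚ.≤-reflexive (sym (ℚ.*-zeroˡ ∣ p - q ∣))
  ∣^-^∣ {p} {q} (suc n) p≤1 q≤1 = subst (∣ p ^ℚ suc n - q ^ℚ suc n ∣ ≤_)
    (trans (solve 2 (λ n δ → con 1ℚ :* (n :* δ) :+ δ :* con 1ℚ := (n :+ con 1ℚ) :* δ) refl
             (fromℕ n) ∣ p - q ∣)
      (cong (_* ∣ p - q ∣) (sym (fromℕ-suc n))))
    (close-* p (p ^ℚ n) q (q ^ℚ n) p≤1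
      (subst (_≤ 1ℚ) (sym (∣^∣ q n)) (^≤1 n (ℚ.0≤∣p∣ q) q≤1)) ℚ.≤-refl (∣^-^∣ n p≤1 q≤1))

  ∣p∣≤ : ∀ {p q} → p ≤ q → - p ≤ q → ∣ p ∣ ≤ q
  ∣p∣≤ {p} p≤q -p≤q with ℚ.∣p∣≡p∨∣p∣≡-p p
  ... | inj₁ e rewrite e = p≤q
  ... | inj₂ e rewrite e = -p≤q

  ∣-∣-triangle : ∀ p q r {ε δ} → ∣ p - q ∣ ≤ ε → ∣ q - r ∣ ≤ δ → ∣ p - r ∣ ≤ ε + δ
  ∣-∣-triangle p q r h k = ℚ.≤-trans (triangle p q r) (ℚ.+-mono-≤ h k)

  -- Bernoulli's inequality without division. The left side decreases with `l`: consecutive values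
  -- differ by `θˡ (l + 1) (1 - θ)²`.
  bernoulli : ∀ {θ} l → 0ℚ ≤ θ → θ ≤ 1ℚ → θ ^ℚ l * (1ℚ + fromℕ l * (1ℚ - θ)) ≤ 1ℚ
  bernoulli {θ} zero    0≤θ θ≤1 = ℚ.≤-reflexive
    (solve 1 (λ θ → con 1ℚ :* (con 1ℚ :+ con 0ℚ :* (con 1ℚ :- θ)) := con 1ℚ) refl θ)
  bernoulli {θ} (suc l) 0≤θ θ≤1 = ℚ.≤-trans
    (≤-by
      (0≤* (0≤* (0≤^ l 0≤θ) (0≤+ (0≤fromℕ′ l) 0≤1)) (0≤* (0≤- θ≤1) (0≤- θ≤1)))
      (trans
        (solve 3 (λ θ P L →
          P :* (con 1ℚ :+ L :* (con 1ℚ :- θ)) :=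
          θ :* P :* (con 1ℚ :+ (L :+ con 1ℚ) :* (con 1ℚ :- θ)) :+
          P :* (L :+ con 1ℚ) :* ((con 1ℚ :- θ) :* (con 1ℚ :- θ))) refl θ (θ ^ℚ l) (fromℕ l))
        (cong (λ L → θ ^ℚ suc l * (1ℚ + L * (1ℚ - θ)) +
                     θ ^ℚ l * (fromℕ l + 1ℚ) * ((1ℚ - θ) * (1ℚ - θ))) (sym (fromℕ-suc l)))))
    (bernoulli l 0≤θ θ≤1)
    where
    0≤fromℕ′ : ∀ n → 0ℚ ≤ fromℕ n
    0≤fromℕ′ n = fromℕ-mono {0} {n} ℕ.z≤n

  -- Once `K ≤ ε (1 + l (1 - θ))`, which holds for large `l`, multiplication by `θ ^ℚ l` gives the
  -- bound by `bernoulli`.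
  geometric-decay : ∀ {θ} K ε → 0ℚ ≤ θ → θ < 1ℚ → 0ℚ ≤ K → 0ℚ < ε →
                    ∃ λ L → ∀ l → L ℕ.≤ l → K * θ ^ℚ l ≤ ε
  geometric-decay {θ} K ε 0≤θ θ<1 0≤K 0<ε = suc L , λ l L<l → ℚ.≤-trans
    (*-monoʳ-≤ (θ ^ℚ l) (0≤^ l 0≤θ) (K≤ l L<l))
    (subst (_≤ ε) (solve 3 (λ ε θ B → ε :* (θ :* B) := ε :* B :* θ) refl ε (θ ^ℚ l) _)
      (p*q≤p (ℚ.<⇒≤ 0<ε) (bernoulli l 0≤θ (ℚ.<⇒≤ θ<1))))
    where
    0<δ : 0ℚ < 1ℚ - θ
    0<δ = subst (_< 1ℚ - θ) (ℚ.+-inverseʳ θ) (ℚ.+-monoˡ-< (- θ) θ<1)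
    0<εδ : 0ℚ < ε * (1ℚ - θ)
    0<εδ = 0<* 0<ε 0<δ
    L = proj₁ (archimedean K 0<εδ)
    K≤ : ∀ l → suc L ℕ.≤ l → K ≤ ε * (1ℚ + fromℕ l * (1ℚ - θ))
    K≤ l L<l = ℚ.≤-trans (ℚ.<⇒≤ (proj₂ (archimedean K 0<εδ)))
      (ℚ.≤-trans (*-monoˡ-≤ _ (ℚ.<⇒≤ 0<εδ) (fromℕ-mono L<l))
        (≤-by (ℚ.<⇒≤ 0<ε) (solve 3 (λ ε δ l →
          ε :* (con 1ℚ :+ l :* δ) := ε :* δ :* l :+ ε) refl ε (1ℚ - θ) (fromℕ l))))

-- Finite sums, expectations and iterated limits.

module _ where
  open import Data.Rational.Base using (_+_; _*_; _-_; -_; _≤_; _<_; ∣_∣)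

  Σ<-mono : ∀ n {f g} → (∀ k → k ℕ.< n → f k ≤ g k) → Σ< n f ≤ Σ< n g
  Σ<-mono zero    f≤g = ℚ.≤-refl
  Σ<-mono (suc n) f≤g =
    ℚ.+-mono-≤ (Σ<-mono n λ k k<n → f≤g k (ℕ.m<n⇒m<1+n k<n)) (f≤g n ℕ.≤-refl)

  0≤Σ< : ∀ n {f} → (∀ k → 0ℚ ≤ f k) → 0ℚ ≤ Σ< n f
  0≤Σ< zero    0≤f = ℚ.≤-refl
  0≤Σ< (suc n) 0≤f = 0≤+ (0≤Σ< n 0≤f) (0≤f n)

  ∣Σ<∣ : ∀ n f → ∣ Σ< n f ∣ ≤ Σ< n λ k → ∣ f k ∣
  ∣Σ<∣ zero    f = ℚ.≤-refl
  ∣Σ<∣ (suc n) f = ℚ.≤-trans (ℚ.∣p+q∣≤∣p∣+∣q∣ (Σ< n f) (f n)) (ℚ.+-monoˡ-≤ ∣ f n ∣ (∣Σ<∣ n f))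

  Σ<-monoˡ : ∀ {m n f} → (∀ k → 0ℚ ≤ f k) → m ℕ.≤ n → Σ< m f ≤ Σ< n f
  Σ<-monoˡ {m} {n} {f} 0≤f m≤n = helper (ℕ.≤⇒≤′ m≤n)
    where
    helper : ∀ {n} → m ℕ.≤′ n → Σ< m f ≤ Σ< n f
    helper ℕ.≤′-refl        = ℚ.≤-refl
    helper (ℕ.≤′-step m≤′n) = ℚ.≤-trans (helper m≤′n)
      (≤-by (0≤f _) refl)

  Σ<-- : ∀ n f g → Σ< n (λ k → f k - g k) ≡ Σ< n f - Σ< n g
  Σ<-- zero    f g = refl
  Σ<-- (suc n) f g = trans (cong (_+ (f n - g n)) (Σ<-- n f g))
    (solve 4 (λ s t x y → s :- t :+ (x :- y) := s :+ x :- (t :+ y)) refl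
      (Σ< n f) (Σ< n g) (f n) (g n))

  Σ<-split : ∀ m n f → Σ< (m ℕ.+ n) f ≡ Σ< m f + Σ< n λ k → f (m ℕ.+ k)
  Σ<-split m zero    f rewrite ℕ.+-identityʳ m = sym (ℚ.+-identityʳ _)
  Σ<-split m (suc n) f rewrite ℕ.+-suc m n =
    trans (cong (_+ f (m ℕ.+ n)) (Σ<-split m n f)) (ℚ.+-assoc (Σ< m f) (Σ< n λ k → f (m ℕ.+ k)) (f (m ℕ.+ n)))

  Σ<-first : ∀ n f → Σ< (suc n) f ≡ f 0 + Σ< n (f ∘ suc)
  Σ<-first n f = trans (Σ<-split 1 n f)
    (cong (_+ Σ< n (f ∘ suc)) (ℚ.+-identityˡ (f 0)))

  Σ<-sum : ∀ n f → Σ< n f ≡ ℚΣ.sum {n} (f ∘ toℕ)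
  Σ<-sum zero    f = refl
  Σ<-sum (suc n) f = trans (Σ<-first n f) (cong (f 0 +_) (Σ<-sum n (f ∘ suc)))

  Σ<-blocks : ∀ b m f → Σ< (m ℕ.* b) f ≡ Σ< m λ n → ℚΣ.sum {b} λ a → f (n ℕ.* b ℕ.+ toℕ a)
  Σ<-blocks b zero    f = refl
  Σ<-blocks b (suc m) f = trans (cong (λ n → Σ< n f) (ℕ.+-comm b (m ℕ.* b)))
    (trans (Σ<-split (m ℕ.* b) b f)
      (cong₂ _+_ (Σ<-blocks b m f) (Σ<-sum b λ k → f (m ℕ.* b ℕ.+ k))))

  sum-mono : ∀ {n} {f g : Fin n → ℚ} → (∀ a → f a ≤ g a) → ℚΣ.sum f ≤ ℚΣ.sum g
  sum-mono {zero}  f≤g = ℚ.≤-refl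
  sum-mono {suc n} f≤g = ℚ.+-mono-≤ (f≤g Fin.zero) (sum-mono (f≤g ∘ Fin.suc))

  0≤sum : ∀ {n} {f : Fin n → ℚ} → (∀ a → 0ℚ ≤ f a) → 0ℚ ≤ ℚΣ.sum f
  0≤sum {zero}  0≤f = ℚ.≤-refl
  0≤sum {suc n} 0≤f = 0≤+ (0≤f Fin.zero) (0≤sum (0≤f ∘ Fin.suc))

  sum-pick : ∀ {n} (d : Fin n) (f g : Fin n → ℚ) →
    ℚΣ.sum (λ a → if does (a Fin.≟ d) then f a else g a) ≡
    f d + ℚΣ.sum (λ a → if does (a Fin.≟ d) then 0ℚ else g a)
  sum-pick {suc n} Fin.zero    f g = cong (f Fin.zero +_) (sym (ℚ.+-identityˡ _))
  sum-pick {suc n} (Fin.suc d) f g =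
    trans (cong (g Fin.zero +_) (sum-pick d (f ∘ Fin.suc) (g ∘ Fin.suc)))
      (solve 3 (λ x y z → x :+ (y :+ z) := y :+ (x :+ z)) refl (g Fin.zero) (f (Fin.suc d)) _)

  sum-pick-* : ∀ {n} (d : Fin n) (t : ℚ) (f : Fin n → ℚ) →
    ℚΣ.sum (λ a → (if does (a Fin.≟ d) then t else 1ℚ) * f a) ≡
    t * f d + ℚΣ.sum (λ a → if does (a Fin.≟ d) then 0ℚ else f a)
  sum-pick-* d t f = trans (ℚΣ.sum-cong-≗ λ a → if-* (does (a Fin.≟ d)) a)
    (sum-pick d (λ a → t * f a) f)
    where
    if-* : ∀ x a → (if x then t else 1ℚ) * f a ≡ (if x then t * f a else f a)
    if-* true  a = refl
    if-* false a = ℚ.*-identityˡ (f a)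

  module _ {b} (μ : DigitLaw b) where
    open DigitLaw μ using (prob; nonNegative)

    𝔼-cong : ∀ l {f g} → (∀ w → f w ≡ g w) → 𝔼 μ l f ≡ 𝔼 μ l g
    𝔼-cong zero    f≗g = f≗g []
    𝔼-cong (suc l) f≗g =
      ℚΣ.sum-cong-≗ λ a → cong (prob a *_) (𝔼-cong l λ w → f≗g (a ∷ w))

    𝔼-+ : ∀ l f g → 𝔼 μ l (λ w → f w + g w) ≡ 𝔼 μ l f + 𝔼 μ l g
    𝔼-+ zero    f g = refl
    𝔼-+ (suc l) f g = trans
      (ℚΣ.sum-cong-≗ λ a → trans (cong (prob a *_) (𝔼-+ l (f ∘ (a ∷_)) (g ∘ (a ∷_))))
        (ℚ.*-distribˡ-+ (prob a) (𝔼 μ l (f ∘ (a ∷_))) (𝔼 μ l (g ∘ (a ∷_)))))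
      (ℚΣ.∑-distrib-+ (λ a → prob a * 𝔼 μ l (f ∘ (a ∷_))) (λ a → prob a * 𝔼 μ l (g ∘ (a ∷_))))

    𝔼-* : ∀ l x f → 𝔼 μ l (λ w → x * f w) ≡ x * 𝔼 μ l f
    𝔼-* zero    x f = refl
    𝔼-* (suc l) x f = trans
      (ℚΣ.sum-cong-≗ λ a → trans (cong (prob a *_) (𝔼-* l x (f ∘ (a ∷_))))
        (solve 3 (λ p x e → p :* (x :* e) := x :* (p :* e)) refl (prob a) x _))
      (sym (ℚΣ.*-distribˡ-sum x (λ a → prob a * 𝔼 μ l (f ∘ (a ∷_)))))

    𝔼-mono : ∀ l {f g} → (∀ w → f w ≤ g w) → 𝔼 μ l f ≤ 𝔼 μ l g
    𝔼-mono zero    f≤g = f≤g []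
    𝔼-mono (suc l) f≤g =
      sum-mono λ a → *-monoˡ-≤ (prob a) (nonNegative a) (𝔼-mono l λ w → f≤g (a ∷ w))

    𝔼≤ : ∀ l {f x} → (∀ w → f w ≤ x) → 𝔼 μ l f ≤ x
    𝔼≤ l {f} {x} f≤x = subst (𝔼 μ l f ≤_) (𝔼-const μ l x) (𝔼-mono l f≤x)

    0≤𝔼 : ∀ l {f} → (∀ w → 0ℚ ≤ f w) → 0ℚ ≤ 𝔼 μ l f
    0≤𝔼 l {f} 0≤f = subst (_≤ 𝔼 μ l f) (𝔼-const μ l 0ℚ) (𝔼-mono l 0≤f)

    ∣𝔼∣ : ∀ l f → ∣ 𝔼 μ l f ∣ ≤ 𝔼 μ l (λ w → ∣ f w ∣)
    ∣𝔼∣ l f = ∣p∣≤ (𝔼-mono l λ w → p≤∣p∣ (f w))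
      (subst (_≤ 𝔼 μ l (λ w → ∣ f w ∣)) (trans (𝔼-* l (- 1ℚ) f) (neg-one (𝔼 μ l f)))
        (𝔼-mono l λ w → subst (_≤ ∣ f w ∣) (sym (neg-one (f w)))
          (subst (- f w ≤_) (ℚ.∣-p∣≡∣p∣ (f w)) (p≤∣p∣ (- f w)))))
      where
      neg-one : ∀ p → - 1ℚ * p ≡ - p
      neg-one = solve 1 (λ p → con (- 1ℚ) :* p := :- p) refl
      p≤∣p∣ : ∀ p → p ≤ ∣ p ∣
      p≤∣p∣ p with ℚ.≤-total 0ℚ p
      ... | inj₁ 0≤p = ℚ.≤-reflexive (sym (ℚ.0≤p⇒∣p∣≡p 0≤p))
      ... | inj₂ p≤0 = ℚ.≤-trans p≤0 (ℚ.0≤∣p∣ p)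

  Eventually : (ℕ → Set) → Set
  Eventually P = ∃ λ L → ∀ l → L ℕ.≤ l → P l

  eventually-× : ∀ {P Q} → Eventually P → Eventually Q → Eventually λ l → P l × Q l
  eventually-× (L , p) (M , q) = L ℕ.⊔ M , λ l h → p l (⊔ˡ h) , q l (⊔ʳ h)

  eventually-map : ∀ {P Q : ℕ → Set} → (∀ l → P l → Q l) → Eventually P → Eventually Q
  eventually-map f (L , p) = L , λ l h → f l (p l h)

  eventually-∀< : ∀ {P : ℕ → ℕ → Set} n → (∀ k → k ℕ.< n → Eventually (P k)) →
                  Eventually λ l → ∀ k → k ℕ.< n → P k l
  eventually-∀< zero    h = 0 , λ _ _ _ ()
  eventually-∀< {P} (suc n) h = eventually-map split
    (eventually-× (eventually-∀< {P} n λ k k<n → h k (ℕ.m<n⇒m<1+n k<n)) (h n ℕ.≤-refl))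
    where
    split : ∀ l → (∀ k → k ℕ.< n → P k l) × P n l → ∀ k → k ℕ.< suc n → P k l
    split l (p , q) k k<1+n with ℕ.m≤n⇒m<n∨m≡n (ℕ.≤-pred k<1+n)
    ... | inj₁ k<n  = p k k<n
    ... | inj₂ refl = q

  infix 4 _⇝_

  -- An iterated limit: how large the level `l` must be may depend on `N`. Here `N` bounds the
  -- number of digits of the integers summed over, and errors such as `bᴺ βˡ` vanish only in this
  -- order.
  record _⇝_ (f g : ℕ → ℕ → ℚ) : Set where
    constructor mk⇝
    field
      within : ∀ ε → 0ℚ < ε → Eventually λ N → Eventually λ l → ∣ f N l - g N l ∣ ≤ ε

  open _⇝_ public

  ⇝-reflexive : ∀ {f g} → (∀ N l → f N l ≡ g N l) → f ⇝ g
  ⇝-reflexive {f} {g} f≗g = mk⇝ λ ε 0<ε → 0 , λ N _ → 0 , λ l _ →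
    subst (λ p → ∣ p - g N l ∣ ≤ ε) (sym (f≗g N l)) (ℚ.<⇒≤ (∣p-p∣<ε (g N l) 0<ε))

  ⇝-trans : ∀ {f g h} → f ⇝ g → g ⇝ h → f ⇝ h
  ⇝-trans {f} {g} {h} p q = mk⇝ λ ε 0<ε → eventually-map
    (λ N (r , s) → eventually-map
      (λ l (u , v) → subst (∣ f N l - h N l ∣ ≤_) (½+½ ε)
        (∣-∣-triangle (f N l) (g N l) (h N l) u v))
      (eventually-× r s))
    (eventually-× (within p (½ * ε) (½>0 0<ε)) (within q (½ * ε) (½>0 0<ε)))

  ⇝-+ : ∀ {f g f′ g′} → f ⇝ g → f′ ⇝ g′ → (λ N l → f N l + f′ N l) ⇝ (λ N l → g N l + g′ N l)
  ⇝-+ {f} {g} {f′} {g′} p q = mk⇝ λ ε 0<ε → eventually-map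
    (λ N (r , s) → eventually-map
      (λ l (u , v) → resp-∣-∣≤
        (solve 4 (λ x y x′ y′ → (x :- y) :+ (x′ :- y′) := x :+ x′ :- (y :+ y′)) refl
          (f N l) (g N l) (f′ N l) (g′ N l))
        (subst (∣ (f N l - g N l) + (f′ N l - g′ N l) ∣ ≤_) (½+½ ε)
          (ℚ.≤-trans (ℚ.∣p+q∣≤∣p∣+∣q∣ (f N l - g N l) (f′ N l - g′ N l)) (ℚ.+-mono-≤ u v))))
      (eventually-× r s))
    (eventually-× (within p (½ * ε) (½>0 0<ε)) (within q (½ * ε) (½>0 0<ε)))

  ⇝-* : ∀ {f g} x → f ⇝ g → (λ N l → x * f N l) ⇝ (λ N l → x * g N l)
  ⇝-* {f} {g} x p = mk⇝ λ ε 0<ε →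
    let δ , 0<δ , small = share ∣ x ∣ 0ℚ ε (ℚ.0≤∣p∣ x) ℚ.≤-refl 0<ε
    in eventually-map
      (λ N → eventually-map λ l h → resp-∣-∣≤
        (solve 3 (λ x y z → x :* (y :- z) := x :* y :- x :* z) refl x (f N l) (g N l))
        (ℚ.≤-trans (∣-∣-mono-* {x} ℚ.≤-refl h) (ℚ.<⇒≤ (subst (_< ε)
          (solve 2 (λ x δ → x :* δ :+ δ :* con 0ℚ := x :* δ) refl ∣ x ∣ δ) small))))
      (within p δ 0<δ)

-- Polynomials in s and the truncated expansion of 1/(w - v - s).

-- A polynomial in an indeterminate s with coefficients depending on a point x:
-- P i x is the coefficient of sⁱ.
Poly : Set
Poly = ℕ → ℚ → ℚ

module _ where
  open import Data.Rational.Base using (_+_; _*_; _-_; -_; _≤_; _<_; ∣_∣)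

  -- Multiplication by s + f(x).
  mul : (ℚ → ℚ) → Poly → Poly
  mul f P zero    x = f x * P zero x
  mul f P (suc i) x = P i x + f x * P (suc i) x

  one : Poly
  one zero    _ = 1ℚ
  one (suc _) _ = 0ℚ

  pow : (ℚ → ℚ) → ℕ → Poly
  pow f zero    = one
  pow f (suc j) = mul f (pow f j)

  binomial : ℕ → ℕ → ℚ → ℚ
  binomial j i p = fromℕ (j C i) * p ^ℚ (j ℕ.∸ i)

  binomial-> : ∀ {i j} p → j ℕ.< i → binomial j i p ≡ 0ℚ
  binomial-> {i} {j} p j<i = trans
    (cong (λ n → fromℕ n * p ^ℚ (j ℕ.∸ i)) (ℕ.k>n⇒nCk≡0 j<i)) (ℚ.*-zeroˡ (p ^ℚ (j ℕ.∸ i)))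

  binomial-diagonal : ∀ j p → binomial j j p ≡ 1ℚ
  binomial-diagonal j p = cong₂ (λ m n → fromℕ m * p ^ℚ n) (ℕ.nCn≡1 j) (ℕ.n∸n≡0 j)

  nC0≡1 : ∀ n → n C 0 ≡ 1
  nC0≡1 n = trans (ℕ.nCk≡nC[n∸k] {0} {n} ℕ.z≤n) (ℕ.nCn≡1 n)

  pow≡binomial : ∀ f j i x → pow f j i x ≡ binomial j i (f x)
  pow≡binomial f zero    zero    x = refl
  pow≡binomial f zero    (suc i) x = sym (binomial-> {suc i} {zero} (f x) (ℕ.s≤s ℕ.z≤n))
  pow≡binomial f (suc j) zero    x = trans (cong (f x *_) (pow≡binomial f j zero x))
    (trans (solve 3 (λ p n q → p :* (n :* q) := n :* (p :* q)) refl
             (f x) (fromℕ (j C 0)) (f x ^ℚ j))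
      (cong (λ n → fromℕ n * f x ^ℚ suc j) (trans (nC0≡1 j) (sym (nC0≡1 (suc j))))))
  pow≡binomial f (suc j) (suc i) x = trans
    (cong₂ (λ s t → s + f x * t) (pow≡binomial f j i x) (pow≡binomial f j (suc i) x))
    (trans (cong (binomial j i (f x) +_) shift)
      (trans (sym (ℚ.*-distribʳ-+ P (fromℕ (j C i)) (fromℕ (j C suc i))))
        (cong (_* P) (trans (fromℕ-+ (j C i) (j C suc i))
          (cong fromℕ (ℕ.nCk+nC[k+1]≡[n+1]C[k+1] j i))))))
    where
    P = f x ^ℚ (j ℕ.∸ i)
    shift : f x * binomial j (suc i) (f x) ≡ fromℕ (j C suc i) * P
    shift with suc i ℕ.≤? j
    ... | yes i<j = trans
      (solve 3 (λ p n q → p :* (n :* q) := n :* (p :* q)) refl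
        (f x) (fromℕ (j C suc i)) (f x ^ℚ (j ℕ.∸ suc i)))
      (cong (λ n → fromℕ (j C suc i) * f x ^ℚ n) (sym (ℕ.+-∸-assoc 1 i<j)))
    ... | no  i≮j = trans (cong (f x *_) (binomial-> (f x) j<1+i))
      (trans (ℚ.*-zeroʳ (f x)) (sym (trans (cong (λ n → fromℕ n * P) (ℕ.k>n⇒nCk≡0 j<1+i))
        (ℚ.*-zeroˡ P))))
      where
      j<1+i : j ℕ.< suc i
      j<1+i = ℕ.≰⇒> i≮j

  -- The upper half of the binomial theorem, for any number `n` of its nonnegative terms. The
  -- induction on `j` follows `mul`: the shifted copy of the coefficients yields the factor `α`, the
  -- other copy the factor `ρ`.
  Σ<-binomial : ∀ j n {α ρ} → 0ℚ ≤ α → 0ℚ ≤ ρ →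
                Σ< n (λ i → α ^ℚ i * binomial j i ρ) ≤ (α + ρ) ^ℚ j
  Σ<-binomial j n {α} {ρ} 0≤α 0≤ρ = subst (_≤ (α + ρ) ^ℚ j)
    (Σ<-cong n λ i _ → cong (α ^ℚ i *_) (pow≡binomial (const ρ) j i 0ℚ)) (helper j n)
    where
    P : ℕ → ℕ → ℚ
    P j i = pow (const ρ) j i 0ℚ
    helper : ∀ j n → Σ< n (λ i → α ^ℚ i * P j i) ≤ (α + ρ) ^ℚ j
    helper j       zero    = 0≤^ j (0≤+ 0≤α 0≤ρ)
    helper zero    (suc n) = ℚ.≤-reflexive (trans (Σ<-first n _)
      (cong (1ℚ +_) (Σ<-zero n λ i _ → ℚ.*-zeroʳ (α ^ℚ suc i))))
    helper (suc j) (suc n) = ℚ.≤-trans (ℚ.≤-reflexive expand)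
      (subst (α * Σ< n (λ i → α ^ℚ i * P j i) + ρ * Σ< (suc n) (λ i → α ^ℚ i * P j i) ≤_)
        (sym (ℚ.*-distribʳ-+ ((α + ρ) ^ℚ j) α ρ))
        (ℚ.+-mono-≤ (*-monoˡ-≤ α 0≤α (helper j n)) (*-monoˡ-≤ ρ 0≤ρ (helper j (suc n)))))
      where
      A = λ i → α ^ℚ i * P j i
      expand : Σ< (suc n) (λ i → α ^ℚ i * P (suc j) i) ≡ α * Σ< n A + ρ * Σ< (suc n) A
      expand = trans (Σ<-first n _) (trans
        (cong (α ^ℚ 0 * P (suc j) 0 +_) (trans
          (Σ<-cong n λ i _ → solve 5 (λ α ρ a p p′ → (α :* a) :* (p :+ ρ :* p′) :=
             α :* (a :* p) :+ ρ :* ((α :* a) :* p′)) refl α ρ (α ^ℚ i) (P j i) (P j (suc i)))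
          (trans (Σ<-+ n _ _) (cong₂ _+_ (sym (Σ<-*ˡ n α A)) (sym (Σ<-*ˡ n ρ (A ∘ suc)))))))
        (trans (solve 4 (λ ρ p s t → con 1ℚ :* (ρ :* p) :+ (s :+ ρ :* t) :=
                  s :+ ρ :* (con 1ℚ :* p :+ t)) refl ρ (P j 0) (α * Σ< n A) (Σ< n (A ∘ suc)))
          (cong (λ s → α * Σ< n A + ρ * s) (sym (Σ<-first n A)))))

  -- The coefficients of the expansion of 1/(w - v - s) in powers of s + v,
  -- truncated after J terms, where ω = 1/w.
  partialSum : ℚ → (ℚ → ℚ) → ℕ → Poly
  partialSum ω v zero    i x = 0ℚ
  partialSum ω v (suc J) i x = ω * (one i x + mul v (partialSum ω v J) i x)

  -- The recursion of `partialSum` with the number `e` in place of the factor s + v. For v = e - z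
  -- this is the value of the truncated expansion at s = z.
  geometric : ℚ → ℚ → ℕ → ℚ
  geometric ω e zero    = 0ℚ
  geometric ω e (suc J) = ω * (1ℚ + e * geometric ω e J)

  -- For ω = 1/w the hypothesis says η = 1/(w - e). It makes η a fixed point of the recursion, and
  -- each step multiplies the error by `e * ω`.
  geometric-remainder : ∀ {ω e η} → ω * (1ℚ + e * η) ≡ η → ∀ J →
                        η - geometric ω e J ≡ (e * ω) ^ℚ J * η
  geometric-remainder {ω} {e} {η} fixed zero    =
    solve 1 (λ η → η :- con 0ℚ := con 1ℚ :* η) refl η
  geometric-remainder {ω} {e} {η} fixed (suc J) = trans
    (cong (_- geometric ω e (suc J)) (sym fixed))
    (trans (solve 4 (λ ω e η g → ω :* (con 1ℚ :+ e :* η) :- ω :* (con 1ℚ :+ e :* g) :=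
              (e :* ω) :* (η :- g)) refl ω e η (geometric ω e J))
      (trans (cong (e * ω *_) (geometric-remainder fixed J))
        (sym (ℚ.*-assoc (e * ω) ((e * ω) ^ℚ J) η))))

  -- The bound is the majorant obtained by replacing v by q ≥ 1 ≥ v, for which
  -- the terms of degree ≥ J - i in v gain the factor pᴶ⁻ⁱ, p = 1/q.
  remainder-bound : ∀ {ω w q p κ γ} (v : ℚ → ℚ) x → 0ℚ ≤ ω → w * ω ≡ 1ℚ →
    1ℚ ≤ q → q * p ≡ 1ℚ → 0ℚ ≤ p → 0ℚ ≤ κ → κ * (w - q) ≡ 1ℚ →
    0ℚ ≤ v x → v x ≤ 1ℚ → 0ℚ ≤ γ → γ ≤ κ → γ * (w - v x) ≡ 1ℚ → ∀ J i →
    let R = γ ^ℚ suc i - partialSum ω v J i x in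
    0ℚ ≤ R × R ≤ q ^ℚ i * p ^ℚ J * κ ^ℚ suc i
  remainder-bound {ω} {w} {q} {p} {κ} {γ} v x 0≤ω wω≡1 1≤q qp≡1 0≤p 0≤κ κ-inv 0≤v v≤1 0≤γ γ≤κ γ-inv =
    λ J i → 0≤R J i , R≤B J i
    where
    0≤q = ℚ.≤-trans 0≤1 1≤q
    -- The coefficients of the full expansion of 1/(w - v - s) in powers of s, as γ = 1/(w - v).
    g : Poly
    g i _ = γ ^ℚ suc i
    B : ℕ → Poly
    B J i _ = q ^ℚ i * p ^ℚ J * κ ^ℚ suc i
    R : ℕ → Poly
    R J i x = g i x - partialSum ω v J i x
    0≤B : ∀ J i → 0ℚ ≤ B J i x
    0≤B J i = 0≤* (0≤* (0≤^ i 0≤q) (0≤^ J 0≤p)) (0≤^ (suc i) 0≤κ)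

    cancel-ω : ∀ {s t} → w * s ≡ t → s ≡ ω * t
    cancel-ω {s} {t} h = trans (sym (ℚ.*-identityˡ s)) (trans (cong (_* s) (sym wω≡1))
      (trans (solve 3 (λ w o s → w :* o :* s := o :* (w :* s)) refl w ω s) (cong (ω *_) h)))

    g-step : ∀ i → g i x ≡ ω * (one i x + mul v g i x)
    g-step zero    = cancel-ω (trans
      (solve 3 (λ w v γ → w :* (γ :* con 1ℚ) := γ :* (w :- v) :+ v :* (γ :* con 1ℚ)) refl w (v x) γ)
      (cong (_+ v x * (γ * 1ℚ)) γ-inv))
    g-step (suc i) = cancel-ω (trans
      (solve 4 (λ w v γ G → w :* (γ :* G) := γ :* (w :- v) :* G :+ v :* (γ :* G)) refl w (v x) γ (γ ^ℚ suc i))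
      (trans (cong (λ s → s * γ ^ℚ suc i + v x * (γ * γ ^ℚ suc i)) γ-inv)
        (solve 2 (λ G t → con 1ℚ :* G :+ t := con 0ℚ :+ (G :+ t)) refl
          (γ ^ℚ suc i) (v x * (γ * γ ^ℚ suc i)))))

    mul-- : ∀ P Q i → mul v P i x - mul v Q i x ≡ mul v (λ i x → P i x - Q i x) i x
    mul-- P Q zero    = solve 3 (λ v p q → v :* p :- v :* q := v :* (p :- q)) refl
      (v x) (P 0 x) (Q 0 x)
    mul-- P Q (suc i) = solve 5 (λ v p q p′ q′ → p :+ v :* p′ :- (q :+ v :* q′) :=
      p :- q :+ v :* (p′ :- q′)) refl (v x) (P i x) (Q i x) (P (suc i) x) (Q (suc i) x)

    mul-mono : ∀ P Q i → (∀ i → P i x ≤ Q i x) → mul v P i x ≤ mul v Q i x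
    mul-mono P Q zero    h = *-monoˡ-≤ (v x) 0≤v (h zero)
    mul-mono P Q (suc i) h = ℚ.+-mono-≤ (h i) (*-monoˡ-≤ (v x) 0≤v (h (suc i)))

    R-step : ∀ J i → R (suc J) i x ≡ ω * mul v (R J) i x
    R-step J i = trans (cong (_- partialSum ω v (suc J) i x) (g-step i))
      (trans (solve 4 (λ ω o s t → ω :* (o :+ s) :- ω :* (o :+ t) := ω :* (s :- t)) refl
          ω (one i x) (mul v g i x) (mul v (partialSum ω v J) i x))
        (cong (ω *_) (mul-- g (partialSum ω v J) i)))

    -- Since `w κ = 1 + q κ`, the right side is `B J (i - 1) + B J i` in degree i ≥ 1, so there the
    -- inequality would be an equality with 1 in place of `v x ≤ 1`. In degree 0 the right side
    -- exceeds `B J 0` by `pᴶ⁺¹`.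
    B-step : ∀ J i → mul v (B J) i x ≤ w * B (suc J) i x
    B-step J zero    = ≤-by (0≤+ (0≤* (0≤- v≤1) (0≤B J 0)) (0≤* (0≤^ (suc J) 0≤p) 0≤1))
      (trans (solve 6 (λ w v q p κ P →
          w :* (con 1ℚ :* (p :* P) :* (κ :* con 1ℚ)) :=
          (q :* p) :* (κ :* P) :+ (κ :* (w :- q)) :* (p :* P :* con 1ℚ)) refl
          w (v x) q p κ (p ^ℚ J))
        (trans (cong₂ (λ s t → s * (κ * p ^ℚ J) + t * (p * p ^ℚ J * 1ℚ)) qp≡1 κ-inv)
          (solve 4 (λ v p κ P → con 1ℚ :* (κ :* P) :+ con 1ℚ :* (p :* P :* con 1ℚ) :=
            v :* (con 1ℚ :* P :* (κ :* con 1ℚ)) :+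
            ((con 1ℚ :- v) :* (con 1ℚ :* P :* (κ :* con 1ℚ)) :+ p :* P :* con 1ℚ)) refl
            (v x) p κ (p ^ℚ J))))
    B-step J (suc i) = ≤-by (0≤* (0≤- v≤1) (0≤B J (suc i)))
      (trans (solve 7 (λ w q p κ Q P K →
          w :* (q :* Q :* (p :* P) :* (κ :* K)) :=
          (q :* p) :* (q :* Q :* P :* (κ :* K)) :+ (q :* p) :* ((κ :* (w :- q)) :* (Q :* P :* K)))
          refl w q p κ (q ^ℚ i) (p ^ℚ J) (κ ^ℚ suc i))
        (trans (cong₂ (λ s t → s * (q * q ^ℚ i * p ^ℚ J * (κ * κ ^ℚ suc i)) +
                                s * (t * (q ^ℚ i * p ^ℚ J * κ ^ℚ suc i))) qp≡1 κ-inv)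
          (solve 6 (λ v q κ Q P K →
            con 1ℚ :* (q :* Q :* P :* (κ :* K)) :+ con 1ℚ :* (con 1ℚ :* (Q :* P :* K)) :=
            Q :* P :* K :+ v :* (q :* Q :* P :* (κ :* K)) :+
            (con 1ℚ :- v) :* (q :* Q :* P :* (κ :* K))) refl
            (v x) q κ (q ^ℚ i) (p ^ℚ J) (κ ^ℚ suc i))))

    0≤mulR : ∀ J i → (∀ i → 0ℚ ≤ R J i x) → 0ℚ ≤ mul v (R J) i x
    0≤mulR J zero    h = 0≤* 0≤v (h zero)
    0≤mulR J (suc i) h = 0≤+ (h i) (0≤* 0≤v (h (suc i)))

    0≤R : ∀ J i → 0ℚ ≤ R J i x
    0≤R zero    i = subst (0ℚ ≤_) (sym (ℚ.+-identityʳ (γ ^ℚ suc i))) (0≤^ (suc i) 0≤γ)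
    0≤R (suc J) i = subst (0ℚ ≤_) (sym (R-step J i)) (0≤* 0≤ω (0≤mulR J i (0≤R J)))

    R≤B : ∀ J i → R J i x ≤ B J i x
    R≤B zero    i = subst₂ _≤_ (trans (ℚ.*-identityˡ (γ ^ℚ suc i)) (sym (ℚ.+-identityʳ (γ ^ℚ suc i))))
      (cong (_* κ ^ℚ suc i) (sym (ℚ.*-identityʳ (q ^ℚ i))))
      (*-mono-≤ 0≤1 (1≤^ i 1≤q) (0≤^ (suc i) 0≤γ) (^-mono (suc i) 0≤γ γ≤κ))
    R≤B (suc J) i = subst₂ _≤_ (sym (R-step J i)) (sym (cancel-ω {B (suc J) i x} refl))
      (*-monoˡ-≤ ω 0≤ω (ℚ.≤-trans (mul-mono (R J) (B J) i (R≤B J)) (B-step J i)))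

-- The functional Λ at a fixed level.

module Umbral {b : ℕ} .{{_ : NonTrivial b}} (μ : ℕ → DigitLaw b) (z : ℚ → ℚ) (c : ℕ → ℚ) (l : ℕ) where
  open import Data.Rational.Base using (_+_; _*_; _-_; -_; _≤_; _<_; ∣_∣)
  open Base b using (value)

  E : ℕ → (ℚ → ℚ) → ℚ
  E i f = 𝔼 (μ i) l (f ∘ value)

  -- The functional with sⁱ f(x) ↦ cᵢ Eᵢ[f], on polynomials of degree < n.
  Λ : ℕ → Poly → ℚ
  Λ n P = Σ< n λ i → c i * E i (P i)

  Λ-cong : ∀ n {P R} → (∀ i x → P i x ≡ R i x) → Λ n P ≡ Λ n R
  Λ-cong n P≗R = Σ<-cong n λ i _ → cong (c i *_) (𝔼-cong (μ i) l λ w → P≗R i (value w))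

  Λ-linear : ∀ n α β P R →
    Λ n (λ i x → α * P i x + β * R i x) ≡ α * Λ n P + β * Λ n R
  Λ-linear n α β P R = trans
    (Σ<-cong n λ i _ → trans
      (cong (c i *_) (trans (𝔼-+ (μ i) l (λ w → α * P i (value w)) (λ w → β * R i (value w)))
        (cong₂ _+_ (𝔼-* (μ i) l α (P i ∘ value)) (𝔼-* (μ i) l β (R i ∘ value)))))
      (solve 5 (λ c α β p r → c :* (α :* p :+ β :* r) := α :* (c :* p) :+ β :* (c :* r)) refl
        (c i) α β (E i (P i)) (E i (R i))))
    (trans (Σ<-+ n (λ i → α * (c i * E i (P i))) (λ i → β * (c i * E i (R i))))
      (cong₂ _+_ (sym (Σ<-*ˡ n α _)) (sym (Σ<-*ˡ n β _))))

  X : ℚ → ℚ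
  X x = - z x

  δ₀ : ℕ → ℚ
  δ₀ zero    = 1ℚ
  δ₀ (suc _) = 0ℚ

  mulX^ : ℕ → Poly → Poly
  mulX^ zero    P = P
  mulX^ (suc p) P = mulX^ p (mul X P)

  mulX^-pow : ∀ p j → mulX^ p (pow X j) ≡ pow X (p ℕ.+ j)
  mulX^-pow zero    j = refl
  mulX^-pow (suc p) j = trans (mulX^-pow p (suc j)) (cong (pow X) (ℕ.+-suc p j))

  mul-linear : ∀ f α β {P R S : Poly} → (∀ i x → S i x ≡ α * P i x + β * R i x) →
               ∀ i x → mul f S i x ≡ α * mul f P i x + β * mul f R i x
  mul-linear f α β {P} {R} h zero    x = trans (cong (f x *_) (h zero x))
    (solve 5 (λ f α β p r → f :* (α :* p :+ β :* r) := α :* (f :* p) :+ β :* (f :* r)) refl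
      (f x) α β (P 0 x) (R 0 x))
  mul-linear f α β {P} {R} h (suc i) x = trans (cong₂ (λ s t → s + f x * t) (h i x) (h (suc i) x))
    (solve 7 (λ f α β p r p′ r′ →
        α :* p :+ β :* r :+ f :* (α :* p′ :+ β :* r′) := α :* (p :+ f :* p′) :+ β :* (r :+ f :* r′))
      refl (f x) α β (P i x) (R i x) (P (suc i) x) (R (suc i) x))

  mulX^-linear : ∀ p α β {P R S : Poly} → (∀ i x → S i x ≡ α * P i x + β * R i x) →
                 ∀ i x → mulX^ p S i x ≡ α * mulX^ p P i x + β * mulX^ p R i x
  mulX^-linear zero    α β h = h
  mulX^-linear (suc p) α β h = mulX^-linear p α β (mul-linear X α β h)

  -- P is a polynomial of degree < N in s - z with constant coefficients,
  -- and a is its value at s = z, as far as Λ can tell.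
  Evaluates : ℕ → Poly → ℚ → Set
  Evaluates N P a = ∀ p n → N ℕ.+ p ℕ.≤ n → Λ n (mulX^ p P) ≡ a * δ₀ p

  evaluates-weaken : ∀ {M N P a} → M ℕ.≤ N → Evaluates M P a → Evaluates N P a
  evaluates-weaken M≤N h p n N+p≤n = h p n (ℕ.≤-trans (ℕ.+-monoˡ-≤ p M≤N) N+p≤n)

  evaluates-linear : ∀ {N P R S a a′} α β → (∀ i x → S i x ≡ α * P i x + β * R i x) →
    Evaluates N P a → Evaluates N R a′ → Evaluates N S (α * a + β * a′)
  evaluates-linear {P = P} {R} {a = a} {a′} α β S≗ h k p n N+p≤n = trans
    (Λ-cong n (mulX^-linear p α β S≗))
    (trans (Λ-linear n α β (mulX^ p P) (mulX^ p R))
      (trans (cong₂ (λ s t → α * s + β * t) (h p n N+p≤n) (k p n N+p≤n))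
        (solve 5 (λ α β a a′ δ → α :* (a :* δ) :+ β :* (a′ :* δ) := (α :* a :+ β :* a′) :* δ) refl
          α β a a′ (δ₀ p))))

  evaluates-mulX : ∀ {N P a} → Evaluates N P a → Evaluates (suc N) (mul X P) 0ℚ
  evaluates-mulX {N} {a = a} h p n N+p<n = trans
    (h (suc p) n (subst (ℕ._≤ n) (sym (ℕ.+-suc N p)) N+p<n))
    (trans (ℚ.*-zeroʳ a) (sym (ℚ.*-zeroˡ (δ₀ p))))

  -- The factor s + e - z is split into s - z, after which the value is 0, and the constant `e`,
  -- which commutes with Λ. The variable z does not commute with Λ, since it depends on x.
  evaluates-mul : ∀ {N P a} e → Evaluates N P a →
                  Evaluates (suc N) (mul (λ x → e - z x) P) (e * a)
  evaluates-mul {N} {P} {a} e h = subst (Evaluates (suc N) (mul (λ x → e - z x) P))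
    (solve 2 (λ e a → con 1ℚ :* con 0ℚ :+ e :* a := e :* a) refl e a)
    (evaluates-linear {a = 0ℚ} {a} 1ℚ e split (evaluates-mulX {a = a} h)
      (evaluates-weaken {a = a} (ℕ.n≤1+n N) h))
    where
    split : ∀ i x → mul (λ x → e - z x) P i x ≡ 1ℚ * mul X P i x + e * P i x
    split zero    x = solve 3 (λ e z p → (e :- z) :* p := con 1ℚ :* ((:- z) :* p) :+ e :* p) refl
      e (z x) (P 0 x)
    split (suc i) x = solve 4 (λ e z p p′ → p :+ (e :- z) :* p′ :=
        con 1ℚ :* (p :+ (:- z) :* p′) :+ e :* p′) refl e (z x) (P i x) (P (suc i) x)

  module _ (defining : ∀ j → Λ (suc j) (pow X j) ≡ δ₀ j) where

    evaluates-one : Evaluates 1 one 1ℚ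
    evaluates-one p n p<n = trans (cong (Λ n) (mulX^-pow p 0)) (trans
      (cong (λ j → Λ n (pow X j)) (ℕ.+-identityʳ p))
      (trans (sym (Σ<-extend _ (ℕ.≤⇒≤′ p<n) λ i p<i → trans
          (cong (c i *_) (trans (𝔼-cong (μ i) l λ w → trans (pow≡binomial X p i (value w))
            (binomial-> (X (value w)) p<i)) (𝔼-const (μ i) l 0ℚ))) (ℚ.*-zeroʳ (c i))))
        (trans (defining p) (sym (ℚ.*-identityˡ (δ₀ p))))))

    evaluates-pow : ∀ e j → Evaluates (suc j) (pow (λ x → e - z x) j) (e ^ℚ j)
    evaluates-pow e zero    = evaluates-one
    evaluates-pow e (suc j) = evaluates-mul {a = e ^ℚ j} e (evaluates-pow e j)

    -- The identity `Λ((s + e - z)ʲ) = eʲ` solved for its term of degree `j`, where the polynomial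
    -- has coefficient 1. The centre `e` is free and can be chosen to make the other coefficients
    -- small.
    coefficient-recursion : ∀ e j →
      c j ≡ e ^ℚ j - Σ< j λ i → c i * E i (λ x → binomial j i (e - z x))
    coefficient-recursion e j = trans (rearrange c-j) (cong (_- rest) total)
      where
      rest = Σ< j λ i → c i * E i (λ x → binomial j i (e - z x))
      total : rest + c j * E j (λ x → binomial j j (e - z x)) ≡ e ^ℚ j
      total = trans (Λ-cong (suc j) (λ i x → sym (pow≡binomial (λ x → e - z x) j i x)))
        (trans (evaluates-pow e j 0 (suc j) (ℕ.≤-reflexive (ℕ.+-identityʳ (suc j))))
          (ℚ.*-identityʳ (e ^ℚ j)))
      c-j : c j * E j (λ x → binomial j j (e - z x)) ≡ c j
      c-j = trans (cong (c j *_) (trans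
          (𝔼-cong (μ j) l λ w → binomial-diagonal j (e - z (value w))) (𝔼-const (μ j) l 1ℚ)))
        (ℚ.*-identityʳ (c j))
      rearrange : ∀ {s t} → s ≡ t → t ≡ rest + s - rest
      rearrange {s} refl = solve 2 (λ r s → s := r :+ s :- r) refl rest s

    evaluates-partialSum : ∀ ω e J →
      Evaluates J (partialSum ω (λ x → e - z x) J) (geometric ω e J)
    evaluates-partialSum ω e zero    p n _ = trans
      (trans (Λ-cong n {R = λ i x → 0ℚ * one i x + 0ℚ * one i x} (zeros p))
        (trans (Λ-linear n 0ℚ 0ℚ one one) (solve 1 (λ s → con 0ℚ :* s :+ con 0ℚ :* s := con 0ℚ) refl (Λ n one))))
      (sym (ℚ.*-zeroˡ (δ₀ p)))
      where
      zeros : ∀ p i x → mulX^ p (partialSum ω (λ x → e - z x) 0) i x ≡ 0ℚ * one i x + 0ℚ * one i x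
      zeros p i x = trans
        (mulX^-linear p 0ℚ 0ℚ {one} {one}
          (λ i x → solve 1 (λ s → con 0ℚ := con 0ℚ :* s :+ con 0ℚ :* s) refl (one i x)) i x)
        (solve 2 (λ s t → con 0ℚ :* s :+ con 0ℚ :* s := con 0ℚ :* t :+ con 0ℚ :* t) refl
          (mulX^ p one i x) (one i x))
    evaluates-partialSum ω e (suc J) = subst (Evaluates (suc J) _)
      (solve 3 (λ ω e g → ω :* con 1ℚ :+ ω :* (e :* g) := ω :* (con 1ℚ :+ e :* g)) refl
        ω e (geometric ω e J))
      (evaluates-linear {P = one} {mul (λ x → e - z x) (partialSum ω (λ x → e - z x) J)}
        {a = 1ℚ} {e * geometric ω e J} ω ω
        (λ i x → ℚ.*-distribˡ-+ ω (one i x) (mul (λ x → e - z x) (partialSum ω (λ x → e - z x) J) i x))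
        (evaluates-weaken {a = 1ℚ} (ℕ.s≤s ℕ.z≤n) evaluates-one)
        (evaluates-mul {a = geometric ω e J} e (evaluates-partialSum ω e J)))

    Λ-partialSum : ∀ ω e J → Λ J (partialSum ω (λ x → e - z x) J) ≡ geometric ω e J
    Λ-partialSum ω e J = trans
      (evaluates-partialSum ω e J 0 J (ℕ.≤-reflexive (ℕ.+-identityʳ J)))
      (ℚ.*-identityʳ (geometric ω e J))

-- Reals read off at a fixed level.

seq-Σ< : ∀ n f l → seq (Defs.Σ< n f) l ≡ Σ< n λ k → seq (f k) l
seq-Σ< zero    f l = refl
seq-Σ< (suc n) f l = cong (ℚ._+ seq (f n) l) (seq-Σ< n f l)

seq-δ : ∀ i j l → seq (Defs.δ i j) l ≡ ℚM.δ i j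
seq-δ i j l with does (i ℕ.≟ j)
... | true  = refl
... | false = refl

-- The ring operations on reals act termwise, so level `l` of the inverse is the inverse of the
-- rational matrix at level `l`. This is what makes the identities for the `cⱼ` exact at every
-- level.
seq-row : ∀ M i n j l → seq (row M i n j) l ≡ ℚM.row (λ i j → seq (M i j) l) i n j
seq-row M i zero    j l = refl
seq-row M i (suc n) j l with does (j ℕ.<? n)
... | true  = seq-row M i n j l
... | false = cong₂ ℚ._-_ (seq-δ i n l) (trans (seq-Σ< n _ l)
  (Σ<-cong n λ k _ → cong (ℚ._* seq (M k n) l) (seq-row M i n k l)))

seq-^ : ∀ x n l → seq (x ^ n) l ≡ seq x l ^ℚ n
seq-^ x zero    l = refl
seq-^ x (suc n) l = cong (seq x l ℚ.*_) (seq-^ x n l)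

fromℕ-* : ∀ m n → fromℕ (m ℕ.* n) ≡ fromℕ m ℚ.* fromℕ n
fromℕ-* zero    n = sym (ℚ.*-zeroˡ (fromℕ n))
fromℕ-* (suc m) n = trans (sym (fromℕ-+ n (m ℕ.* n)))
  (trans (cong (fromℕ n ℚ.+_) (fromℕ-* m n))
    (trans (solve 2 (λ m n → n :+ m :* n := (m :+ con 1ℚ) :* n) refl (fromℕ m) (fromℕ n))
      (cong (ℚ._* fromℕ n) (sym (fromℕ-suc m)))))

fromℕ-^ : ∀ m n → fromℕ (m ℕ.^ n) ≡ fromℕ m ^ℚ n
fromℕ-^ m zero    = refl
fromℕ-^ m (suc n) = trans (fromℕ-* m (m ℕ.^ n)) (cong (fromℕ m ℚ.*_) (fromℕ-^ m n))

-- The base b, the laws νⱼ and their concentration.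

module BaseLemmas (b : ℕ) .{{_ : NonTrivial b}} where
  open import Data.Rational.Base using (_+_; _*_; _-_; -_; _≤_; _<_; ∣_∣)
  open Base b

  instance
    b≢0 : NonZero b
    b≢0 = ℕ.nonTrivial⇒nonZero b

  β : ℚ
  β = b⁻¹

  0≤β : 0ℚ ≤ β
  0≤β = ℚ.<⇒≤ 0<b⁻¹

  2≤b : fromℕ 2 ≤ fromℕ b
  2≤b = fromℕ-mono (ℕ.nonTrivial⇒n>1 b)

  β≤½ : β ≤ ½
  β≤½ = subst₂ _≤_ (solve 1 (λ β → con ½ :* (con (fromℕ 2) :* β) := β) refl β)
    (cong (½ *_) b*b⁻¹≡1) (*-monoˡ-≤ ½ (ℚ.nonNegative⁻¹ ½) (*-monoʳ-≤ β 0≤β 2≤b))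

  β≤1 : β ≤ 1ℚ
  β≤1 = ℚ.≤-trans β≤½ (ℚ.≤ᵇ⇒≤ tt)

  fromℕ-pred : ∀ n .{{_ : NonZero n}} → fromℕ n ≡ fromℕ (pred n) + 1ℚ
  fromℕ-pred (suc n) = fromℕ-suc n

  pred-b*β≤1 : fromℕ (pred b) * β ≤ 1ℚ
  pred-b*β≤1 = subst (fromℕ (pred b) * β ≤_) b*b⁻¹≡1
    (*-monoʳ-≤ β 0≤β (fromℕ-mono (ℕ.pred[n]≤n {b})))

  β^*b^≡1 : ∀ n → β ^ℚ n * fromℕ b ^ℚ n ≡ 1ℚ
  β^*b^≡1 n = trans (sym (ℚ^.^-distrib-* β (fromℕ b) n))
    (trans (cong (_^ℚ n) (trans (ℚ.*-comm β (fromℕ b)) b*b⁻¹≡1)) (1^≡1 n))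

  1/b^ : ∀ n .{{_ : NonZero (b ℕ.^ n)}} → ℤ.+ 1 / b ℕ.^ n ≡ β ^ℚ n
  1/b^ n = trans (sym (ℚ.*-identityˡ p)) (trans (cong (_* p) (sym (β^*b^≡1 n)))
    (trans (ℚ.*-assoc (β ^ℚ n) (fromℕ b ^ℚ n) p)
      (trans (cong (β ^ℚ n *_) (trans (cong (_* p) (sym (fromℕ-^ b n)))
          (trans (sym (/≡* (b ℕ.^ n) (b ℕ.^ n))) (n/n≡1 (b ℕ.^ n)))))
        (ℚ.*-identityʳ (β ^ℚ n)))))
    where
    p = ℤ.+ 1 / b ℕ.^ n

module DigitLemmas (b : ℕ) .{{_ : NonTrivial b}} (d : Fin b) where
  open import Data.Rational.Base using (_+_; _*_; _-_; -_; _≤_; _<_; ∣_∣)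
  open Base b
  open BaseLemmas b
  open DigitLaw

  D : ℚ
  D = fromℕ (toℕ d)

  0≤D : 0ℚ ≤ D
  0≤D = 0≤fromℕ (toℕ d)

  D+1≤b : D + 1ℚ ≤ fromℕ b
  D+1≤b = subst (_≤ fromℕ b) (fromℕ-suc (toℕ d)) (fromℕ-mono (Fin.toℕ<n d))

  law : ℕ → DigitLaw b
  law i = ν d (suc i)

  -- The number `1 / λⱼ = bʲ - b + 1` for j = i + 1. As in `law`, an index i starting at 0 stands
  -- for j = i + 1 from here on.
  t : ℕ → ℚ
  t i = fromℕ (suc (b ℕ.^ suc i ℕ.∸ b))

  λ*t≡1 : ∀ i → λℚ (suc i) * t i ≡ 1ℚ
  λ*t≡1 i = trans (ℚ.*-comm (λℚ (suc i)) (t i)) (trans (sym (/≡* n n)) (n/n≡1 n))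
    where n = suc (b ℕ.^ suc i ℕ.∸ b)

  ≤-if : ∀ a {p x y} → (a ≡ d → p ≤ x) → (a ≢ d → p ≤ y) →
         p ≤ (if does (a Fin.≟ d) then x else y)
  ≤-if a h k with a Fin.≟ d
  ... | yes a≡d = h a≡d
  ... | no  a≢d = k a≢d

  prob-law : ∀ i a → prob (law i) a ≡ β ^ℚ suc i * (if does (a Fin.≟ d) then t i else 1ℚ)
  prob-law i a with does (a Fin.≟ d)
  ... | false = trans (1/b^ (suc i) {{ℕ.m^n≢0 b (suc i)}}) (sym (ℚ.*-identityʳ (β ^ℚ suc i)))
  ... | true  = trans (/≡* (suc (b ℕ.^ suc i ℕ.∸ b)) (b ℕ.^ suc i) {{ℕ.m^n≢0 b (suc i)}})
    (trans (cong (t i *_) (1/b^ (suc i) {{ℕ.m^n≢0 b (suc i)}})) (ℚ.*-comm (t i) (β ^ℚ suc i)))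

  prob-other : ∀ i a → a ≢ d → prob (law i) a ≡ β ^ℚ suc i
  prob-other i a a≢d = trans (prob-law i a)
    (trans (cong (λ x → β ^ℚ suc i * (if x then t i else 1ℚ)) (dec-false (a Fin.≟ d) a≢d))
      (ℚ.*-identityʳ (β ^ℚ suc i)))

  prob≤1 : ∀ i a → prob (law i) a ≤ 1ℚ
  prob≤1 i a = subst (prob (law i) a ≤_) (total (law i)) (single (prob (law i)) (nonNegative (law i)) a)
    where
    single : ∀ {n} (f : Fin n → ℚ) → (∀ a → 0ℚ ≤ f a) → ∀ a → f a ≤ ℚΣ.sum f
    single f 0≤f Fin.zero    = ≤-by (0≤sum (0≤f ∘ Fin.suc)) refl
    single f 0≤f (Fin.suc a) = ℚ.≤-trans (single (f ∘ Fin.suc) (0≤f ∘ Fin.suc) a)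
      (≤-by (0≤f Fin.zero) (ℚ.+-comm (f Fin.zero) _))

  -- Under νᵢ₊₁ the first digit differs from d with probability (b - 1)βʲ ≤ βⁱ, j = i + 1.
  𝔼-first-digit : ∀ i l f {A A′} → 0ℚ ≤ A → 0ℚ ≤ A′ → 𝔼 (law i) l (f ∘ (d ∷_)) ≤ A →
    (∀ a → a ≢ d → 𝔼 (law i) l (f ∘ (a ∷_)) ≤ A′) → 𝔼 (law i) (suc l) f ≤ A + β ^ℚ i * A′
  𝔼-first-digit i l f {A} {A′} 0≤A 0≤A′ hd ha = ℚ.≤-trans (sum-mono step)
    (subst (_≤ A + β ^ℚ i * A′) (sym (sum-if d A (β ^ℚ suc i * A′)))
      (ℚ.+-monoʳ-≤ A (subst (_≤ β ^ℚ i * A′)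
        (solve 4 (λ p β B A → (B :* A) :* (p :* β) := p :* (β :* B :* A)) refl
          (fromℕ (pred b)) β (β ^ℚ i) A′)
        (p*q≤p (0≤* (0≤^ i 0≤β) 0≤A′) pred-b*β≤1))))
    where
    step : ∀ a → prob (law i) a * 𝔼 (law i) l (f ∘ (a ∷_)) ≤
                 (if does (a Fin.≟ d) then A else β ^ℚ suc i * A′)
    step a = ≤-if a
      (λ { refl → ℚ.≤-trans (*-monoˡ-≤ (prob (law i) d) (nonNegative (law i) d) hd)
        (subst (prob (law i) d * A ≤_) (ℚ.*-identityˡ A) (*-monoʳ-≤ A 0≤A (prob≤1 i d))) })
      (λ a≢d → ℚ.≤-trans (*-monoˡ-≤ (prob (law i) a) (nonNegative (law i) a) (ha a a≢d))
        (ℚ.≤-reflexive (cong (_* A′) (prob-other i a a≢d))))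

  instance
    pred-b≢0 : NonZero (pred b)
    pred-b≢0 = ℕ.>-nonZero (ℕ.≤-pred (subst (2 ℕ.≤_) (sym (ℕ.suc-pred b)) (ℕ.nonTrivial⇒n>1 b)))

  -- The number 0.ddd…, at which νᵢ concentrates for large i.
  x₀ : ℚ
  x₀ = D * (ℤ.+ 1 / pred b)

  pred-b*x₀ : fromℕ (pred b) * x₀ ≡ D
  pred-b*x₀ = trans (solve 3 (λ n D r → n :* (D :* r) := D :* (n :* r)) refl
      (fromℕ (pred b)) D (ℤ.+ 1 / pred b))
    (trans (cong (D *_) (trans (sym (/≡* (pred b) (pred b))) (n/n≡1 (pred b)))) (ℚ.*-identityʳ D))

  x₀-fixed : x₀ ≡ (D + x₀) * β
  x₀-fixed = trans (sym (ℚ.*-identityˡ x₀)) (trans (cong (_* x₀) (sym b*b⁻¹≡1))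
    (trans (solve 3 (λ b β x → b :* β :* x := b :* x :* β) refl (fromℕ b) β x₀)
      (cong (_* β) (trans (cong (_* x₀) (fromℕ-pred b))
        (trans (solve 2 (λ n x → (n :+ con 1ℚ) :* x := n :* x :+ x) refl (fromℕ (pred b)) x₀)
          (cong (_+ x₀) pred-b*x₀))))))

  0≤x₀ : 0ℚ ≤ x₀
  0≤x₀ = 0≤* 0≤D (ℚ.<⇒≤ (ℚ.positive⁻¹ _ {{1/n>0 (pred b)}}))

  x₀≤1 : x₀ ≤ 1ℚ
  x₀≤1 = ℚ.≤-trans (*-monoʳ-≤ r (ℚ.<⇒≤ (ℚ.positive⁻¹ _ {{1/n>0 (pred b)}}))
      (fromℕ-mono (ℕ.≤-pred (subst (suc (toℕ d) ℕ.≤_) (sym (ℕ.suc-pred b)) (Fin.toℕ<n d)))))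
    (ℚ.≤-reflexive (trans (sym (/≡* (pred b) (pred b))) (n/n≡1 (pred b))))
    where r = ℤ.+ 1 / pred b

  deviation : ∀ {l} → Vec (Fin b) l → ℚ
  deviation w = x₀ - value w

  deviation-∷ : ∀ {l} a (w : Vec (Fin b) l) →
    deviation (a ∷ w) ≡ (D - fromℕ (toℕ a) + deviation w) * β
  deviation-∷ a w = trans (cong (_- value (a ∷ w)) x₀-fixed)
    (solve 5 (λ D a x v β → (D :+ x) :* β :- (a :+ v) :* β := (D :- a :+ (x :- v)) :* β) refl
      D (fromℕ (toℕ a)) x₀ (value w) β)

  ∣-∣≤1 : ∀ {p q} → 0ℚ ≤ p → p ≤ 1ℚ → 0ℚ ≤ q → q ≤ 1ℚ → ∣ p - q ∣ ≤ 1ℚ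
  ∣-∣≤1 {p} {q} 0≤p p≤1 0≤q q≤1 = ∣p∣≤
    (≤-by (0≤+ (0≤- p≤1) 0≤q) (solve 2 (λ p q → con 1ℚ := p :- q :+ (con 1ℚ :- p :+ q)) refl p q))
    (≤-by (0≤+ (0≤- q≤1) 0≤p) (solve 2 (λ p q → con 1ℚ := :- (p :- q) :+ (con 1ℚ :- q :+ p)) refl p q))

  ∣deviation∣≤1 : ∀ {l} (w : Vec (Fin b) l) → ∣ deviation w ∣ ≤ 1ℚ
  ∣deviation∣≤1 w = ∣-∣≤1 0≤x₀ x₀≤1 (0≤value w) (ℚ.<⇒≤ (value<1 w))

  ρ : ℚ
  ρ = 1ℚ - ½ * β

  0≤ρ : 0ℚ ≤ ρ
  0≤ρ = 0≤- {½ * β} {1ℚ} (ℚ.≤-trans (*-monoˡ-≤ ½ (ℚ.nonNegative⁻¹ ½) β≤1) (ℚ.≤ᵇ⇒≤ tt))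

  deviation-d : ∀ {l} (w : Vec (Fin b) l) → deviation (d ∷ w) ≡ β * deviation w
  deviation-d w = trans (deviation-∷ d w)
    (solve 3 (λ D u β → (D :- D :+ u) :* β := β :* u) refl D (deviation w) β)

  ∣deviation-d∣ : ∀ {l} (w : Vec (Fin b) l) → ∣ deviation (d ∷ w) ∣ ≡ β * ∣ deviation w ∣
  ∣deviation-d∣ w = trans (cong ∣_∣ (deviation-d w)) (trans (ℚ.∣p*q∣≡∣p∣*∣q∣ β (deviation w))
    (cong (_* ∣ deviation w ∣) (ℚ.0≤p⇒∣p∣≡p 0≤β)))

  -- The digit `d` in second place leaves a deviation of at most β, whence the bound
  -- `(b - 1 + β) β = 1 - β + β²`, and this is at most `1 - β/2` because `β ≤ ½`. The first digit
  -- alone would in general give no better bound than 1.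
  ∣deviation∣≤ρ : ∀ {l} a (w : Vec (Fin b) l) → ∣ deviation (a ∷ d ∷ w) ∣ ≤ ρ
  ∣deviation∣≤ρ a w = subst (_≤ ρ)
    (sym (trans (cong ∣_∣ (deviation-∷ a (d ∷ w))) (ℚ.∣p*q∣≡∣p∣*∣q∣ (D - A + u) β)))
    (ℚ.≤-trans
      (*-mono-≤ (ℚ.0≤∣p∣ (D - A + u))
        (ℚ.≤-trans (ℚ.∣p+q∣≤∣p∣+∣q∣ (D - A) u) (ℚ.+-mono-≤ ∣D-A∣≤ ∣u∣≤β))
        (ℚ.0≤∣p∣ β) (ℚ.≤-reflexive (ℚ.0≤p⇒∣p∣≡p 0≤β)))
      (subst (_≤ ρ)
        (solve 2 (λ b β → b :* β :- β :+ β :* β := (b :- con 1ℚ :+ β) :* β) refl (fromℕ b) β)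
        (subst (λ t → t - β + β * β ≤ ρ) (sym b*b⁻¹≡1)
          (≤-by (0≤* 0≤β (0≤- β≤½)) (solve 1 (λ β → con 1ℚ :- con ½ :* β :=
            con 1ℚ :- β :+ β :* β :+ β :* (con ½ :- β)) refl β)))))
    where
    A = fromℕ (toℕ a)
    u = deviation (d ∷ w)
    A+1≤b : A + 1ℚ ≤ fromℕ b
    A+1≤b = subst (_≤ fromℕ b) (fromℕ-suc (toℕ a)) (fromℕ-mono (Fin.toℕ<n a))
    ∣D-A∣≤ : ∣ D - A ∣ ≤ fromℕ b - 1ℚ
    ∣D-A∣≤ = ∣p∣≤
      (≤-by (0≤+ (0≤- D+1≤b) (0≤fromℕ (toℕ a))) (solve 3 (λ b D A →
        b :- con 1ℚ := D :- A :+ (b :- (D :+ con 1ℚ) :+ A)) refl (fromℕ b) D A))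
      (≤-by (0≤+ (0≤- A+1≤b) 0≤D) (solve 3 (λ b D A →
        b :- con 1ℚ := :- (D :- A) :+ (b :- (A :+ con 1ℚ) :+ D)) refl (fromℕ b) D A))
    ∣u∣≤β : ∣ u ∣ ≤ β
    ∣u∣≤β = subst (_≤ β) (sym (∣deviation-d∣ w)) (p*q≤p 0≤β (∣deviation∣≤1 w))

  -- If the first digit is `d`, the deviation shrinks by β and induction applies. Otherwise, with
  -- probability at most `βⁱ`, the second digit either is `d`, giving `ρ`, or differs as well, which
  -- costs another `βⁱ`. The resulting recursion `M ↦ β M + T` has the solution stated, since
  -- `β ≤ ½`; `βˡ` is the trace of the start, where only the bound 1 is known.
  deviation-moment : ∀ i m l → let T = β ^ℚ i * (ρ ^ℚ suc m + β ^ℚ i * 1ℚ) in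
    𝔼 (law i) (suc l) (λ w → ∣ deviation w ∣ ^ℚ suc m) ≤ β ^ℚ l + (T + T)
  deviation-moment i m l = helper l
    where
    T = β ^ℚ i * (ρ ^ℚ suc m + β ^ℚ i * 1ℚ)
    0≤β^i = 0≤^ i 0≤β
    0≤ρ+ : 0ℚ ≤ ρ ^ℚ suc m + β ^ℚ i * 1ℚ
    0≤ρ+ = 0≤+ (0≤^ (suc m) 0≤ρ) (0≤* 0≤β^i 0≤1)
    0≤T : 0ℚ ≤ T
    0≤T = 0≤* 0≤β^i 0≤ρ+
    f : ∀ {l} → Vec (Fin b) l → ℚ
    f w = ∣ deviation w ∣ ^ℚ suc m
    f≤1 : ∀ {l} (w : Vec (Fin b) l) → f w ≤ 1ℚ
    f≤1 w = ^≤1 (suc m) (ℚ.0≤∣p∣ (deviation w)) (∣deviation∣≤1 w)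
    f-d : ∀ {l} (w : Vec (Fin b) l) → f (d ∷ w) ≤ β * f w
    f-d w = subst (_≤ β * f w)
      (sym (trans (cong (_^ℚ suc m) (∣deviation-d∣ w)) (ℚ^.^-distrib-* β ∣ deviation w ∣ (suc m))))
      (*-monoʳ-≤ (f w) (0≤^ (suc m) (ℚ.0≤∣p∣ (deviation w))) (p*q≤p 0≤β (^≤1 m 0≤β β≤1)))
    helper : ∀ l → 𝔼 (law i) (suc l) f ≤ β ^ℚ l + (T + T)
    helper zero    = ℚ.≤-trans (𝔼≤ (law i) 1 f≤1) (≤-by (0≤+ 0≤T 0≤T) refl)
    helper (suc l) = ℚ.≤-trans
      (𝔼-first-digit i (suc l) f {β * (β ^ℚ l + (T + T))} {ρ ^ℚ suc m + β ^ℚ i * 1ℚ}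
        (0≤* 0≤β (0≤+ (0≤^ l 0≤β) (0≤+ 0≤T 0≤T))) 0≤ρ+
        (ℚ.≤-trans (𝔼-mono (law i) (suc l) f-d)
          (subst (_≤ β * (β ^ℚ l + (T + T))) (sym (𝔼-* (law i) (suc l) β f))
            (*-monoˡ-≤ β 0≤β (helper l))))
        (λ a _ → 𝔼-first-digit i l (f ∘ (a ∷_)) (0≤^ (suc m) 0≤ρ) 0≤1
          (𝔼≤ (law i) l λ w → ^-mono (suc m) (ℚ.0≤∣p∣ _) (∣deviation∣≤ρ a w))
          (λ a′ _ → 𝔼≤ (law i) l λ w → f≤1 (a ∷ a′ ∷ w))))
      (≤-by (0≤+ (0≤* (0≤- β≤½) 0≤T) (0≤* (0≤- β≤½) 0≤T)) (solve 3 (λ β P T →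
        β :* P :+ (T :+ T) := β :* (P :+ (T :+ T)) :+ T :+
          ((con ½ :- β) :* T :+ (con ½ :- β) :* T)) refl β (β ^ℚ l) T))

-- The growth of the coefficients cⱼ.

module Coefficients (b : ℕ) .{{_ : NonTrivial b}} (d : Fin b) where
  open import Data.Rational.Base using (_+_; _*_; _-_; -_; _≤_; _<_; ∣_∣)
  open Base b
  open BaseLemmas b
  open DigitLemmas b d

  z : ℚ → ℚ
  z x = D + x

  entry : ℕ → ℕ → Bool → ℝ
  entry i j t = if t
    then (Defs.- 1ℝ) ^ (j ℕ.∸ i) Defs.* fromℚ (fromℕ (pred j C pred i)) Defs.*
         moment d (j ℕ.∸ i) (suc (pred i))
    else 0ℝ

  -- The rationals at level l of the sequences defining cᵢ₊₁ and qᵢ₊₁,ⱼ₊₁.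
  abstract
    c^ : ℕ → ℕ → ℚ
    c^ l i = seq (c d (suc i)) l

    Q^ : ℕ → ℕ → ℕ → ℚ
    Q^ l i j = seq (Q d i j) l

    c^≡ : ∀ l i → c^ l i ≡ seq (c d (suc i)) l
    c^≡ l i = refl

    c^≡inverse : ∀ l k → c^ l k ≡ ℚM.inverse (Q^ l) 0 k
    c^≡inverse l k = seq-row (Q d) 0 (suc k) k l

    Q^≡entry : ∀ l i j → Q^ l i j ≡ seq (entry (suc i) (suc j) (does (suc i ℕ.≤? suc j))) l
    Q^≡entry l i j = refl

  module U (l : ℕ) = Umbral law z (c^ l) l

  Q^-lower : ∀ l {i j} → j ℕ.< i → Q^ l i j ≡ 0ℚ
  Q^-lower l {i} {j} j<i = trans (Q^≡entry l i j)
    (cong (λ t → seq (entry (suc i) (suc j) t) l)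
      (dec-false (suc i ℕ.≤? suc j) (ℕ.<⇒≱ (ℕ.s≤s j<i))))

  -- The sign `(-1)ʲ⁻ⁱ` turns z into -z, so the entries of `Q` are the expectations of the
  -- coefficients of `(s - z)ʲ`.
  Q^-upper : ∀ l {i j} → i ℕ.≤ j → Q^ l i j ≡ U.E l i (pow (U.X l) j i)
  Q^-upper l {i} {j} i≤j = trans
    (trans (Q^≡entry l i j)
      (cong (λ t → seq (entry (suc i) (suc j) t) l)
        (dec-true (suc i ℕ.≤? suc j) (ℕ.s≤s i≤j))))
    (trans (cong (λ s → s * fromℕ (j C i) * 𝔼 (law i) l (λ w → z (value w) ^ℚ m))
             (seq-^ (Defs.- 1ℝ) m l))
      (trans (sym (𝔼-* (law i) l ((- 1ℚ) ^ℚ m * fromℕ (j C i)) (λ w → z (value w) ^ℚ m)))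
        (𝔼-cong (law i) l λ w → trans (signs (value w)) (sym (pow≡binomial (U.X l) j i (value w))))))
    where
    m = j ℕ.∸ i
    signs : ∀ x → (- 1ℚ) ^ℚ m * fromℕ (j C i) * z x ^ℚ m ≡ binomial j i (- z x)
    signs x = trans (solve 3 (λ s n p → s :* n :* p := n :* (s :* p)) refl
        ((- 1ℚ) ^ℚ m) (fromℕ (j C i)) (z x ^ℚ m))
      (cong (fromℕ (j C i) *_) (trans (sym (ℚ^.^-distrib-* (- 1ℚ) (z x) m))
        (cong (_^ℚ m) (solve 1 (λ z → con (- 1ℚ) :* z := :- z) refl (z x)))))

  Q^-unipotent : ∀ l → ℚM.IsUnipotent (Q^ l)
  Q^-unipotent l = Q^-lower l , λ i → trans (Q^-upper l {i} {i} ℕ.≤-refl)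
    (trans (𝔼-cong (law i) l λ w → trans (pow≡binomial (U.X l) i i (value w))
        (binomial-diagonal i (U.X l (value w)))) (𝔼-const (law i) l 1ℚ))

  -- In view of `Q^-upper`, this is the first row of `Q⁻¹ Q = 1`.
  defining : ∀ l j → U.Λ l (suc j) (pow (U.X l) j) ≡ U.δ₀ l j
  defining l j = trans
    (Σ<-cong (suc j) {g = λ k → ℚM.inverse (Q^ l) 0 k * Q^ l k j} λ k k<1+j → cong₂ _*_ (c^≡inverse l k)
      (sym (Q^-upper l (ℕ.≤-pred k<1+j))))
    (trans (ℚM.inverse-left (Q^-unipotent l) 0 j) (δ≡ j))
    where
    δ≡ : ∀ j → ℚM.δ 0 j ≡ U.δ₀ l j
    δ≡ zero    = refl
    δ≡ (suc _) = refl

  -- The bound |cⱼ| ≤ K rʲ is proved by induction on j, up to constants, if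
  -- s₀ ≤ r, rβ + ρ < r and rβ² + 1 < r, and gives convergence if r < B.
  s₀ r B : ℚ
  s₀ = D + x₀
  B  = fromℕ b + D
  r  = B - ℤ.+ 1 / 4

  -- The value of `(r β + ρ) / r` in the extreme case b = 2, d = 0, where r = 7/4, β = 1/2 and ρ =
  -- 3/4.
  θ : ℚ
  θ = ℤ.+ 13 / 14

  0≤s₀ : 0ℚ ≤ s₀
  0≤s₀ = 0≤+ 0≤D 0≤x₀

  7/4≤r : ℤ.+ 7 / 4 ≤ r
  7/4≤r = ≤-by (0≤+ (0≤- 2≤b) 0≤D) (solve 2 (λ b D →
    b :+ D :- con (ℤ.+ 1 / 4) := con (ℤ.+ 7 / 4) :+ (b :- con (fromℕ 2) :+ D)) refl (fromℕ b) D)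

  1≤r : 1ℚ ≤ r
  1≤r = ℚ.≤-trans (ℚ.≤ᵇ⇒≤ tt) 7/4≤r

  0≤r : 0ℚ ≤ r
  0≤r = ℚ.≤-trans 0≤1 1≤r

  s₀≤r : s₀ ≤ r
  s₀≤r = ≤-by (0≤+ (0≤+ (0≤- x₀≤1) (0≤- 2≤b)) (ℚ.≤ᵇ⇒≤ {0ℚ} {ℤ.+ 3 / 4} tt)) (solve 3 (λ b D x →
    b :+ D :- con (ℤ.+ 1 / 4) :=
    D :+ x :+ (con 1ℚ :- x :+ (b :- con (fromℕ 2)) :+ con (ℤ.+ 3 / 4))) refl (fromℕ b) D x₀)

  rβ+ρ≤θr : r * β + ρ ≤ θ * r
  rβ+ρ≤θr = ≤-by
    (0≤+ (0≤* (0≤+ (0≤- β≤½) (ℚ.≤ᵇ⇒≤ {0ℚ} {ℤ.+ 6 / 14} tt)) (0≤- 7/4≤r))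
         (0≤* (ℚ.≤ᵇ⇒≤ {0ℚ} {ℤ.+ 5 / 4} tt) (0≤- β≤½)))
    (solve 2 (λ r β → con θ :* r := r :* β :+ (con 1ℚ :- con ½ :* β) :+
      ((con ½ :- β :+ con (ℤ.+ 6 / 14)) :* (r :- con (ℤ.+ 7 / 4)) :+
       con (ℤ.+ 5 / 4) :* (con ½ :- β))) refl r β)

  rβ²+1≤θr : r * (β * β) + 1ℚ ≤ θ * r
  rβ²+1≤θr = ℚ.≤-trans
    (ℚ.+-monoˡ-≤ 1ℚ (*-monoˡ-≤ r 0≤r (*-mono-≤ 0≤β β≤½ 0≤β β≤½)))
    (≤-by (0≤+ (0≤* (ℚ.≤ᵇ⇒≤ {0ℚ} {ℤ.+ 19 / 28} tt) (0≤- 7/4≤r)) (ℚ.≤ᵇ⇒≤ {0ℚ} {ℤ.+ 3 / 16} tt))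
      (solve 1 (λ r → con θ :* r := r :* con (½ * ½) :+ con 1ℚ :+
        (con (ℤ.+ 19 / 28) :* (r :- con (ℤ.+ 7 / 4)) :+ con (ℤ.+ 3 / 16))) refl r))

  -- The law νᵢ₊₁ charges mostly 0.ddd…, so the recursion for cⱼ, centred there,
  -- has small coefficients away from the diagonal.
  small-coefficient : ∀ l i j → i ℕ.< j → β ^ℚ l ≤ β ^ℚ i * β ^ℚ i →
    ∣ U.E (suc l) i (λ x → binomial j i (s₀ - z x)) ∣ ≤
    fromℕ 2 * (β ^ℚ i * binomial j i ρ) + fromℕ 3 * ((β * β) ^ℚ i * binomial j i 1ℚ)
  small-coefficient l i j i<j β^l≤ = ℚ.≤-trans (∣𝔼∣ (law i) (suc l) f)
    (subst₂ _≤_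
      (trans (sym (𝔼-* (law i) (suc l) n (λ w → ∣ deviation w ∣ ^ℚ suc m)))
        (𝔼-cong (law i) (suc l) {λ w → n * ∣ deviation w ∣ ^ℚ suc m} {λ w → ∣ f w ∣}
          λ w → sym (absolute w)))
      rearrange
      -- The truncation error `βˡ` is absorbed in `β²ⁱ`, which then occurs three times: once from
      -- here and twice from `T + T`.
      (*-monoˡ-≤ n 0≤n (ℚ.≤-trans (deviation-moment i m l) (ℚ.+-monoˡ-≤ (T + T) β^l≤))))
    where
    m = j ℕ.∸ suc i
    n = fromℕ (j C i)
    f : Vec (Fin b) (suc l) → ℚ
    f w = binomial j i (s₀ - z (value w))
    0≤n : 0ℚ ≤ n
    0≤n = 0≤fromℕ (j C i)
    T = β ^ℚ i * (ρ ^ℚ suc m + β ^ℚ i * 1ℚ)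
    j∸i : j ℕ.∸ i ≡ suc m
    j∸i = ℕ.+-∸-assoc 1 i<j
    absolute : ∀ {l} (w : Vec (Fin b) l) →
      ∣ binomial j i (s₀ - z (value w)) ∣ ≡ n * ∣ deviation w ∣ ^ℚ suc m
    absolute w = trans (ℚ.∣p*q∣≡∣p∣*∣q∣ n ((s₀ - z (value w)) ^ℚ (j ℕ.∸ i)))
      (cong₂ _*_ (ℚ.0≤p⇒∣p∣≡p 0≤n) (trans (∣^∣ (s₀ - z (value w)) (j ℕ.∸ i))
        (cong₂ (λ p k → ∣ p ∣ ^ℚ k) (solve 3 (λ D x v → D :+ x :- (D :+ v) := x :- v) refl
          D x₀ (value w)) j∸i)))
    rearrange : n * (β ^ℚ i * β ^ℚ i + (T + T)) ≡
      fromℕ 2 * (β ^ℚ i * binomial j i ρ) + fromℕ 3 * ((β * β) ^ℚ i * binomial j i 1ℚ)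
    rearrange = trans
      (solve 3 (λ n b R → n :* (b :* b :+ (b :* (R :+ b :* con 1ℚ) :+ b :* (R :+ b :* con 1ℚ))) :=
        con (fromℕ 2) :* (b :* (n :* R)) :+ con (fromℕ 3) :* (b :* b :* (n :* con 1ℚ))) refl
        n (β ^ℚ i) (ρ ^ℚ suc m))
      (cong₂ (λ s t → fromℕ 2 * (β ^ℚ i * s) + fromℕ 3 * t)
        (cong (λ k → n * ρ ^ℚ k) (sym j∸i))
        (cong₂ (λ s t → s * (n * t)) (sym (ℚ^.^-distrib-* β β i)) (sym (1^≡1 (j ℕ.∸ i)))))

  initial-bound : ∀ n → ∃ λ K → 0ℚ ≤ K × Eventually λ l → ∀ i → i ℕ.< n → ∣ c^ l i ∣ ≤ K
  initial-bound zero    = 0ℚ , ℚ.≤-refl , 0 , λ _ _ _ i<0 → contradiction i<0 λ ()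
  initial-bound (suc n) = combine n (initial-bound n) (bounded (c d (suc n)))
    where
    split : ∀ n K M → 0ℚ ≤ K → 0ℚ ≤ M → ∀ l → (∀ i → i ℕ.< n → ∣ c^ l i ∣ ≤ K) →
      ∣ c^ l n ∣ ≤ M → ∀ i → i ℕ.< suc n → ∣ c^ l i ∣ ≤ K + M
    split n K M 0≤K 0≤M l p q i i<1+n with ℕ.m≤n⇒m<n∨m≡n (ℕ.≤-pred i<1+n)
    ... | inj₁ i<n  = ℚ.≤-trans (p i i<n) (≤-by 0≤M refl)
    ... | inj₂ refl = ℚ.≤-trans q (≤-by 0≤K (ℚ.+-comm K M))
    combine : ∀ n → (∃ λ K → 0ℚ ≤ K × Eventually λ l → ∀ i → i ℕ.< n → ∣ c^ l i ∣ ≤ K) →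
      (∃ λ M → 0ℚ ≤ M × Eventually λ l → ∣ seq (c d (suc n)) l ∣ ≤ M) →
      ∃ λ K → 0ℚ ≤ K × Eventually λ l → ∀ i → i ℕ.< suc n → ∣ c^ l i ∣ ≤ K
    combine n (K , 0≤K , L , h) (M , 0≤M , L′ , k) = K + M , 0≤+ 0≤K 0≤M , L ℕ.⊔ L′ , λ l p →
      split n K M 0≤K 0≤M l (h l (⊔ˡ p)) (subst (λ q → ∣ q ∣ ≤ M) (sym (c^≡ l n)) (k l (⊔ʳ p)))

  -- The two parts of `small-coefficient` are summed by the binomial theorem to `(r β + ρ)ʲ` and
  -- `(r β² + 1)ʲ`. Both are at most `(θ r)ʲ`, and 5 = 2 + 3.
  recursion-bound : ∀ {K} l j → 0ℚ ≤ K →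
    (∀ i → i ℕ.< j → β ^ℚ l ≤ β ^ℚ i * β ^ℚ i) →
    (∀ i → i ℕ.< j → ∣ c^ (suc l) i ∣ ≤ K * r ^ℚ i) →
    ∣ c^ (suc l) j ∣ ≤ r ^ℚ j + K * (fromℕ 5 * θ ^ℚ j * r ^ℚ j)
  recursion-bound {K} l j 0≤K small hyp = subst (λ p → ∣ p ∣ ≤ _)
    (sym (U.coefficient-recursion (suc l) (defining (suc l)) s₀ j))
    (ℚ.≤-trans (ℚ.∣p-q∣≤∣p∣+∣q∣ (s₀ ^ℚ j) _)
      (ℚ.+-mono-≤
        (subst (_≤ r ^ℚ j) (sym (ℚ.0≤p⇒∣p∣≡p (0≤^ j 0≤s₀))) (^-mono j 0≤s₀ s₀≤r))
        (ℚ.≤-trans (∣Σ<∣ j _) (ℚ.≤-trans (Σ<-mono j term) sums))))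
    where
    α₁ = λ i → (r * β) ^ℚ i * binomial j i ρ
    α₂ = λ i → (r * (β * β)) ^ℚ i * binomial j i 1ℚ
    term : ∀ i → i ℕ.< j →
      ∣ c^ (suc l) i * U.E (suc l) i (λ x → binomial j i (s₀ - z x)) ∣ ≤
      K * (fromℕ 2 * α₁ i + fromℕ 3 * α₂ i)
    term i i<j = subst (∣ c^ (suc l) i * U.E (suc l) i (λ x → binomial j i (s₀ - z x)) ∣ ≤_)
      (trans
        (solve 6 (λ K R b p b′ p′ →
          K :* R :* (con (fromℕ 2) :* (b :* p) :+ con (fromℕ 3) :* (b′ :* p′)) :=
          K :* (con (fromℕ 2) :* (R :* b :* p) :+ con (fromℕ 3) :* (R :* b′ :* p′))) refl
          K (r ^ℚ i) (β ^ℚ i) (binomial j i ρ) ((β * β) ^ℚ i) (binomial j i 1ℚ))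
        (cong₂ (λ s t → K * (fromℕ 2 * (s * binomial j i ρ) + fromℕ 3 * (t * binomial j i 1ℚ)))
          (sym (ℚ^.^-distrib-* r β i)) (sym (ℚ^.^-distrib-* r (β * β) i))))
      (∣-∣-mono-* {c^ (suc l) i} (hyp i i<j) (small-coefficient l i j i<j (small i i<j)))
    0≤rβ² = 0≤* 0≤r (0≤* 0≤β 0≤β)
    sums : Σ< j (λ i → K * (fromℕ 2 * α₁ i + fromℕ 3 * α₂ i)) ≤ K * (fromℕ 5 * θ ^ℚ j * r ^ℚ j)
    sums = subst (_≤ K * (fromℕ 5 * θ ^ℚ j * r ^ℚ j))
      (trans (cong (K *_) (trans (cong₂ _+_ (Σ<-*ˡ j (fromℕ 2) α₁) (Σ<-*ˡ j (fromℕ 3) α₂))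
          (sym (Σ<-+ j (λ i → fromℕ 2 * α₁ i) (λ i → fromℕ 3 * α₂ i)))))
        (Σ<-*ˡ j K (λ i → fromℕ 2 * α₁ i + fromℕ 3 * α₂ i)))
      (*-monoˡ-≤ K 0≤K (subst (fromℕ 2 * Σ< j α₁ + fromℕ 3 * Σ< j α₂ ≤_)
        (trans (solve 1 (λ p → con (fromℕ 2) :* p :+ con (fromℕ 3) :* p := con (fromℕ 5) :* p) refl ((θ * r) ^ℚ j))
          (trans (cong (fromℕ 5 *_) (ℚ^.^-distrib-* θ r j)) (sym (ℚ.*-assoc (fromℕ 5) (θ ^ℚ j) (r ^ℚ j)))))
        (ℚ.+-mono-≤
          (*-monoˡ-≤ (fromℕ 2) (0≤fromℕ 2) (ℚ.≤-trans (Σ<-binomial j j (0≤* 0≤r 0≤β) 0≤ρ)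
            (^-mono j (0≤+ (0≤* 0≤r 0≤β) 0≤ρ) rβ+ρ≤θr)))
          (*-monoˡ-≤ (fromℕ 3) (0≤fromℕ 3) (ℚ.≤-trans (Σ<-binomial j j 0≤rβ² 0≤1)
            (^-mono j (0≤+ 0≤rβ² 0≤1) rβ²+1≤θr))))))

  -- As soon as `5 θʲ ≤ ½`, the recursion gives `(1 + K/2) rʲ ≤ K rʲ`, provided that K ≥ 2. The
  -- finitely many earlier coefficients are Cauchy sequences and hence eventually bounded, by `K₀`;
  -- so `K = K₀ + 2` serves for all J, and only the required level depends on J.
  coefficient-bound : ∃ λ K → 0ℚ ≤ K × ∀ J → Eventually λ l → ∀ i → i ℕ.< J → ∣ c^ l i ∣ ≤ K * r ^ℚ i
  coefficient-bound = from-decay (geometric-decay {θ} (fromℕ 5) ½ (ℚ.≤ᵇ⇒≤ tt) (from-yes (θ ℚ.<? 1ℚ))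
      (0≤fromℕ 5) (ℚ.positive⁻¹ ½))
    where
    module _ (N : ℕ) (decay : ∀ j → N ℕ.≤ j → fromℕ 5 * θ ^ℚ j ≤ ½) (K₀ : ℚ) (0≤K₀ : 0ℚ ≤ K₀) where
      K = K₀ + fromℕ 2
      0≤K : 0ℚ ≤ K
      0≤K = 0≤+ 0≤K₀ (0≤fromℕ 2)
      small : ∀ J l → J ℕ.+ J ℕ.≤ l → ∀ i → i ℕ.< J → β ^ℚ l ≤ β ^ℚ i * β ^ℚ i
      small J l 2J≤l i i<J = subst (β ^ℚ l ≤_) (ℚ^.^-homo-* β i i)
        (^-antimono 0≤β β≤1 (ℕ.≤-trans (ℕ.+-mono-≤ (ℕ.<⇒≤ i<J) (ℕ.<⇒≤ i<J)) 2J≤l))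
      bound : ∀ {J} l → (∀ i → i ℕ.< J → β ^ℚ l ≤ β ^ℚ i * β ^ℚ i) →
        (∀ i → i ℕ.< N → ∣ c^ (suc l) i ∣ ≤ K₀) →
        ∀ n → n ℕ.≤ J → ∀ i → i ℕ.< n → ∣ c^ (suc l) i ∣ ≤ K * r ^ℚ i
      bound l small-l initial-l (suc n) n<J i i<1+n with ℕ.m≤n⇒m<n∨m≡n (ℕ.≤-pred i<1+n)
      ... | inj₁ i<n = bound l small-l initial-l n (ℕ.<⇒≤ n<J) i i<n
      ... | inj₂ refl with i ℕ.<? N
      ...   | yes i<N = ℚ.≤-trans (initial-l i i<N) (ℚ.≤-trans
        (≤-by (0≤fromℕ 2) refl)
        (subst (_≤ K * r ^ℚ i) (ℚ.*-identityʳ K) (*-monoˡ-≤ K 0≤K (1≤^ i 1≤r))))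
      ...   | no  i≮N = ℚ.≤-trans
        (recursion-bound {K} l i 0≤K
          (λ k k<i → small-l k (ℕ.<-trans k<i n<J))
          (bound l small-l initial-l i (ℕ.<⇒≤ n<J)))
        (≤-by (0≤+ (0≤* (0≤* 0≤K (0≤- (decay i (ℕ.≮⇒≥ i≮N)))) (0≤^ i 0≤r))
                   (0≤* (0≤* (ℚ.nonNegative⁻¹ ½) 0≤K₀) (0≤^ i 0≤r)))
          (solve 3 (λ K T R → (K :+ con (fromℕ 2)) :* R :=
            R :+ (K :+ con (fromℕ 2)) :* (T :* R) :+
            ((K :+ con (fromℕ 2)) :* (con ½ :- T) :* R :+ con ½ :* K :* R)) refl
            K₀ (fromℕ 5 * θ ^ℚ i) (r ^ℚ i)))
    from-decay : (Eventually λ j → fromℕ 5 * θ ^ℚ j ≤ ½) →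
      ∃ λ K → 0ℚ ≤ K × ∀ J → Eventually λ l → ∀ i → i ℕ.< J → ∣ c^ l i ∣ ≤ K * r ^ℚ i
    from-decay (N , decay) = from-initial (initial-bound N)
      where
      from-initial : (∃ λ K → 0ℚ ≤ K × Eventually λ l → ∀ i → i ℕ.< N → ∣ c^ l i ∣ ≤ K) →
        ∃ λ K → 0ℚ ≤ K × ∀ J → Eventually λ l → ∀ i → i ℕ.< J → ∣ c^ l i ∣ ≤ K * r ^ℚ i
      from-initial (K₀ , 0≤K₀ , L , initial) = K N decay K₀ 0≤K₀ , 0≤K N decay K₀ 0≤K₀ , λ J →
        -- At level l + 1 with l ≥ 2J, `βˡ ≤ β²ⁱ` holds for all i < J, as `small-coefficient`
        -- requires.
        suc (J ℕ.+ J) ℕ.⊔ L , λ where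
          (suc l) h → bound N decay K₀ 0≤K₀ l
            (small N decay K₀ 0≤K₀ J l (ℕ.≤-pred (⊔ˡ {suc (J ℕ.+ J)} {L} h)))
            (initial (suc l) (⊔ʳ {suc (J ℕ.+ J)} {L} h)) J ℕ.≤-refl
          zero h → contradiction (⊔ˡ {suc (J ℕ.+ J)} {L} h) λ ()

-- The approximation of 1/(bn) by sums of cⱼ Hⱼ(bn + d).

module Approximation (b : ℕ) .{{_ : NonTrivial b}} (d : Fin b) where
  open import Data.Rational.Base using (_+_; _*_; _-_; -_; _≤_; _<_; ∣_∣)
  open Base b
  open BaseLemmas b
  open DigitLemmas b d
  open Coefficients b d

  recip-inverse : ∀ {p} → 0ℚ < p → p * recip p ≡ 1ℚ
  recip-inverse {p} 0<p = trans (cong (p *_) (recip-≢0 p≢0)) (ℚ.*-inverseʳ p)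
    where instance p≢0 = ℚ.pos⇒nonZero p {{ℚ.positive 0<p}}

  0≤recip : ∀ {p} → 0ℚ < p → 0ℚ ≤ recip p
  0≤recip {p} 0<p = ℚ.*-cancelˡ-≤-pos p {{ℚ.positive 0<p}}
    (subst₂ _≤_ (sym (ℚ.*-zeroʳ p)) (sym (recip-inverse 0<p)) 0≤1)

  recip-unique : ∀ {p q} → 0ℚ < p → p * q ≡ 1ℚ → q ≡ recip p
  recip-unique {p} {q} 0<p pq≡1 = trans (sym (ℚ.*-identityˡ q))
    (trans (cong (_* q) (sym (recip-inverse 0<p)))
      (trans (solve 3 (λ p r q → p :* r :* q := r :* (p :* q)) refl p (recip p) q)
        (trans (cong (recip p *_) pq≡1) (ℚ.*-identityʳ (recip p)))))

  recip-antimono : ∀ {p q} → 0ℚ < p → p ≤ q → recip q ≤ recip p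
  recip-antimono {p} {q} 0<p p≤q = subst₂ _≤_
    (trans (cong (_* recip q) (recip-inverse 0<p)) (ℚ.*-identityˡ (recip q)))
    (trans (solve 3 (λ q r s → q :* r :* s := r :* (q :* s)) refl q (recip p) (recip q))
      (trans (cong (recip p *_) (recip-inverse 0<q)) (ℚ.*-identityʳ (recip p))))
    (*-monoʳ-≤ (recip q) (0≤recip 0<q) (*-monoʳ-≤ (recip p) (0≤recip 0<p) p≤q))
    where 0<q = ℚ.<-≤-trans 0<p p≤q

  -- `B⁻` is the midpoint of `r` and `B`. It leaves room for the majorant with q = 9/8 > 1: as y ≥
  -- b, one has `w - 9/8 = y + d - 1/8 ≥ B⁻`. The ratio `η < 1` is the rate of convergence.
  B⁻ η : ℚ
  B⁻ = B - ℤ.+ 1 / 8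
  η  = r * recip B⁻

  2≤B : fromℕ 2 ≤ B
  2≤B = ≤-by (0≤+ (0≤- 2≤b) 0≤D) (solve 2 (λ b D → b :+ D := con (fromℕ 2) :+ (b :- con (fromℕ 2) :+ D)) refl (fromℕ b) D)

  1≤B⁻ : 1ℚ ≤ B⁻
  1≤B⁻ = ≤-by (0≤+ (0≤- 2≤B) (ℚ.≤ᵇ⇒≤ {0ℚ} {ℤ.+ 7 / 8} tt)) (solve 1 (λ B →
    B :- con (ℤ.+ 1 / 8) := con 1ℚ :+ (B :- con (fromℕ 2) :+ con (ℤ.+ 7 / 8))) refl B)

  0<B⁻ : 0ℚ < B⁻
  0<B⁻ = ℚ.<-≤-trans 0<1 1≤B⁻

  0≤η : 0ℚ ≤ η
  0≤η = 0≤* 0≤r (0≤recip 0<B⁻)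

  14/15≤η : ℤ.+ 14 / 15 ≤ η
  14/15≤η = subst (_≤ η)
    (trans (ℚ.*-assoc (ℤ.+ 14 / 15) B⁻ (recip B⁻))
      (trans (cong (ℤ.+ 14 / 15 *_) (recip-inverse 0<B⁻)) (ℚ.*-identityʳ (ℤ.+ 14 / 15))))
    (*-monoʳ-≤ (recip B⁻) (0≤recip 0<B⁻) 14/15*B⁻≤r)
    where
    14/15*B⁻≤r : ℤ.+ 14 / 15 * B⁻ ≤ r
    14/15*B⁻≤r = ≤-by (0≤* (ℚ.≤ᵇ⇒≤ {0ℚ} {ℤ.+ 1 / 15} tt) (0≤- 2≤B))
      (solve 1 (λ B → B :- con (ℤ.+ 1 / 4) := con (ℤ.+ 14 / 15) :* (B :- con (ℤ.+ 1 / 8)) :+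
        con (ℤ.+ 1 / 15) :* (B :- con (fromℕ 2))) refl B)

  η<1 : η < 1ℚ
  η<1 = subst (η <_) (recip-inverse 0<B⁻) (ℚ.*-monoˡ-<-pos (recip B⁻) {{ℚ.positive 0<recip}}
    (subst (r <_) (solve 1 (λ B → B :- con (ℤ.+ 1 / 4) :+ con (ℤ.+ 1 / 8) := B :- con (ℤ.+ 1 / 8)) refl B)
      (subst (_< r + ℤ.+ 1 / 8) (ℚ.+-identityʳ r) (ℚ.+-monoʳ-< r (from-yes (0ℚ ℚ.<? ℤ.+ 1 / 8))))))
    where
    0<recip : 0ℚ < recip B⁻
    0<recip = ℚ.*-cancelˡ-<-nonNeg B⁻ {{ℚ.nonNegative (ℚ.<⇒≤ 0<B⁻)}}
      (subst₂ _<_ (sym (ℚ.*-zeroʳ B⁻)) (sym (recip-inverse 0<B⁻)) 0<1)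

  H : ℕ → ℕ → ℚ → ℚ
  H l i p = 𝔼 (law i) l λ w → recip (p + value w) ^ℚ suc i

  9/8 8/9 : ℚ
  9/8 = ℤ.+ 9 / 8
  8/9 = ℤ.+ 8 / 9

  -- By `14/15≤η` the ratio `9/8 η` of successive terms is at least 21/20, so the last terms
  -- dominate. The constant 20 satisfies `8/9 · 21 = 20 · 14/15`, which closes the induction.
  Σ<-majorant : ∀ J → Σ< J (λ i → 9/8 ^ℚ i * 8/9 ^ℚ J * η ^ℚ i) ≤ fromℕ 20 * η ^ℚ J
  Σ<-majorant zero    = ℚ.≤ᵇ⇒≤ tt
  Σ<-majorant (suc J) = subst (_≤ fromℕ 20 * η ^ℚ suc J) (sym step)
    (ℚ.≤-trans (*-monoˡ-≤ 8/9 0≤8/9 (ℚ.+-monoˡ-≤ (η ^ℚ J) (Σ<-majorant J)))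
      (≤-by (0≤* (0≤* (0≤fromℕ 20) (0≤- 14/15≤η)) (0≤^ J 0≤η))
        (solve 2 (λ η P → con (fromℕ 20) :* (η :* P) :=
          con 8/9 :* (con (fromℕ 20) :* P :+ P) :+
          con (fromℕ 20) :* (η :- con (ℤ.+ 14 / 15)) :* P) refl η (η ^ℚ J))))
    where
    0≤8/9 : 0ℚ ≤ 8/9
    0≤8/9 = ℚ.≤ᵇ⇒≤ tt
    ones : ∀ n → 9/8 ^ℚ n * 8/9 ^ℚ n ≡ 1ℚ
    ones zero    = refl
    ones (suc n) = trans (solve 2 (λ x y → con 9/8 :* x :* (con 8/9 :* y) := x :* y) refl
      (9/8 ^ℚ n) (8/9 ^ℚ n)) (ones n)
    step : Σ< (suc J) (λ i → 9/8 ^ℚ i * 8/9 ^ℚ suc J * η ^ℚ i) ≡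
           8/9 * (Σ< J (λ i → 9/8 ^ℚ i * 8/9 ^ℚ J * η ^ℚ i) + η ^ℚ J)
    step = trans
      (cong₂ _+_
        (trans (Σ<-cong J λ i _ → solve 4 (λ p x y z → x :* (p :* y) :* z := p :* (x :* y :* z)) refl
                 8/9 (9/8 ^ℚ i) (8/9 ^ℚ J) (η ^ℚ i))
          (sym (Σ<-*ˡ J 8/9 (λ i → 9/8 ^ℚ i * 8/9 ^ℚ J * η ^ℚ i))))
        (trans (solve 4 (λ p x y z → x :* (p :* y) :* z := p :* (x :* y :* z)) refl
                 8/9 (9/8 ^ℚ J) (8/9 ^ℚ J) (η ^ℚ J))
          (cong (8/9 *_) (trans (cong (_* η ^ℚ J) (ones J)) (ℚ.*-identityˡ (η ^ℚ J))))))
      (sym (ℚ.*-distribˡ-+ 8/9 (Σ< J (λ i → 9/8 ^ℚ i * 8/9 ^ℚ J * η ^ℚ i)) (η ^ℚ J)))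

  -- 1/y is the value at s = z of 1/(y + z - s), and Λ evaluates the expansion of
  -- the latter in powers of s - z + e as if s were z; its remainder is estimated
  -- coefficient by coefficient. With e = d + 1 all terms of the expansion are positive.
  module _ (N : ℚ) (1≤N : 1ℚ ≤ N) (l J : ℕ) {K : ℚ} (0≤K : 0ℚ ≤ K)
           (bound : ∀ i → i ℕ.< J → ∣ c^ l i ∣ ≤ K * r ^ℚ i) where

    y e w ω κ : ℚ
    y = N * fromℕ b
    e = D + 1ℚ
    w = y + e
    ω = recip w
    κ = recip (w - 9/8)

    v : ℚ → ℚ
    v x = e - z x

    0≤N : 0ℚ ≤ N
    0≤N = ℚ.≤-trans 0≤1 1≤N

    b≤y : fromℕ b ≤ y
    b≤y = subst (_≤ y) (ℚ.*-identityˡ (fromℕ b)) (*-monoʳ-≤ (fromℕ b) (0≤fromℕ b) 1≤N)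

    B⁻≤w-q : B⁻ ≤ w - 9/8
    B⁻≤w-q = ≤-by (0≤- b≤y) (solve 3 (λ y D b → y :+ (D :+ con 1ℚ) :- con 9/8 :=
      b :+ D :- con (ℤ.+ 1 / 8) :+ (y :- b)) refl y D (fromℕ b))

    0<w-q : 0ℚ < w - 9/8
    0<w-q = ℚ.<-≤-trans 0<B⁻ B⁻≤w-q

    N≤w-q : N ≤ w - 9/8
    N≤w-q = ≤-by
      (0≤+ (0≤+ (0≤* 0≤N (0≤- 2≤b)) (0≤- 1≤N)) (0≤+ 0≤D (ℚ.≤ᵇ⇒≤ {0ℚ} {ℤ.+ 7 / 8} tt)))
      (solve 3 (λ N b D → N :* b :+ (D :+ con 1ℚ) :- con 9/8 :=
        N :+ (N :* (b :- con (fromℕ 2)) :+ (N :- con 1ℚ) :+ (D :+ con (ℤ.+ 7 / 8)))) refl N (fromℕ b) D)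

    0<N : 0ℚ < N
    0<N = ℚ.<-≤-trans 0<1 1≤N

    w-q≤w : w - 9/8 ≤ w
    w-q≤w = ≤-by (ℚ.≤ᵇ⇒≤ {0ℚ} {9/8} tt) (solve 1 (λ w → w := w :- con 9/8 :+ con 9/8) refl w)

    0<w : 0ℚ < w
    0<w = ℚ.<-≤-trans 0<w-q w-q≤w

    0≤κ : 0ℚ ≤ κ
    0≤κ = 0≤recip 0<w-q

    y⁻¹ : ℚ
    y⁻¹ = β * recip N

    y⁻¹-inverse : y * y⁻¹ ≡ 1ℚ
    y⁻¹-inverse = trans (solve 4 (λ N b β R → N :* b :* (β :* R) := b :* β :* (N :* R)) refl
      N (fromℕ b) β (recip N)) (cong₂ _*_ b*b⁻¹≡1 (recip-inverse 0<N))

    y⁻¹-fixed : ω * (1ℚ + e * y⁻¹) ≡ y⁻¹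
    y⁻¹-fixed = trans (cong (λ t → ω * (t + e * y⁻¹)) (sym y⁻¹-inverse))
      (trans (solve 4 (λ ω y e Y → ω :* (y :* Y :+ e :* Y) := (y :+ e) :* ω :* Y) refl ω y e y⁻¹)
        (trans (cong (_* y⁻¹) (recip-inverse 0<w)) (ℚ.*-identityˡ y⁻¹)))

    remainder : ℕ → ℚ → ℚ
    remainder i x = recip (w - v x) ^ℚ suc i - partialSum ω v J i x

    remainder≤ : ∀ i {l} (u : Vec (Fin b) l) → let R = remainder i (value u) in
      0ℚ ≤ R × R ≤ 9/8 ^ℚ i * 8/9 ^ℚ J * κ ^ℚ suc i
    remainder≤ i u = remainder-bound {ω} {w} {9/8} {8/9} {κ} {recip (w - v x)} v x
        (0≤recip 0<w) (recip-inverse 0<w) (ℚ.≤ᵇ⇒≤ tt) refl (ℚ.≤ᵇ⇒≤ tt) 0≤κ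
        (trans (ℚ.*-comm κ (w - 9/8)) (recip-inverse 0<w-q)) 0≤v v≤1 (0≤recip 0<w-v)
        (recip-antimono 0<w-q w-q≤w-v) (trans (ℚ.*-comm (recip (w - v x)) (w - v x)) (recip-inverse 0<w-v)) J i
      where
      x = value u
      0≤v : 0ℚ ≤ v x
      0≤v = ≤-by (0≤- (ℚ.<⇒≤ (value<1 u))) (solve 2 (λ D x → D :+ con 1ℚ :- (D :+ x) :=
        con 0ℚ :+ (con 1ℚ :- x)) refl D x)
      v≤1 : v x ≤ 1ℚ
      v≤1 = ≤-by (0≤value u) (solve 2 (λ D x → con 1ℚ := D :+ con 1ℚ :- (D :+ x) :+ x) refl D x)
      w-q≤w-v : w - 9/8 ≤ w - v x
      w-q≤w-v = ≤-by (0≤- (ℚ.≤-trans v≤1 (ℚ.≤ᵇ⇒≤ {1ℚ} {9/8} tt)))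
        (solve 2 (λ w v → w :- v := w :- con 9/8 :+ (con 9/8 :- v)) refl w (v x))
      0<w-v : 0ℚ < w - v x
      0<w-v = ℚ.<-≤-trans 0<w-q w-q≤w-v

    P : ℚ
    P = y + D

    total : ℚ
    total = Σ< J λ i → c^ l i * H l i P

    -- As `w - v = y + z`, the powers in `H` are the coefficients of 1/(y + z - s). Of these, Λ maps
    -- the truncated expansion to `geometric ω e J`, which falls short of 1/y by `(e ω)ᴶ / y`.
    total≡ : total - y⁻¹ ≡ Σ< J (λ i → c^ l i * U.E l i (remainder i)) - (e * ω) ^ℚ J * y⁻¹
    total≡ = trans (cong (_- y⁻¹) split)
      (trans (solve 3 (λ R g Y → R :+ g :- Y := R :- (Y :- g)) refl
        (Σ< J (λ i → c^ l i * U.E l i (remainder i))) (geometric ω e J) y⁻¹)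
        (cong (_-_ (Σ< J (λ i → c^ l i * U.E l i (remainder i)))) (geometric-remainder y⁻¹-fixed J)))
      where
      split : total ≡ Σ< J (λ i → c^ l i * U.E l i (remainder i)) + geometric ω e J
      split = trans
        (Σ<-cong J λ i _ → trans
          (cong (c^ l i *_) (trans
            (𝔼-cong (law i) l λ u → trans
              (cong (λ t → recip t ^ℚ suc i) (solve 3 (λ y D x → y :+ D :+ x :=
                 y :+ (D :+ con 1ℚ) :- (D :+ con 1ℚ :- (D :+ x))) refl y D (value u)))
              (solve 2 (λ g s → g := g :- s :+ s) refl (recip (w - v (value u)) ^ℚ suc i)
                (partialSum ω v J i (value u))))
            (𝔼-+ (law i) l (remainder i ∘ value) (partialSum ω v J i ∘ value))))
          (ℚ.*-distribˡ-+ (c^ l i) (U.E l i (remainder i)) (U.E l i (partialSum ω v J i))))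
        (trans (Σ<-+ J (λ i → c^ l i * U.E l i (remainder i)) (λ i → c^ l i * U.E l i (partialSum ω v J i)))
          (cong (_+_ (Σ< J (λ i → c^ l i * U.E l i (remainder i))))
            (U.Λ-partialSum l (defining l) ω e J)))

    -- Since `r κ ≤ η`, the majorant of the remainder sums to a multiple of `ηᴶ`; its one spare
    -- factor `κ ≤ 1/N` makes the error summable over the integers counted. The second part is
    -- smaller, because `e ≤ b ≤ y` gives `e ω ≤ ½ ≤ η`.
    approximation : ∣ total - y⁻¹ ∣ ≤ (fromℕ 20 * K + 1ℚ) * η ^ℚ J * recip N
    approximation = subst (λ t → ∣ t ∣ ≤ (fromℕ 20 * K + 1ℚ) * η ^ℚ J * recip N) (sym total≡)
      (ℚ.≤-trans (ℚ.∣p-q∣≤∣p∣+∣q∣ (Σ< J (λ i → c^ l i * U.E l i (remainder i))) ((e * ω) ^ℚ J * y⁻¹))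
        (subst (∣ Σ< J (λ i → c^ l i * U.E l i (remainder i)) ∣ + ∣ (e * ω) ^ℚ J * y⁻¹ ∣ ≤_)
          (solve 3 (λ K h R → K :* R :* (con (fromℕ 20) :* h) :+ h :* R :=
            (con (fromℕ 20) :* K :+ con 1ℚ) :* h :* R) refl K (η ^ℚ J) (recip N))
          (ℚ.+-mono-≤ first second)))
      where
      0≤recipN = 0≤recip 0<N
      rκ≤η : r * κ ≤ η
      rκ≤η = *-monoˡ-≤ r 0≤r (recip-antimono 0<B⁻ B⁻≤w-q)
      M : ℕ → ℚ
      M i = 9/8 ^ℚ i * 8/9 ^ℚ J * κ ^ℚ suc i
      0≤9/8^8/9^ : ∀ i → 0ℚ ≤ 9/8 ^ℚ i * 8/9 ^ℚ J
      0≤9/8^8/9^ i = 0≤* (0≤^ i (ℚ.≤ᵇ⇒≤ tt)) (0≤^ J (ℚ.≤ᵇ⇒≤ tt))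
      term : ∀ i → i ℕ.< J → ∣ c^ l i * U.E l i (remainder i) ∣ ≤
        K * recip N * (9/8 ^ℚ i * 8/9 ^ℚ J * η ^ℚ i)
      term i i<J = ℚ.≤-trans
        (∣-∣-mono-* {c^ l i} (bound i i<J)
          (subst (_≤ M i) (sym (ℚ.0≤p⇒∣p∣≡p (0≤𝔼 (law i) l λ u → proj₁ (remainder≤ i u))))
            (𝔼≤ (law i) l λ u → proj₂ (remainder≤ i u))))
        (ℚ.≤-trans
          (ℚ.≤-reflexive (trans
            (solve 5 (λ K R T k k′ → K :* R :* (T :* (k :* k′)) := K :* k :* (T :* (R :* k′))) refl
              K (r ^ℚ i) (9/8 ^ℚ i * 8/9 ^ℚ J) κ (κ ^ℚ i))
            (cong (λ t → K * κ * (9/8 ^ℚ i * 8/9 ^ℚ J * t)) (sym (ℚ^.^-distrib-* r κ i)))))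
          (*-mono-≤ (0≤* 0≤K 0≤κ) (*-monoˡ-≤ K 0≤K (recip-antimono 0<N N≤w-q))
            (0≤* (0≤9/8^8/9^ i) (0≤^ i (0≤* 0≤r 0≤κ)))
            (*-monoˡ-≤ (9/8 ^ℚ i * 8/9 ^ℚ J) (0≤9/8^8/9^ i) (^-mono i (0≤* 0≤r 0≤κ) rκ≤η))))
      first : ∣ Σ< J (λ i → c^ l i * U.E l i (remainder i)) ∣ ≤ K * recip N * (fromℕ 20 * η ^ℚ J)
      first = ℚ.≤-trans (∣Σ<∣ J (λ i → c^ l i * U.E l i (remainder i)))
        (ℚ.≤-trans (Σ<-mono J term)
          (subst (_≤ K * recip N * (fromℕ 20 * η ^ℚ J))
            (Σ<-*ˡ J (K * recip N) (λ i → 9/8 ^ℚ i * 8/9 ^ℚ J * η ^ℚ i))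
            (*-monoˡ-≤ (K * recip N) (0≤* 0≤K 0≤recipN) (Σ<-majorant J))))
      0≤e : 0ℚ ≤ e
      0≤e = 0≤+ 0≤D 0≤1
      0≤eω : 0ℚ ≤ e * ω
      0≤eω = 0≤* 0≤e (0≤recip 0<w)
      eω≤½ : e * ω ≤ ½
      eω≤½ = subst (e * ω ≤_)
        (trans (ℚ.*-assoc ½ w ω) (trans (cong (½ *_) (recip-inverse 0<w)) (ℚ.*-identityʳ ½)))
        (*-monoʳ-≤ ω (0≤recip 0<w) e≤½w)
        where
        e≤½w : e ≤ ½ * w
        e≤½w = ≤-by (0≤* (ℚ.nonNegative⁻¹ ½) (0≤- (ℚ.≤-trans D+1≤b b≤y)))
          (solve 2 (λ y e → con ½ :* (y :+ e) := e :+ con ½ :* (y :- e)) refl y e)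
      0≤y⁻¹ : 0ℚ ≤ y⁻¹
      0≤y⁻¹ = 0≤* 0≤β 0≤recipN
      second : ∣ (e * ω) ^ℚ J * y⁻¹ ∣ ≤ η ^ℚ J * recip N
      second = subst (_≤ η ^ℚ J * recip N)
        (sym (ℚ.0≤p⇒∣p∣≡p (0≤* (0≤^ J 0≤eω) 0≤y⁻¹)))
        (*-mono-≤ (0≤^ J 0≤eω)
          (^-mono J 0≤eω (ℚ.≤-trans eω≤½ (ℚ.≤-trans (ℚ.≤ᵇ⇒≤ tt) 14/15≤η)))
          0≤y⁻¹
          (subst (_≤ recip N) (ℚ.*-comm (recip N) β) (p*q≤p 0≤recipN β≤1)))

-- Digit counts and the tails of the Irwin series.

module IrwinSums (b : ℕ) .{{_ : NonTrivial b}} (d : Fin b) where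
  open import Data.Rational.Base using (_+_; _*_; _-_; -_; _≤_; _<_; ∣_∣)
  open Base b
  open BaseLemmas b
  open DigitLemmas b d
  open Coefficients b d
  open Approximation b d

  digitsWithin-stable : ∀ l l′ n → n ℕ.≤ l → n ℕ.≤ l′ → digitsWithin l n ≡ digitsWithin l′ n
  digitsWithin-stable zero    zero     n       _   _    = refl
  digitsWithin-stable zero    (suc l′) zero    _   _    = refl
  digitsWithin-stable (suc l) zero     zero    _   _    = refl
  digitsWithin-stable (suc l) (suc l′) zero    _   _    = refl
  digitsWithin-stable (suc l) (suc l′) (suc n) n≤l n≤l′ = cong (_ ∷ˡ_)
    (digitsWithin-stable l l′ (suc n ℕ./ b) (quotient≤ n n≤l) (quotient≤ n n≤l′))

  digits-append : ∀ m n (a : Fin b) → suc m ≡ n ℕ.* b ℕ.+ toℕ a → digits (suc m) ≡ a ∷ˡ digits n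
  digits-append m n a eq = cong₂ _∷ˡ_
    (Fin.toℕ-injective (trans (toℕ-mod (suc m)) mod-b))
    (trans (cong (digitsWithin m) div-b)
      (digitsWithin-stable m n n (subst (ℕ._≤ m) div-b (quotient≤ m ℕ.≤-refl)) ℕ.≤-refl))
    where
    eq′ : suc m ≡ toℕ a ℕ.+ n ℕ.* b
    eq′ = trans eq (ℕ.+-comm (n ℕ.* b) (toℕ a))
    mod-b : suc m ℕ.% b ≡ toℕ a
    mod-b = trans (cong (ℕ._% b) eq′) (trans (ℕ.[m+kn]%n≡m%n (toℕ a) n b) (ℕ.m<n⇒m%n≡m (Fin.toℕ<n a)))
    div-b : suc m ℕ./ b ≡ n
    div-b = ℕ.*-cancelʳ-≡ (suc m ℕ./ b) n b (ℕ.+-cancelˡ-≡ (toℕ a) _ _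
      (trans (cong (ℕ._+ suc m ℕ./ b ℕ.* b) (sym mod-b))
        (trans (sym (ℕ.m≡m%n+[m/n]*n (suc m) b)) eq′)))

  occurrences-append : ∀ m n (a : Fin b) → suc m ≡ n ℕ.* b ℕ.+ toℕ a →
    occurrences d (suc m) ≡ (if does (a Fin.≟ d) then suc (occurrences d n) else occurrences d n)
  occurrences-append m n a eq = trans (cong (List.length ∘ List.filter (Fin._≟ d)) (digits-append m n a eq))
    (length-filter (digits n))
    where
    length-filter : ∀ as → List.length (List.filter (Fin._≟ d) (a ∷ˡ as)) ≡
      (if does (a Fin.≟ d) then suc (List.length (List.filter (Fin._≟ d) as))
                           else List.length (List.filter (Fin._≟ d) as))
    length-filter as with does (a Fin.≟ d)
    ... | true  = refl
    ... | false = refl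

  ⟦_⟧ : Bool → ℚ
  ⟦ t ⟧ = if t then 1ℚ else 0ℚ

  -- The value 0 at n = 0 holds for every k, including k = 0, and excludes n = 0 from all sums over
  -- n < bᴺ.
  χ : ℕ → ℕ → ℚ
  χ k zero    = 0ℚ
  χ k (suc n) = ⟦ does (occurrences d (suc n) ℕ.≟ k) ⟧

  χ⁻ : ℕ → ℕ → ℚ
  χ⁻ zero    n = 0ℚ
  χ⁻ (suc k) n = χ k n

  0≤⟦⟧ : ∀ t → 0ℚ ≤ ⟦ t ⟧
  0≤⟦⟧ true  = 0≤1
  0≤⟦⟧ false = ℚ.≤-refl

  0≤χ : ∀ k n → 0ℚ ≤ χ k n
  0≤χ k zero    = ℚ.≤-refl
  0≤χ k (suc n) = 0≤⟦⟧ _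

  χ≤1 : ∀ k n → χ k n ≤ 1ℚ
  χ≤1 k zero    = 0≤1
  χ≤1 k (suc n) = helper (does (occurrences d (suc n) ℕ.≟ k))
    where
    helper : ∀ t → ⟦ t ⟧ ≤ 1ℚ
    helper true  = ℚ.≤-refl
    helper false = 0≤1

  χ⁻-zero : ∀ k → χ⁻ k 0 ≡ 0ℚ
  χ⁻-zero zero    = refl
  χ⁻-zero (suc k) = refl

  χ-append : ∀ k n (a : Fin b) →
    χ k (suc n ℕ.* b ℕ.+ toℕ a) ≡ (if does (a Fin.≟ d) then χ⁻ k (suc n) else χ k (suc n))
  χ-append k n a with suc n ℕ.* b ℕ.+ toℕ a in eq
  ... | zero  = contradiction (ℕ.m*n≡0⇒m≡0 (suc n) b (ℕ.m+n≡0⇒m≡0 (suc n ℕ.* b) eq)) λ ()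
  ... | suc m = trans (cong (λ o → ⟦ does (o ℕ.≟ k) ⟧) (occurrences-append m (suc n) a (sym eq)))
    (cases (does (a Fin.≟ d)) k)
    where
    cases : ∀ t k → ⟦ does ((if t then suc (occurrences d (suc n)) else occurrences d (suc n)) ℕ.≟ k) ⟧ ≡
                    (if t then χ⁻ k (suc n) else χ k (suc n))
    cases true  zero    = refl
    cases true  (suc k) = refl
    cases false k       = refl

  χ-digit : ∀ k (a : Fin b) → 1 ℕ.≤ toℕ a →
    χ k (toℕ a) ≡ ⟦ does ((if does (a Fin.≟ d) then 1 else 0) ℕ.≟ k) ⟧
  χ-digit k a 1≤a with toℕ a in eq
  ... | suc m = cong (λ o → ⟦ does (o ℕ.≟ k) ⟧) (occurrences-append m 0 a (sym eq))

  S S⁻ : ℕ → ℕ → (ℕ → ℚ) → ℚ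
  S  k N f = Σ< (b ℕ.^ N) λ n → χ k n * f n
  S⁻ k N f = Σ< (b ℕ.^ N) λ n → χ⁻ k n * f n

  others : (ℕ → ℚ) → ℕ → ℚ
  others f n = ℚΣ.sum λ a → if does (a Fin.≟ d) then 0ℚ else f (n ℕ.* b ℕ.+ toℕ a)

  append : (ℕ → ℚ) → ℕ → ℚ
  append f n = f (n ℕ.* b ℕ.+ toℕ d)

  single : ℕ → (ℕ → ℚ) → ℚ
  single k f = ℚΣ.sum λ (a : Fin b) → χ k (toℕ a) * f (toℕ a)

  Σ<-replace-first : ∀ m {h g : ℕ → ℚ} → 1 ℕ.≤ m → g 0 ≡ 0ℚ → (∀ n → h (suc n) ≡ g (suc n)) →
                     Σ< m h ≡ h 0 + Σ< m g
  Σ<-replace-first (suc m) {h} {g} _ g0≡0 h≗g = trans (Σ<-first m h) (cong (h 0 +_)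
    (trans (Σ<-cong m λ n _ → h≗g n) (trans (sym (ℚ.+-identityˡ (Σ< m (g ∘ suc))))
      (trans (cong (_+ Σ< m (g ∘ suc)) (sym g0≡0)) (sym (Σ<-first m g))))))

  -- A positive number of at most N + 1 digits either has one digit or arises from a positive number
  -- of at most N digits by appending a digit; appending `d` raises the count by one.
  S-suc : ∀ k N f → S k (suc N) f ≡ single k f + (S k N (others f) + S⁻ k N (append f))
  S-suc k N f = trans (cong (λ m → Σ< m (λ n → χ k n * f n)) (ℕ.*-comm b (b ℕ.^ N)))
    (trans (Σ<-blocks b (b ℕ.^ N) (λ n → χ k n * f n))
      -- The block n = 0 contains the one-digit numbers and becomes `single`; the term n = 0 of the
      -- new sum vanishes with χ.
      (trans (Σ<-replace-first (b ℕ.^ N) {blocks} {λ n → χ k n * others f n + χ⁻ k n * append f n}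
          (ℕ.m^n>0 b N) zero-term step)
        (cong (single k f +_) (Σ<-+ (b ℕ.^ N) (λ n → χ k n * others f n) (λ n → χ⁻ k n * append f n)))))
    where
    blocks : ℕ → ℚ
    blocks n = ℚΣ.sum λ (a : Fin b) → χ k (n ℕ.* b ℕ.+ toℕ a) * f (n ℕ.* b ℕ.+ toℕ a)
    zero-term : χ k 0 * others f 0 + χ⁻ k 0 * append f 0 ≡ 0ℚ
    zero-term = trans (cong (λ s → 0ℚ * others f 0 + s * append f 0) (χ⁻-zero k))
      (solve 2 (λ x y → con 0ℚ :* x :+ con 0ℚ :* y := con 0ℚ) refl (others f 0) (append f 0))
    step : ∀ n → blocks (suc n) ≡
                 χ k (suc n) * others f (suc n) + χ⁻ k (suc n) * append f (suc n)
    step n = trans (ℚΣ.sum-cong-≗ {b} {λ a → χ k (suc n ℕ.* b ℕ.+ toℕ a) * g a}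
        {λ a → if does (a Fin.≟ d) then χ⁻ k (suc n) * g a else χ k (suc n) * g a} λ a → trans
        (cong (_* f (suc n ℕ.* b ℕ.+ toℕ a)) (χ-append k n a)) (if-* (does (a Fin.≟ d)) a))
      (trans (sum-pick d (λ a → χ⁻ k (suc n) * g a) (λ a → χ k (suc n) * g a))
        (trans (cong (χ⁻ k (suc n) * g d +_) (trans (ℚΣ.sum-cong-≗ λ a → *-if (does (a Fin.≟ d)) a)
            (sym (ℚΣ.*-distribˡ-sum (χ k (suc n)) (λ a → if does (a Fin.≟ d) then 0ℚ else g a)))))
          (ℚ.+-comm (χ⁻ k (suc n) * g d) (χ k (suc n) * others f (suc n)))))
      where
      g : Fin b → ℚ
      g a = f (suc n ℕ.* b ℕ.+ toℕ a)
      if-* : ∀ t a → (if t then χ⁻ k (suc n) else χ k (suc n)) * g a ≡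
                     (if t then χ⁻ k (suc n) * g a else χ k (suc n) * g a)
      if-* true  a = refl
      if-* false a = refl
      *-if : ∀ t a → (if t then 0ℚ else χ k (suc n) * g a) ≡ χ k (suc n) * (if t then 0ℚ else g a)
      *-if true  a = sym (ℚ.*-zeroʳ (χ k (suc n)))
      *-if false a = refl

  Σ<-increment-mono : ∀ {m n f g} → m ℕ.≤ n → (∀ k → f k ≤ g k) →
                      Σ< n f - Σ< m f ≤ Σ< n g - Σ< m g
  Σ<-increment-mono {m} {n} {f} {g} m≤n f≤g = ≤-by (0≤- (subst₂ _≤_ (Σ<-- m g f) (Σ<-- n g f)
      (Σ<-monoˡ {m} {n} {λ k → g k - f k} (λ k → 0≤- (f≤g k)) m≤n)))
    (solve 4 (λ a b c d → c :- d := a :- b :+ (c :- a :- (d :- b))) refl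
      (Σ< n f) (Σ< m f) (Σ< n g) (Σ< m g))

  b^-mono : ∀ N → b ℕ.^ N ℕ.≤ b ℕ.^ suc N
  b^-mono N = ℕ.m≤n*m (b ℕ.^ N) b

  rc : ℕ → ℚ
  rc n = recip (fromℕ n)

  0<fromℕ : ∀ n → 0ℚ < fromℕ (suc n)
  0<fromℕ n = ℚ.<-≤-trans 0<1 (fromℕ-mono {1} {suc n} (ℕ.s≤s ℕ.z≤n))

  0≤rc : ∀ n → 0ℚ ≤ rc n
  0≤rc zero    = ℚ.≤-refl
  0≤rc (suc n) = 0≤recip (0<fromℕ n)

  rc≤1 : ∀ n → rc n ≤ 1ℚ
  rc≤1 zero    = 0≤1
  rc≤1 (suc n) = recip-antimono 0<1 (fromℕ-mono {1} {suc n} (ℕ.s≤s ℕ.z≤n))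

  recip-*β : ∀ {p} → 0ℚ < p → recip (p * fromℕ b) ≡ β * recip p
  recip-*β {p} 0<p = sym (recip-unique
    (0<* 0<p (ℚ.<-≤-trans 0<1 (ℚ.≤-trans (ℚ.≤ᵇ⇒≤ tt) 2≤b)))
    (trans (solve 4 (λ p b β r → p :* b :* (β :* r) := b :* β :* (p :* r)) refl p (fromℕ b) β (recip p))
      (cong₂ _*_ b*b⁻¹≡1 (recip-inverse 0<p))))

  rc-append : ∀ n (a : Fin b) → rc (suc n ℕ.* b ℕ.+ toℕ a) ≤ β * rc (suc n)
  rc-append n a = subst (rc (suc n ℕ.* b ℕ.+ toℕ a) ≤_)
    (trans (cong recip (fromℕ-* (suc n) b)) (recip-*β (0<fromℕ n)))
    (recip-antimono (ℚ.<-≤-trans 0<1 (fromℕ-mono {1} {suc n ℕ.* b}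
        (ℕ.≤-trans (ℕ.>-nonZero⁻¹ b) (ℕ.m≤m+n b (n ℕ.* b)))))
      (fromℕ-mono (ℕ.m≤m+n (suc n ℕ.* b) (toℕ a))))

  others-rc : ∀ n → others rc (suc n) ≤ (1ℚ - β) * rc (suc n)
  others-rc n = ℚ.≤-trans (sum-mono λ a → bound (does (a Fin.≟ d)) a)
    (ℚ.≤-reflexive (trans (sum-if d 0ℚ (β * rc (suc n)))
      (trans (solve 3 (λ p β r → con 0ℚ :+ p :* (β :* r) := ((p :+ con 1ℚ) :* β :- β) :* r) refl
          (fromℕ (pred b)) β (rc (suc n)))
        (cong (λ t → (t - β) * rc (suc n)) (trans (cong (_* β) (sym (fromℕ-pred b))) b*b⁻¹≡1)))))
    where
    bound : ∀ t a → (if t then 0ℚ else rc (suc n ℕ.* b ℕ.+ toℕ a)) ≤ (if t then 0ℚ else β * rc (suc n))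
    bound true  a = ℚ.≤-refl
    bound false a = rc-append n a

  -- `Δ k N` is the contribution of the numbers with exactly N + 1 digits.
  W Δ : ℕ → ℕ → ℚ
  W k N = S k N rc
  Δ k N = W k (suc N) - W k N

  Δ⁻ : ℕ → ℕ → ℚ
  Δ⁻ zero    N = 0ℚ
  Δ⁻ (suc k) N = Δ k N

  -- Appending a digit to n replaces 1/n by at most `β/n`. The b - 1 digits other than `d` keep the
  -- count and give the factor `(b - 1) β = 1 - β`; the digit `d` is appended to numbers of count k
  -- - 1. The one-digit numbers cancel in the difference.
  Δ-suc : ∀ k N → Δ k (suc N) ≤ (1ℚ - β) * Δ k N + β * Δ⁻ k N
  Δ-suc k N = subst (_≤ (1ℚ - β) * Δ k N + β * Δ⁻ k N)
    (sym (trans (cong₂ _-_ (S-suc k (suc N) rc) (S-suc k N rc))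
      (solve 5 (λ s a c a′ c′ → s :+ (a :+ c) :- (s :+ (a′ :+ c′)) := a :- a′ :+ (c :- c′)) refl
        (single k rc) (S k (suc N) (others rc)) (S⁻ k (suc N) (append rc))
        (S k N (others rc)) (S⁻ k N (append rc)))))
    (ℚ.+-mono-≤ first (second k))
    where
    scale : ∀ x (ψ : ℕ → ℚ) → Σ< (b ℕ.^ suc N) (λ n → x * (ψ n * rc n)) - Σ< (b ℕ.^ N) (λ n → x * (ψ n * rc n)) ≡
      x * (Σ< (b ℕ.^ suc N) (λ n → ψ n * rc n) - Σ< (b ℕ.^ N) (λ n → ψ n * rc n))
    scale x ψ = trans (cong₂ _-_ (sym (Σ<-*ˡ (b ℕ.^ suc N) x (λ n → ψ n * rc n)))
        (sym (Σ<-*ˡ (b ℕ.^ N) x (λ n → ψ n * rc n))))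
      (solve 3 (λ x s t → x :* s :- x :* t := x :* (s :- t)) refl x
        (Σ< (b ℕ.^ suc N) (λ n → ψ n * rc n)) (Σ< (b ℕ.^ N) (λ n → ψ n * rc n)))
    pointwise-≤ : ∀ k {f x} → (∀ n → f (suc n) ≤ x * rc (suc n)) → ∀ n → χ k n * f n ≤ x * (χ k n * rc n)
    pointwise-≤ k {f} {x} f≤ zero    = ℚ.≤-reflexive (solve 3 (λ f x r → con 0ℚ :* f := x :* (con 0ℚ :* r)) refl (f 0) x (rc 0))
    pointwise-≤ k {f} {x} f≤ (suc n) = subst (χ k (suc n) * f (suc n) ≤_)
      (solve 3 (λ c x r → c :* (x :* r) := x :* (c :* r)) refl (χ k (suc n)) x (rc (suc n)))
      (*-monoˡ-≤ (χ k (suc n)) (0≤χ k (suc n)) (f≤ n))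
    first : S k (suc N) (others rc) - S k N (others rc) ≤ (1ℚ - β) * Δ k N
    first = subst (S k (suc N) (others rc) - S k N (others rc) ≤_) (scale (1ℚ - β) (χ k))
      (Σ<-increment-mono {b ℕ.^ N} {b ℕ.^ suc N} (b^-mono N) (pointwise-≤ k {others rc} {1ℚ - β} others-rc))
    second : ∀ k → S⁻ k (suc N) (append rc) - S⁻ k N (append rc) ≤ β * Δ⁻ k N
    second zero    = ℚ.≤-reflexive (trans (cong₂ _-_
        (Σ<-zero (b ℕ.^ suc N) λ n _ → ℚ.*-zeroˡ (append rc n)) (Σ<-zero (b ℕ.^ N) λ n _ → ℚ.*-zeroˡ (append rc n)))
      (sym (ℚ.*-zeroʳ β)))
    second (suc k) = subst (S k (suc N) (append rc) - S k N (append rc) ≤_) (scale β (χ k))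
      (Σ<-increment-mono {b ℕ.^ N} {b ℕ.^ suc N} (b^-mono N) (pointwise-≤ k {append rc} {β} (λ n → rc-append n d)))

  W-zero : ∀ k → W k 0 ≡ 0ℚ
  W-zero k = refl

  0≤χrc : ∀ k n → 0ℚ ≤ χ k n * rc n
  0≤χrc k n = 0≤* (0≤χ k n) (0≤rc n)

  b·2^ : ℕ → ℚ
  b·2^ k = fromℕ b * fromℕ 2 ^ℚ k

  0≤b·2^ : ∀ k → 0ℚ ≤ b·2^ k
  0≤b·2^ k = 0≤* (0≤fromℕ b) (0≤^ k (0≤fromℕ 2))

  -- The generating function Σₖ Δ k N xᵏ grows by the factor (1 - β) + βx with N,
  -- which is ρ at x = ½.
  Δ-bound : ∀ k N → Δ k N ≤ b·2^ k * ρ ^ℚ N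
  Δ-bound k zero    = subst₂ _≤_ (sym (trans (cong (_-_ (W k 1)) (W-zero k)) (ℚ.+-identityʳ (W k 1))))
    (sym (ℚ.*-identityʳ (b·2^ k)))
    (ℚ.≤-trans
      (Σ<-mono (b ℕ.^ 1) {g = λ _ → 1ℚ} λ n _ →
        subst (χ k n * rc n ≤_) (ℚ.*-identityˡ 1ℚ) (*-mono-≤ (0≤χ k n) (χ≤1 k n) (0≤rc n) (rc≤1 n)))
      (ℚ.≤-trans (ℚ.≤-reflexive (trans (trans (Σ<-sum (b ℕ.^ 1) (λ _ → 1ℚ)) (sum-const (b ℕ.^ 1) 1ℚ))
          (trans (ℚ.*-identityʳ (fromℕ (b ℕ.^ 1))) (cong fromℕ (ℕ.*-identityʳ b)))))
        (subst (_≤ b·2^ k) (ℚ.*-identityʳ (fromℕ b))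
          (*-monoˡ-≤ (fromℕ b) (0≤fromℕ b) (1≤^ k (ℚ.≤ᵇ⇒≤ {1ℚ} {fromℕ 2} tt))))))
  Δ-bound k (suc N) = ℚ.≤-trans (Δ-suc k N) (ℚ.≤-trans
    (ℚ.+-monoˡ-≤ (β * Δ⁻ k N) (*-monoˡ-≤ (1ℚ - β) (0≤- β≤1) (Δ-bound k N)))
    (finish k))
    where
    finish : ∀ k → (1ℚ - β) * (b·2^ k * ρ ^ℚ N) + β * Δ⁻ k N ≤ b·2^ k * ρ ^ℚ suc N
    finish zero    = ≤-by (0≤* (0≤* (ℚ.nonNegative⁻¹ ½) 0≤β) (0≤* (0≤b·2^ 0) (0≤^ N 0≤ρ)))
      (solve 3 (λ β B R → B :* ((con 1ℚ :- con ½ :* β) :* R) :=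
        (con 1ℚ :- β) :* (B :* R) :+ β :* con 0ℚ :+ con ½ :* β :* (B :* R)) refl β (b·2^ 0) (ρ ^ℚ N))
    finish (suc k) = ℚ.≤-trans
      (ℚ.+-monoʳ-≤ ((1ℚ - β) * (b·2^ (suc k) * ρ ^ℚ N)) (*-monoˡ-≤ β 0≤β (Δ-bound k N)))
      (ℚ.≤-reflexive (solve 4 (λ β B T R →
        (con 1ℚ :- β) :* (B :* (con (fromℕ 2) :* T) :* R) :+ β :* (B :* T :* R) :=
        B :* (con (fromℕ 2) :* T) :* ((con 1ℚ :- con ½ :* β) :* R)) refl β (fromℕ b) (fromℕ 2 ^ℚ k) (ρ ^ℚ N)))

  -- This is `b·2^ k / (1 - ρ)`, the sum of the geometric bounds of `Δ-bound`, as `1 - ρ = β/2`.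
  tailBound : ℕ → ℚ
  tailBound k = b·2^ k * (fromℕ 2 * fromℕ b)

  0≤tailBound : ∀ k → 0ℚ ≤ tailBound k
  0≤tailBound k = 0≤* (0≤b·2^ k) (0≤* (0≤fromℕ 2) (0≤fromℕ b))

  W-increment : ∀ k N m → W k (m ℕ.+ N) - W k N ≤ tailBound k * (ρ ^ℚ N - ρ ^ℚ (m ℕ.+ N))
  W-increment k N zero    = ℚ.≤-reflexive (solve 3 (λ w t r → w :- w := t :* (r :- r)) refl (W k N) (tailBound k) (ρ ^ℚ N))
  W-increment k N (suc m) = subst₂ _≤_
    (solve 3 (λ x y z → x :- y :+ (y :- z) := x :- z) refl (W k (suc m ℕ.+ N)) (W k (m ℕ.+ N)) (W k N))
    (trans
      (cong (_+ tailBound k * (ρ ^ℚ N - ρ ^ℚ (m ℕ.+ N))) (sym scale))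
      (solve 4 (λ t r x y → t :* (x :- y) :+ t :* (r :- x) := t :* (r :- y)) refl
        (tailBound k) (ρ ^ℚ N) (ρ ^ℚ (m ℕ.+ N)) (ρ ^ℚ (suc m ℕ.+ N))))
    (ℚ.+-mono-≤ (Δ-bound k (m ℕ.+ N)) (W-increment k N m))
    where
    scale : tailBound k * (ρ ^ℚ (m ℕ.+ N) - ρ ^ℚ (suc m ℕ.+ N)) ≡ b·2^ k * ρ ^ℚ (m ℕ.+ N)
    scale = trans (solve 4 (λ B b β R →
        B :* (con (fromℕ 2) :* b) :* (R :- (con 1ℚ :- con ½ :* β) :* R) := B :* (b :* β :* R)) refl
        (b·2^ k) (fromℕ b) β (ρ ^ℚ (m ℕ.+ N)))
      (cong (b·2^ k *_) (trans (cong (_* ρ ^ℚ (m ℕ.+ N)) b*b⁻¹≡1) (ℚ.*-identityˡ (ρ ^ℚ (m ℕ.+ N)))))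

  W-tail : ∀ k {N M} → N ℕ.≤ M → W k M - W k N ≤ tailBound k * ρ ^ℚ N
  W-tail k {N} {M} N≤M = ℚ.≤-trans
    (subst (λ M → W k M - W k N ≤ tailBound k * (ρ ^ℚ N - ρ ^ℚ M)) (ℕ.m∸n+n≡m N≤M) (W-increment k N (M ℕ.∸ N)))
    (*-monoˡ-≤ (tailBound k) (0≤tailBound k) (≤-by (0≤^ M 0≤ρ)
      (solve 2 (λ x y → x := x :- y :+ y) refl (ρ ^ℚ N) (ρ ^ℚ M))))

  W-bound : ∀ k N → W k N ≤ tailBound k
  W-bound k N = subst₂ _≤_ (trans (cong (_-_ (W k N)) (W-zero k)) (ℚ.+-identityʳ (W k N)))
    (ℚ.*-identityʳ (tailBound k)) (W-tail k {0} {N} ℕ.z≤n)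

-- The sums of Hⱼ(bn + d) over n, by self-similarity.

module Limits (b : ℕ) .{{_ : NonTrivial b}} (d : Fin b) where
  open import Data.Rational.Base using (_+_; _*_; _-_; -_; _≤_; _<_; ∣_∣)
  open Base b
  open BaseLemmas b
  open DigitLemmas b d
  open Coefficients b d
  open Approximation b d
  open IrwinSums b d
  open DigitLaw
  open FirstDigitSet

  h : ℕ → ℕ → ℕ → ℚ
  h l i n = H l i (fromℕ n)

  weight : ℕ → Fin b → ℚ
  weight i a = if does (a Fin.≟ d) then t i else 1ℚ

  recip-scale : ∀ {q} → 0ℚ < q → recip (q * β) ≡ fromℕ b * recip q
  recip-scale {q} 0<q = sym (recip-unique (0<* 0<q 0<b⁻¹)
    (trans (solve 4 (λ q β b r → q :* β :* (b :* r) := b :* β :* (q :* r)) refl q β (fromℕ b) (recip q))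
      (cong₂ _*_ b*b⁻¹≡1 (recip-inverse 0<q))))

  -- Self-similarity: the factor bʲ from rescaling cancels the one in νⱼ, j = i + 1.
  prob*𝔼 : ∀ l i a q (f : Vec (Fin b) l → ℚ) → (∀ w → 0ℚ < q + value w) →
    (∀ w → f w ≡ recip ((q + value w) * β) ^ℚ suc i) →
    prob (law i) a * 𝔼 (law i) l f ≡ weight i a * H l i q
  prob*𝔼 l i a q f 0<q+x f≗ = trans
    (cong₂ _*_ (prob-law i a) (trans
      (𝔼-cong (law i) l λ w → trans (f≗ w) (trans (cong (_^ℚ suc i) (recip-scale (0<q+x w)))
        (ℚ^.^-distrib-* (fromℕ b) (recip (q + value w)) (suc i))))
      (𝔼-* (law i) l (fromℕ b ^ℚ suc i) (λ w → recip (q + value w) ^ℚ suc i))))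
    (trans (solve 4 (λ β T b H → β :* T :* (b :* H) := β :* b :* (T :* H)) refl
        (β ^ℚ suc i) (weight i a) (fromℕ b ^ℚ suc i) (H l i q))
      (trans (cong (_* (weight i a * H l i q)) (β^*b^≡1 (suc i))) (ℚ.*-identityˡ (weight i a * H l i q))))

  fromℕ-append : ∀ n (a : Fin b) → fromℕ (n ℕ.* b ℕ.+ toℕ a) ≡ fromℕ n * fromℕ b + fromℕ (toℕ a)
  fromℕ-append n a = trans (sym (fromℕ-+ (n ℕ.* b) (toℕ a))) (cong (_+ fromℕ (toℕ a)) (fromℕ-* n b))

  0<p+value : ∀ {l p} (w : Vec (Fin b) l) → 0ℚ < p → 0ℚ < p + value w
  0<p+value {p = p} w 0<p = ℚ.<-≤-trans 0<p (≤-by (0≤value w) refl)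

  -- If `a` is the first digit of x and x′ stands for the remaining ones, then
  -- `n + x = (n b + a + x′) / b`. Splitting off that digit costs one level.
  h-suc : ∀ l i n → h (suc l) i (suc n) ≡ t i * append (h l i) (suc n) + others (h l i) (suc n)
  h-suc l i n = trans
    (ℚΣ.sum-cong-≗ {b} {λ a → prob (law i) a * 𝔼 (law i) l (λ w → recip (fromℕ (suc n) + value (a ∷ w)) ^ℚ suc i)}
      {λ a → weight i a * h l i (suc n ℕ.* b ℕ.+ toℕ a)} λ a →
      prob*𝔼 l i a (fromℕ (suc n ℕ.* b ℕ.+ toℕ a)) (λ w → recip (fromℕ (suc n) + value (a ∷ w)) ^ℚ suc i)
        (λ w → 0<p+value w (ℚ.<-≤-trans 0<1 (fromℕ-mono {1} {suc n ℕ.* b ℕ.+ toℕ a}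
          (ℕ.≤-trans (ℕ.>-nonZero⁻¹ b) (ℕ.≤-trans (ℕ.m≤m+n b (n ℕ.* b)) (ℕ.m≤m+n (suc n ℕ.* b) (toℕ a)))))))
        (λ w → cong (λ q → recip q ^ℚ suc i) (scaled a w)))
    (sum-pick-* d (t i) (λ a → h l i (suc n ℕ.* b ℕ.+ toℕ a)))
    where
    scaled : ∀ a {l} (w : Vec (Fin b) l) →
      fromℕ (suc n) + value (a ∷ w) ≡ (fromℕ (suc n ℕ.* b ℕ.+ toℕ a) + value w) * β
    scaled a w = trans (cong (_+ value (a ∷ w)) (trans (sym (ℚ.*-identityʳ N)) (cong (N *_) (sym b*b⁻¹≡1))))
      (trans (solve 5 (λ N b β A x → N :* (b :* β) :+ (A :+ x) :* β := (N :* b :+ A :+ x) :* β) refl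
          N (fromℕ b) β (fromℕ (toℕ a)) (value w))
        (cong (λ q → (q + value w) * β) (sym (fromℕ-append (suc n) a))))
      where N = fromℕ (suc n)

  module _ {p} (1≤p : 1ℚ ≤ p) where
    private
      0<p : 0ℚ < p
      0<p = ℚ.<-≤-trans 0<1 1≤p

    recip≤1 : ∀ {q} → 1ℚ ≤ q → recip q ≤ 1ℚ
    recip≤1 = recip-antimono 0<1

    0≤H : ∀ l i → 0ℚ ≤ H l i p
    0≤H l i = 0≤𝔼 (law i) l λ w → 0≤^ (suc i) (0≤recip (0<p+value w 0<p))

    H≤ : ∀ l i → H l i p ≤ recip p ^ℚ suc i
    H≤ l i = 𝔼≤ (law i) l λ w → ^-mono (suc i) (0≤recip (0<p+value w 0<p))
      (recip-antimono 0<p (≤-by (0≤value w) refl))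

    -- On x ≥ 0 the function `(p + x)⁻ʲ`, j = i + 1, has Lipschitz constant j because p ≥ 1, and the
    -- additional digit moves x by at most `βˡ`.
    ∣H-suc-H∣ : ∀ l i → ∣ H (suc l) i p - H l i p ∣ ≤ fromℕ (suc i) * β ^ℚ l
    ∣H-suc-H∣ l i = subst (λ k → ∣ 𝔼 (law i) k (f ∘ value) - H l i p ∣ ≤ fromℕ (suc i) * β ^ℚ l)
      (ℕ.+-comm l 1)
      (𝔼-refine (law i) l 1 (f ∘ value) (f ∘ value) λ u v → ℚ.≤-trans
        (∣^-^∣ (suc i) (∣recip∣≤1 (u ++ v)) (∣recip∣≤1 u))
        (*-monoˡ-≤ (fromℕ (suc i)) (0≤fromℕ (suc i)) (ℚ.≤-trans (lipschitz (u ++ v) u) (value-++ u v))))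
      where
      f : ℚ → ℚ
      f x = recip (p + x) ^ℚ suc i
      R : ∀ {l} → Vec (Fin b) l → ℚ
      R u = recip (p + value u)
      1≤p+ : ∀ {l} (u : Vec (Fin b) l) → 1ℚ ≤ p + value u
      1≤p+ u = ℚ.≤-trans 1≤p (≤-by (0≤value u) refl)
      ∣recip∣≤1 : ∀ {l} (u : Vec (Fin b) l) → ∣ R u ∣ ≤ 1ℚ
      ∣recip∣≤1 u = subst (_≤ 1ℚ) (sym (ℚ.0≤p⇒∣p∣≡p (0≤recip (0<p+value u 0<p)))) (recip≤1 (1≤p+ u))
      lipschitz : ∀ {l m} (u : Vec (Fin b) l) (v : Vec (Fin b) m) → ∣ R u - R v ∣ ≤ ∣ value u - value v ∣
      lipschitz u v = resp-∣-∣≤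
        (trans (solve 5 (λ R S p x y → R :* S :* (:- (x :- y)) := R :* ((p :+ y) :* S) :- (p :+ x) :* R :* S)
                 refl (R u) (R v) p (value u) (value v))
          (trans (cong₂ (λ s s′ → R u * s - s′ * R v) (recip-inverse (0<p+value v 0<p)) (recip-inverse (0<p+value u 0<p)))
            (cong₂ _-_ (ℚ.*-identityʳ (R u)) (ℚ.*-identityˡ (R v)))))
        (subst (∣ R u * R v * (- (value u - value v)) ∣ ≤_)
          (trans (solve 1 (λ s → con 1ℚ :* con 1ℚ :* s := s) refl ∣ - (value u - value v) ∣)
            (ℚ.∣-p∣≡∣p∣ (value u - value v)))
          (∣-∣-mono-* {R u * R v} (∣-∣-mono-* {R u} (∣recip∣≤1 u) (∣recip∣≤1 v)) ℚ.≤-refl))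

  1≤fromℕ : ∀ n → 1ℚ ≤ fromℕ (suc n)
  1≤fromℕ n = fromℕ-mono {1} {suc n} (ℕ.s≤s ℕ.z≤n)

  0≤χh : ∀ k l i n → 0ℚ ≤ χ k n * h l i n
  0≤χh k l i zero    = ℚ.≤-reflexive (sym (ℚ.*-zeroˡ (h l i 0)))
  0≤χh k l i (suc n) = 0≤* (0≤χ k (suc n)) (0≤H (1≤fromℕ n) l i)

  χh≤χrc : ∀ k l i n → χ k n * h l i n ≤ χ k n * rc n
  χh≤χrc k l i zero    = ℚ.≤-reflexive (trans (ℚ.*-zeroˡ (h l i 0)) (sym (ℚ.*-zeroˡ (rc 0))))
  χh≤χrc k l i (suc n) = *-monoˡ-≤ (χ k (suc n)) (0≤χ k (suc n))
    (ℚ.≤-trans (H≤ (1≤fromℕ n) l i) (p*q≤p (0≤rc (suc n)) (^≤1 i (0≤rc (suc n)) (rc≤1 (suc n)))))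

  ρ<1 : ρ < 1ℚ
  ρ<1 = subst (ρ <_)
    (solve 1 (λ β → con 1ℚ :- con ½ :* β :+ con ½ :* β := con 1ℚ) refl β)
    (subst (_< ρ + ½ * β) (ℚ.+-identityʳ ρ) (ℚ.+-monoʳ-< ρ (0<* (ℚ.positive⁻¹ ½) 0<b⁻¹)))

  β<1 : β < 1ℚ
  β<1 = ℚ.≤-<-trans β≤½ (from-yes (½ ℚ.<? 1ℚ))

  Null : (ℕ → ℕ → ℚ) → Set
  Null f = f ⇝ λ _ _ → 0ℚ

  null : ∀ {f} → (∀ ε → 0ℚ < ε → Eventually λ N → Eventually λ l → ∣ f N l ∣ ≤ ε) → Null f
  null {f} f→0 = mk⇝ λ ε 0<ε → eventually-map
    (λ N → eventually-map λ l → resp-∣-∣≤ (sym (ℚ.+-identityʳ (f N l)))) (f→0 ε 0<ε)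

  -- The difference runs over the numbers with N + 1 digits, where `h ≤ 1/n`, so `Δ-bound` applies,
  -- uniformly in the level.
  boundary-null : ∀ k i → Null λ N l → S k (suc N) (h l i) - S k N (h l i)
  boundary-null k i = null λ ε 0<ε → eventually-map
    (λ N small → 0 , λ l _ → ℚ.≤-trans (bound N l) small)
    (geometric-decay (b·2^ k) ε 0≤ρ ρ<1 (0≤b·2^ k) 0<ε)
    where
    bound : ∀ N l → ∣ S k (suc N) (h l i) - S k N (h l i) ∣ ≤ b·2^ k * ρ ^ℚ N
    bound N l = subst (_≤ b·2^ k * ρ ^ℚ N)
      (sym (ℚ.0≤p⇒∣p∣≡p (0≤- (Σ<-monoˡ {b ℕ.^ N} {b ℕ.^ suc N} (0≤χh k l i) (b^-mono N)))))
      (ℚ.≤-trans (Σ<-increment-mono {b ℕ.^ N} {b ℕ.^ suc N} (b^-mono N) (χh≤χrc k l i)) (Δ-bound k N))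

  -- For fixed N there are `bᴺ` terms, each of size at most `(i + 1) βˡ`; here the level must grow
  -- after N.
  level-null : ∀ k i → Null λ N l → S k N (h (suc l) i) - S k N (h l i)
  level-null k i = null λ ε 0<ε → 0 , λ N _ → eventually-map
    (λ l small → ℚ.≤-trans (bound N l) small)
    (geometric-decay (fromℕ (b ℕ.^ N) * fromℕ (suc i)) ε 0≤β β<1
      (0≤* (0≤fromℕ (b ℕ.^ N)) (0≤fromℕ (suc i))) 0<ε)
    where
    term : ∀ l n → ∣ χ k n * h (suc l) i n - χ k n * h l i n ∣ ≤ fromℕ (suc i) * β ^ℚ l
    term l zero    = resp-∣-∣≤
      (solve 2 (λ x y → con 0ℚ := con 0ℚ :* x :- con 0ℚ :* y) refl (h (suc l) i 0) (h l i 0))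
      (0≤* (0≤fromℕ (suc i)) (0≤^ l 0≤β))
    term l (suc n) = resp-∣-∣≤
      (solve 3 (λ c x y → c :* (x :- y) := c :* x :- c :* y) refl (χ k (suc n)) (h (suc l) i (suc n)) (h l i (suc n)))
      (subst (∣ χ k (suc n) * (h (suc l) i (suc n) - h l i (suc n)) ∣ ≤_) (ℚ.*-identityˡ (fromℕ (suc i) * β ^ℚ l))
        (∣-∣-mono-* {χ k (suc n)}
          (subst (_≤ 1ℚ) (sym (ℚ.0≤p⇒∣p∣≡p (0≤χ k (suc n)))) (χ≤1 k (suc n)))
          (∣H-suc-H∣ (1≤fromℕ n) l i)))
    bound : ∀ N l → ∣ S k N (h (suc l) i) - S k N (h l i) ∣ ≤ fromℕ (b ℕ.^ N) * fromℕ (suc i) * β ^ℚ l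
    bound N l = subst (λ s → ∣ s ∣ ≤ fromℕ (b ℕ.^ N) * fromℕ (suc i) * β ^ℚ l)
      (Σ<-- (b ℕ.^ N) (λ n → χ k n * h (suc l) i n) (λ n → χ k n * h l i n))
      (ℚ.≤-trans (∣Σ<∣ (b ℕ.^ N) _) (ℚ.≤-trans (Σ<-mono (b ℕ.^ N) {g = λ _ → fromℕ (suc i) * β ^ℚ l} λ n _ → term l n)
        (ℚ.≤-reflexive (trans (trans (Σ<-sum (b ℕ.^ N) (λ _ → fromℕ (suc i) * β ^ℚ l))
            (sum-const (b ℕ.^ N) (fromℕ (suc i) * β ^ℚ l)))
          (sym (ℚ.*-assoc (fromℕ (b ℕ.^ N)) (fromℕ (suc i)) (β ^ℚ l)))))))

  T T⁻ : ℕ → ℕ → ℕ → ℕ → ℚ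
  T  k i N l = S  k N (append (h l i))
  T⁻ k i N l = S⁻ k N (append (h l i))

  Λ^ : ℕ → ℚ
  Λ^ i = λℚ (suc i)

  -- The telescoping. Sorting by the last digit writes `S` at N + 1 as `single + others + T⁻`, while
  -- self-similarity writes `S` at level l + 1 as `t T + others`. On subtraction the digits other
  -- than `d` cancel, and `t T` equals `T⁻ + single` up to the two null differences.
  T-recursion : ∀ k i N l → T k i N l ≡ Λ^ i * (T⁻ k i N l + single k (h l i)) +
    (- Λ^ i * (S k (suc N) (h l i) - S k N (h l i)) + Λ^ i * (S k N (h (suc l) i) - S k N (h l i)))
  T-recursion k i N l = trans (sym (ℚ.*-identityˡ (T k i N l))) (trans (cong (_* T k i N l) (sym (λ*t≡1 i)))
    (trans
      (solve 7 (λ λ′ t T T⁻ s O V → λ′ :* t :* T :=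
        λ′ :* (T⁻ :+ s) :+ (:- λ′ :* (s :+ (O :+ T⁻) :- V) :+ λ′ :* (t :* T :+ O :- V))) refl
        (Λ^ i) (t i) (T k i N l) (T⁻ k i N l) (single k (h l i)) (S k N (others (h l i))) (S k N (h l i)))
      (cong₂ (λ x y → Λ^ i * (T⁻ k i N l + single k (h l i)) +
                (- Λ^ i * (x - S k N (h l i)) + Λ^ i * (y - S k N (h l i))))
        (sym (S-suc k N (h l i))) (sym level-up))))
    where
    term : ∀ n → χ k n * h (suc l) i n ≡ t i * (χ k n * append (h l i) n) + χ k n * others (h l i) n
    term zero    = solve 4 (λ x y z t → con 0ℚ :* x := t :* (con 0ℚ :* y) :+ con 0ℚ :* z) refl
      (h (suc l) i 0) (append (h l i) 0) (others (h l i) 0) (t i)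
    term (suc n) = trans (cong (χ k (suc n) *_) (h-suc l i n))
      (solve 4 (λ c t x y → c :* (t :* x :+ y) := t :* (c :* x) :+ c :* y) refl
        (χ k (suc n)) (t i) (append (h l i) (suc n)) (others (h l i) (suc n)))
    level-up : S k N (h (suc l) i) ≡ t i * T k i N l + S k N (others (h l i))
    level-up = trans (Σ<-cong (b ℕ.^ N) λ n _ → term n)
      (trans (Σ<-+ (b ℕ.^ N) (λ n → t i * (χ k n * append (h l i) n)) (λ n → χ k n * others (h l i) n))
        (cong (_+ S k N (others (h l i))) (sym (Σ<-*ˡ (b ℕ.^ N) (t i) (λ n → χ k n * append (h l i) n)))))

  T-step : ∀ k i {G : ℕ → ℕ → ℚ} → T⁻ k i ⇝ G → T k i ⇝ λ N l → Λ^ i * (G N l + single k (h l i))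
  T-step k i {G} T⁻⇝G = ⇝-trans (⇝-reflexive (T-recursion k i)) (⇝-trans
    (⇝-+ {λ N l → Λ^ i * (T⁻ k i N l + single k (h l i))} {λ N l → Λ^ i * (G N l + single k (h l i))}
      (⇝-* (Λ^ i) (⇝-+ T⁻⇝G (⇝-reflexive λ _ _ → refl)))
      (⇝-+ (⇝-* (- Λ^ i) (boundary-null k i)) (⇝-* (Λ^ i) (level-null k i))))
    (⇝-reflexive λ N l → solve 2 (λ x λ′ → x :+ (:- λ′ :* con 0ℚ :+ λ′ :* con 0ℚ) := x) refl
      (Λ^ i * (G N l + single k (h l i))) (Λ^ i)))

  T₀-limit : ∀ i → T 0 i ⇝ λ _ l → Λ^ i * single 0 (h l i)
  T₀-limit i = ⇝-trans
    (T-step 0 i {λ _ _ → 0ℚ} (⇝-reflexive λ N l → Σ<-zero (b ℕ.^ N) λ n _ → ℚ.*-zeroˡ (append (h l i) n)))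
    (⇝-reflexive λ _ l → cong (Λ^ i *_) (ℚ.+-identityˡ (single 0 (h l i))))

  -- Taken at level l + 1, so that the first digit can be split off.
  abstract
    F^ F*^ : ℕ → ℕ → ℚ
    F^  l i = seq (F  d (suc i)) (suc l)
    F*^ l i = seq (F* d (suc i)) (suc l)

    F^≡ : ∀ l i → F^ l i ≡ seq (F d (suc i)) (suc l)
    F^≡ l i = refl

    F*^≡ : ∀ l i → F*^ l i ≡ seq (F* d (suc i)) (suc l)
    F*^≡ l i = refl

  firstDigit-integral : ∀ {A} (A-fd : FirstDigitSet A) l i →
    𝔼 (law i) (suc l) (λ w → 𝟙 A (value w) * recip (value w) ^ℚ suc i) ≡
    ℚΣ.sum λ a → ⟦ member A-fd a ⟧ * (weight i a * h l i (toℕ a))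
  firstDigit-integral {A} A-fd l i = ℚΣ.sum-cong-≗ {b}
    {λ a → prob (law i) a * 𝔼 (law i) l (λ w → f (a ∷ w))}
    {λ a → ⟦ member A-fd a ⟧ * (weight i a * h l i (toℕ a))} λ a → digit a (member A-fd a) refl
    where
    f : ∀ {l} → Vec (Fin b) l → ℚ
    f w = 𝟙 A (value w) * recip (value w) ^ℚ suc i
    split : ∀ a t → member A-fd a ≡ t → ∀ {l} (w : Vec (Fin b) l) →
            f (a ∷ w) ≡ ⟦ t ⟧ * recip (value (a ∷ w)) ^ℚ suc i
    split a t eq w = cong (λ s → ⟦ s ⟧ * recip (value (a ∷ w)) ^ℚ suc i) (trans (correct A-fd a w) eq)
    digit : ∀ a t → member A-fd a ≡ t →
      prob (law i) a * 𝔼 (law i) l (λ w → f (a ∷ w)) ≡ ⟦ member A-fd a ⟧ * (weight i a * h l i (toℕ a))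
    digit a false eq = trans
      (cong (prob (law i) a *_) (trans (𝔼-cong (law i) l λ w → trans (split a false eq w)
          (ℚ.*-zeroˡ (recip (value (a ∷ w)) ^ℚ suc i))) (𝔼-const (law i) l 0ℚ)))
      (trans (ℚ.*-zeroʳ (prob (law i) a)) (trans (sym (ℚ.*-zeroˡ (weight i a * h l i (toℕ a))))
        (cong (λ s → ⟦ s ⟧ * (weight i a * h l i (toℕ a))) (sym eq))))
    digit a true eq = trans
      (prob*𝔼 l i a (fromℕ (toℕ a)) (λ w → f (a ∷ w))
        (λ w → 0<p+value w (ℚ.<-≤-trans 0<1 (fromℕ-mono {1} {toℕ a} (nonzero A-fd a eq))))
        (λ w → trans (split a true eq w) (ℚ.*-identityˡ (recip (value (a ∷ w)) ^ℚ suc i))))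
      (trans (sym (ℚ.*-identityˡ (weight i a * h l i (toℕ a))))
        (cong (λ s → ⟦ s ⟧ * (weight i a * h l i (toℕ a))) (sym eq)))

  -- `g` tells whether the count of a one-digit number is k, given whether that digit is `d`. The
  -- factor `1 ≤ a` accounts for the digit 0, where χ vanishes.
  χ-digit-if : ∀ k (g : Bool → Bool) → (∀ t → ⟦ does ((if t then 1 else 0) ℕ.≟ k) ⟧ ≡ ⟦ g t ⟧) →
    ∀ a → χ k (toℕ a) ≡ ⟦ does (1 ℕ.≤? toℕ a) ∧ g (does (a Fin.≟ d)) ⟧
  χ-digit-if k g g≗ a = helper (1 ℕ.≤? toℕ a)
    where
    helper : Dec (1 ℕ.≤ toℕ a) → χ k (toℕ a) ≡ ⟦ does (1 ℕ.≤? toℕ a) ∧ g (does (a Fin.≟ d)) ⟧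
    helper (no  1≰a) = trans (cong (χ k) (ℕ.n<1⇒n≡0 (ℕ.≰⇒> 1≰a)))
      (cong (λ s → ⟦ s ∧ g (does (a Fin.≟ d)) ⟧) (sym (dec-false (1 ℕ.≤? toℕ a) 1≰a)))
    helper (yes 1≤a) = trans (χ-digit k a 1≤a) (trans (g≗ (does (a Fin.≟ d)))
      (cong (λ s → ⟦ s ∧ g (does (a Fin.≟ d)) ⟧) (sym (dec-true (1 ℕ.≤? toℕ a) 1≤a))))

  χ₀ : ∀ a → χ 0 (toℕ a) ≡ ⟦ does (1 ℕ.≤? toℕ a) ∧ not (does (a Fin.≟ d)) ⟧
  χ₀ = χ-digit-if 0 not λ { true → refl ; false → refl }

  χ₁ : ∀ a → χ 1 (toℕ a) ≡ ⟦ does (1 ℕ.≤? toℕ a) ∧ does (a Fin.≟ d) ⟧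
  χ₁ = χ-digit-if 1 (λ t → t) λ { true → refl ; false → refl }

  χ₂ : ∀ k a → χ (suc (suc k)) (toℕ a) ≡ 0ℚ
  χ₂ k a = trans (χ-digit-if (suc (suc k)) (const false) (λ { true → refl ; false → refl }) a)
    (cong ⟦_⟧ (∧-zeroʳ (does (1 ℕ.≤? toℕ a))))

  -- The interval [b⁻¹,1) consists of the first digits a ≥ 1. After rescaling, the digit `d` has
  -- weight `t i` and all others weight 1.
  F^≡single : ∀ l i → F^ l i ≡ single 0 (h l i) + t i * single 1 (h l i)
  F^≡single l i = trans (F^≡ l i) (trans (firstDigit-integral [b⁻¹,1⟩-firstDigit l i)
    (trans (ℚΣ.sum-cong-≗ {b} {λ a → ⟦ member [b⁻¹,1⟩-firstDigit a ⟧ * (weight i a * h l i (toℕ a))}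
        {λ a → χ 0 (toℕ a) * h l i (toℕ a) + t i * (χ 1 (toℕ a) * h l i (toℕ a))} λ a →
          trans (cong (λ s → ⟦ does (1 ℕ.≤? toℕ a) ∧ s ⟧ * (weight i a * h l i (toℕ a)))
                  (dec-true (toℕ a ℕ.<? b) (Fin.toℕ<n a)))
            (trans (cases (does (1 ℕ.≤? toℕ a)) (does (a Fin.≟ d)) (h l i (toℕ a)))
              (cong₂ (λ x y → x * h l i (toℕ a) + t i * (y * h l i (toℕ a))) (sym (χ₀ a)) (sym (χ₁ a)))))
      (trans (ℚΣ.∑-distrib-+ {b} (λ a → χ 0 (toℕ a) * h l i (toℕ a)) (λ a → t i * (χ 1 (toℕ a) * h l i (toℕ a))))
        (cong (single 0 (h l i) +_) (sym (ℚΣ.*-distribˡ-sum {b} (t i) (λ a → χ 1 (toℕ a) * h l i (toℕ a))))))))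
    where
    cases : ∀ s s′ x → ⟦ s ∧ true ⟧ * ((if s′ then t i else 1ℚ) * x) ≡ ⟦ s ∧ not s′ ⟧ * x + t i * (⟦ s ∧ s′ ⟧ * x)
    cases false s′    x = solve 3 (λ w x t → con 0ℚ :* (w :* x) := con 0ℚ :* x :+ t :* (con 0ℚ :* x)) refl
      (if s′ then t i else 1ℚ) x (t i)
    cases true  true  x = solve 2 (λ t x → con 1ℚ :* (t :* x) := con 0ℚ :* x :+ t :* (con 1ℚ :* x)) refl (t i) x
    cases true  false x = solve 2 (λ t x → con 1ℚ :* (con 1ℚ :* x) := con 1ℚ :* x :+ t :* (con 0ℚ :* x)) refl (t i) x

  F*^≡single : ∀ l i → F*^ l i ≡ single 0 (h l i)
  F*^≡single l i = trans (F*^≡ l i)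
    (trans (firstDigit-integral (∖-firstDigit [b⁻¹,1⟩-firstDigit (toℕ d)) l i)
      (ℚΣ.sum-cong-≗ {b} {λ a → ⟦ member (∖-firstDigit [b⁻¹,1⟩-firstDigit (toℕ d)) a ⟧ * (weight i a * h l i (toℕ a))}
        {λ a → χ 0 (toℕ a) * h l i (toℕ a)} λ a → trans
          (cong₂ (λ s u → ⟦ (does (1 ℕ.≤? toℕ a) ∧ s) ∧ not u ⟧ * (weight i a * h l i (toℕ a)))
            (dec-true (toℕ a ℕ.<? b) (Fin.toℕ<n a)) (interval a))
          (trans (cases (does (1 ℕ.≤? toℕ a)) (does (a Fin.≟ d)) (h l i (toℕ a)))
            (cong (_* h l i (toℕ a)) (sym (χ₀ a))))))
    where
    interval : ∀ a → does (toℕ d ℕ.≤? toℕ a) ∧ does (toℕ a ℕ.<? suc (toℕ d)) ≡ does (a Fin.≟ d)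
    interval a = does-⇔ (mk⇔
        (λ (d≤a , a≤d) → Fin.toℕ-injective (ℕ.≤-antisym (ℕ.≤-pred a≤d) d≤a))
        (λ { refl → ℕ.≤-refl , ℕ.≤-refl }))
      ((toℕ d ℕ.≤? toℕ a) ×-dec (toℕ a ℕ.<? suc (toℕ d))) (a Fin.≟ d)
    cases : ∀ s s′ x → ⟦ (s ∧ true) ∧ not s′ ⟧ * ((if s′ then t i else 1ℚ) * x) ≡ ⟦ s ∧ not s′ ⟧ * x
    cases false s′    x = solve 2 (λ w x → con 0ℚ :* (w :* x) := con 0ℚ :* x) refl (if s′ then t i else 1ℚ) x
    cases true  true  x = solve 2 (λ t x → con 0ℚ :* (t :* x) := con 0ℚ :* x) refl (t i) x
    cases true  false x = solve 1 (λ x → con 1ℚ :* (con 1ℚ :* x) := con 1ℚ :* x) refl x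

  single-zero : ∀ k f → (∀ a → χ k (toℕ a) ≡ 0ℚ) → single k f ≡ 0ℚ
  single-zero k f χ≡0 = trans (ℚΣ.sum-cong-≗ {b} {λ a → χ k (toℕ a) * f (toℕ a)} {λ _ → 0ℚ} λ a →
      trans (cong (_* f (toℕ a)) (χ≡0 a)) (ℚ.*-zeroˡ (f (toℕ a))))
    (trans (sum-const b 0ℚ) (ℚ.*-zeroʳ (fromℕ b)))

  -- Because `λ t = 1`, the two steps of the recursion combine:
  -- `λ (λ S₀ + S₁) = λ² (S₀ + t S₁) = λ² F`, with `Sₖ` for `single k`.
  T₁-limit : ∀ i → T 1 i ⇝ λ _ l → Λ^ i ^ℚ 2 * F^ l i
  T₁-limit i = ⇝-trans (T-step 1 i {λ _ l → Λ^ i * single 0 (h l i)} (T₀-limit i))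
    (⇝-reflexive λ _ l → trans (cong (λ x → Λ^ i * (Λ^ i * single 0 (h l i) + x)) (trans
        (sym (ℚ.*-identityˡ (single 1 (h l i)))) (cong (_* single 1 (h l i)) (sym (λ*t≡1 i)))))
      (trans (solve 4 (λ λ′ t x y → λ′ :* (λ′ :* x :+ λ′ :* t :* y) := λ′ :* (λ′ :* con 1ℚ) :* (x :+ t :* y)) refl
          (Λ^ i) (t i) (single 0 (h l i)) (single 1 (h l i)))
        (cong (Λ^ i ^ℚ 2 *_) (sym (F^≡single l i)))))

  -- No one-digit number contains `d` twice, so beyond k = 1 each step of the recursion merely
  -- multiplies by λ.
  T-limit : ∀ k i → T (suc k) i ⇝ λ _ l → Λ^ i ^ℚ suc (suc k) * F^ l i
  T-limit zero    i = T₁-limit i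
  T-limit (suc k) i = ⇝-trans (T-step (suc (suc k)) i {λ _ l → Λ^ i ^ℚ suc (suc k) * F^ l i} (T-limit k i))
    (⇝-reflexive λ _ l → trans (cong (λ x → Λ^ i * (Λ^ i ^ℚ suc (suc k) * F^ l i + x))
        (single-zero (suc (suc k)) (h l i) (χ₂ k)))
      (solve 3 (λ λ′ P F → λ′ :* (P :* F :+ con 0ℚ) := λ′ :* P :* F) refl (Λ^ i) (Λ^ i ^ℚ suc (suc k)) (F^ l i)))

  -- A positive one-digit number does not contain the digit 0, so for d = 0 the term `single 1` of
  -- `F` vanishes.
  T₀-limit-F : toℕ d ≡ 0 → ∀ i → T 0 i ⇝ λ _ l → Λ^ i ^ℚ 1 * F^ l i
  T₀-limit-F d≡0 i = ⇝-trans (T₀-limit i) (⇝-reflexive λ _ l →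
    cong₂ _*_ (sym (ℚ.*-identityʳ (Λ^ i))) (trans
      (trans (sym (ℚ.+-identityʳ (single 0 (h l i))))
        (cong (single 0 (h l i) +_) (sym (trans (cong (t i *_) (single-zero 1 (h l i) χ₁≡0)) (ℚ.*-zeroʳ (t i))))))
      (sym (F^≡single l i))))
    where
    χ₁≡0 : ∀ a → χ 1 (toℕ a) ≡ 0ℚ
    χ₁≡0 a = trans (χ₁ a) (cong (λ t → ⟦ t ⟧) (both (1 ℕ.≤? toℕ a) (a Fin.≟ d)))
      where
      both : (p : Dec (1 ℕ.≤ toℕ a)) (q : Dec (a ≡ d)) → does p ∧ does q ≡ false
      both (no _)    q          = refl
      both (yes 1≤a) (no _)     = refl
      both (yes 1≤a) (yes refl) = contradiction (subst (1 ℕ.≤_) d≡0 1≤a) λ ()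

  T₀-limit-F* : ∀ i → T 0 i ⇝ λ _ l → Λ^ i * F*^ l i
  T₀-limit-F* i = ⇝-trans (T₀-limit i) (⇝-reflexive λ _ l → cong (Λ^ i *_) (sym (F*^≡single l i)))

-- Completeness of the reals and dominated series.

module _ where
  open import Data.Rational.Base using (_+_; _*_; _-_; -_; _≤_; _<_; ∣_∣)

  0<1/suc : ∀ n → 0ℚ < ℤ.+ 1 / suc n
  0<1/suc n = ℚ.positive⁻¹ (ℤ.+ 1 / suc n) {{1/n>0 (suc n)}}

  1/suc-small : ∀ ε → 0ℚ < ε → Eventually λ n → ℤ.+ 1 / suc n ≤ ε
  1/suc-small ε 0<ε = proj₁ arch , λ n N≤n → ℚ.*-cancelˡ-≤-pos (fromℕ (suc n)) {{ℚ.normalize-pos (suc n) 1}}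
    (subst₂ _≤_ (trans (sym (n/n≡1 (suc n))) (/≡* (suc n) (suc n))) (ℚ.*-comm ε (fromℕ (suc n)))
      (ℚ.≤-trans (ℚ.<⇒≤ (proj₂ arch)) (*-monoˡ-≤ ε (ℚ.<⇒≤ 0<ε) (fromℕ-mono (ℕ.s≤s N≤n)))))
    where arch = archimedean 1ℚ 0<ε

  ∣-∣-triangle₃ : ∀ p q r s {α β γ} → ∣ p - q ∣ ≤ α → ∣ q - r ∣ ≤ β → ∣ r - s ∣ ≤ γ →
                  ∣ p - s ∣ ≤ α + β + γ
  ∣-∣-triangle₃ p q r s h k m = ∣-∣-triangle p r s (∣-∣-triangle p q r h k) m

  ∣-∣-sym : ∀ p q {ε} → ∣ p - q ∣ ≤ ε → ∣ q - p ∣ ≤ ε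
  ∣-∣-sym p q {ε} = subst (_≤ ε) (∣p-q∣≡∣q-p∣ p q)

  thirds : ∀ ε → ε * (ℤ.+ 1 / 4) + ε * (ℤ.+ 1 / 4) + ε * (ℤ.+ 1 / 4) ≡ ε * (ℤ.+ 3 / 4)
  thirds = solve 1 (λ ε → ε :* con (ℤ.+ 1 / 4) :+ ε :* con (ℤ.+ 1 / 4) :+ ε :* con (ℤ.+ 1 / 4) := ε :* con (ℤ.+ 3 / 4)) refl

  quarter>0 : ∀ {ε} → 0ℚ < ε → 0ℚ < ε * (ℤ.+ 1 / 4)
  quarter>0 0<ε = 0<* 0<ε (ℚ.positive⁻¹ (ℤ.+ 1 / 4))

  ¾<1 : ∀ {ε} → 0ℚ < ε → ε * (ℤ.+ 3 / 4) < ε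
  ¾<1 {ε} 0<ε = subst₂ _<_ (ℚ.+-identityʳ (ε * (ℤ.+ 3 / 4)))
    (solve 1 (λ ε → ε :* con (ℤ.+ 3 / 4) :+ ε :* con (ℤ.+ 1 / 4) := ε) refl ε)
    (ℚ.+-monoʳ-< (ε * (ℤ.+ 3 / 4)) (quarter>0 0<ε))

  record IsCauchy (p : ℕ → ℝ) : Set where
    constructor mkCauchy
    field
      modulus : ∀ ε → 0ℚ < ε → ∃ λ N → ∀ m n → N ℕ.≤ m → N ℕ.≤ n →
                Eventually λ l → ∣ seq (p m) l - seq (p n) l ∣ ≤ ε

  module _ (p : ℕ → ℝ) (p-cauchy : IsCauchy p) where
    private
      open IsCauchy p-cauchy

      L : ℕ → ℕ
      L n = proj₁ (cauchy (p n) (ℤ.+ 1 / suc n) (0<1/suc n))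

      s : ℕ → ℚ
      s n = seq (p n) (L n)

      s-near : ∀ n l → L n ℕ.≤ l → ∣ s n - seq (p n) l ∣ ≤ ℤ.+ 1 / suc n
      s-near n l L≤l = ℚ.<⇒≤ (proj₂ (cauchy (p n) (ℤ.+ 1 / suc n) (0<1/suc n)) (L n) l ℕ.≤-refl L≤l)

      s-cauchy : ∀ ε → 0ℚ < ε → ∃ λ N → ∀ m n → N ℕ.≤ m → N ℕ.≤ n → ∣ s m - s n ∣ < ε
      s-cauchy ε 0<ε = combine (modulus ε′ 0<ε′) (1/suc-small ε′ 0<ε′)
        where
        ε′ = ε * (ℤ.+ 1 / 4)
        0<ε′ = quarter>0 0<ε
        combine : (∃ λ N → ∀ m n → N ℕ.≤ m → N ℕ.≤ n → Eventually λ l → ∣ seq (p m) l - seq (p n) l ∣ ≤ ε′) →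
          (Eventually λ n → ℤ.+ 1 / suc n ≤ ε′) → ∃ λ N → ∀ m n → N ℕ.≤ m → N ℕ.≤ n → ∣ s m - s n ∣ < ε
        combine (N , h) (M , k) = N ℕ.⊔ M , λ m n N≤m N≤n →
          let l₀ , close = h m n (⊔ˡ N≤m) (⊔ˡ N≤n)
              -- A common level at which `p m` and `p n` are close to each other and to their chosen
              -- rationals; three errors of ε/4 keep the inequality strict.
              l = l₀ ℕ.⊔ (L m ℕ.⊔ L n)
              Lmn≤l = ℕ.m≤n⊔m l₀ (L m ℕ.⊔ L n)
          in ℚ.≤-<-trans
            (subst (∣ s m - s n ∣ ≤_) (thirds ε)
              (∣-∣-triangle₃ (s m) (seq (p m) l) (seq (p n) l) (s n)
                (ℚ.≤-trans (s-near m l (⊔ˡ Lmn≤l)) (k m (⊔ʳ N≤m)))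
                (close l (ℕ.m≤m⊔n l₀ (L m ℕ.⊔ L n)))
                (∣-∣-sym (s n) (seq (p n) l) (ℚ.≤-trans (s-near n l (⊔ʳ Lmn≤l)) (k n (⊔ʳ N≤n))))))
            (¾<1 0<ε)

    -- A diagonal sequence: its n-th rational is taken from `p n` at a level beyond which `p n`
    -- varies by less than `1 / (n + 1)`. Such a limit supplies the sum of the absolute values that
    -- absolute convergence asks for.
    limit : ℝ
    limit = mkℝ s s-cauchy

    ⟶-limit : p ⟶ limit
    ⟶-limit ε 0<ε = combine (modulus ε 0<ε)
      where
      combine : (∃ λ N → ∀ m n → N ℕ.≤ m → N ℕ.≤ n → Eventually λ l → ∣ seq (p m) l - seq (p n) l ∣ ≤ ε) →
        ∃ λ N → ∀ n → N ℕ.≤ n → Defs.∣ p n Defs.- limit ∣ Defs.≤ fromℚ ε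
      combine (N , h) = N , λ n N≤n → mk≤ λ ε₂ 0<ε₂ → near n N≤n ε₂ 0<ε₂
        (cauchy (p n) (½ * ε₂) (½>0 0<ε₂)) (1/suc-small (½ * ε₂) (½>0 0<ε₂))
        where
        near : ∀ n → N ℕ.≤ n → ∀ ε₂ → 0ℚ < ε₂ →
          (∃ λ M → ∀ l l′ → M ℕ.≤ l → M ℕ.≤ l′ → ∣ seq (p n) l - seq (p n) l′ ∣ < ½ * ε₂) →
          (Eventually λ n → ℤ.+ 1 / suc n ≤ ½ * ε₂) →
          Eventually λ l → ∣ seq (p n) l - s l ∣ ≤ ε + ε₂
        near n N≤n ε₂ 0<ε₂ (M , c) (M′ , k) = N ℕ.⊔ (M ℕ.⊔ M′) , λ l q →
          let l₀ , close = h n l N≤n (⊔ˡ q)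
              l′ = l₀ ℕ.⊔ (L l ℕ.⊔ M)
              LM≤l′ = ℕ.m≤n⊔m l₀ (L l ℕ.⊔ M)
          in subst (∣ seq (p n) l - s l ∣ ≤_)
            (trans (solve 2 (λ x y → x :+ y :+ x := y :+ (x :+ x)) refl (½ * ε₂) ε) (cong (ε +_) (½+½ ε₂)))
            (∣-∣-triangle₃ (seq (p n) l) (seq (p n) l′) (seq (p l) l′) (s l)
              (ℚ.<⇒≤ (c l l′ (⊔ˡ (⊔ʳ {N} q)) (⊔ʳ {L l} LM≤l′)))
              (close l′ (ℕ.m≤m⊔n l₀ (L l ℕ.⊔ M)))
              (∣-∣-sym (s l) (seq (p l) l′) (ℚ.≤-trans (s-near l l′ (⊔ˡ LM≤l′)) (k l (⊔ʳ {M} (⊔ʳ {N} q))))))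

  module _ (a : ℕ → ℝ) {A η : ℚ} (0≤A : 0ℚ ≤ A) (0≤η : 0ℚ ≤ η) (η<1 : η < 1ℚ)
           (dominated : ∀ i ε → 0ℚ < ε → Eventually λ l → ∣ seq (a i) l ∣ ≤ A * η ^ℚ i + ε) where
    private
      p : ℕ → ℝ
      p n = Defs.Σ< n λ i → Defs.∣ a i ∣

      0<1-η : 0ℚ < 1ℚ - η
      0<1-η = subst (_< 1ℚ - η) (ℚ.+-inverseʳ η) (ℚ.+-monoˡ-< (- η) η<1)

      instance
        1-η≢0 = ℚ.pos⇒nonZero (1ℚ - η) {{ℚ.positive 0<1-η}}

      G : ℚ
      G = ℚ.1/ (1ℚ - η)

      0≤AG : 0ℚ ≤ A * G
      0≤AG = 0≤* 0≤A (ℚ.<⇒≤ (ℚ.positive⁻¹ G {{ℚ.1/pos⇒pos (1ℚ - η) {{ℚ.positive 0<1-η}}}}))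

      term≡ : ∀ i → A * G * (η ^ℚ i - η ^ℚ suc i) ≡ A * η ^ℚ i
      term≡ i = trans (solve 4 (λ A G η P → A :* G :* (P :- η :* P) := A :* P :* ((con 1ℚ :- η) :* G)) refl A G η (η ^ℚ i))
        (trans (cong (A * η ^ℚ i *_) (ℚ.*-inverseʳ (1ℚ - η))) (ℚ.*-identityʳ (A * η ^ℚ i)))

      -- The geometric sum is kept in telescoped form, and half of the slack ε is spent on each new
      -- term, so that the total slack stays ε.
      increment : ∀ n m ε → 0ℚ < ε →
        Eventually λ l → seq (p (m ℕ.+ n)) l - seq (p n) l ≤ A * G * (η ^ℚ n - η ^ℚ (m ℕ.+ n)) + ε
      increment n zero    ε 0<ε = 0 , λ l _ → ≤-by (ℚ.<⇒≤ 0<ε)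
        (solve 4 (λ c x y ε → c :* (x :- x) :+ ε := y :- y :+ ε) refl (A * G) (η ^ℚ n) (seq (p n) l) ε)
      increment n (suc m) ε 0<ε = eventually-map
        (λ l (h , k) → subst₂ _≤_
          (solve 3 (λ x y z → x :- y :+ z := x :+ z :- y) refl (seq (p (m ℕ.+ n)) l) (seq (p n) l) ∣ seq (a (m ℕ.+ n)) l ∣)
          (trans (cong (λ t → A * G * (η ^ℚ n - η ^ℚ (m ℕ.+ n)) + ½ * ε + (t + ½ * ε)) (sym (term≡ (m ℕ.+ n))))
            (solve 5 (λ c x y z ε → c :* (x :- y) :+ con ½ :* ε :+ (c :* (y :- z) :+ con ½ :* ε) := c :* (x :- z) :+ ε) refl
              (A * G) (η ^ℚ n) (η ^ℚ (m ℕ.+ n)) (η ^ℚ (suc m ℕ.+ n)) ε))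
          (ℚ.+-mono-≤ h k))
        (eventually-× (increment n m (½ * ε) (½>0 0<ε)) (dominated (m ℕ.+ n) (½ * ε) (½>0 0<ε)))

      seq-p-mono : ∀ {m n} l → m ℕ.≤ n → seq (p m) l ≤ seq (p n) l
      seq-p-mono {m} {n} l m≤n = subst₂ _≤_ (sym (seq-Σ< m _ l)) (sym (seq-Σ< n _ l))
        (Σ<-monoˡ {m} {n} (λ i → ℚ.0≤∣p∣ (seq (a i) l)) m≤n)

      ordered : ∀ ε → 0ℚ < ε → ∃ λ N → ∀ m n → N ℕ.≤ n → n ℕ.≤ m →
        Eventually λ l → ∣ seq (p m) l - seq (p n) l ∣ ≤ ε
      ordered ε 0<ε = combine (geometric-decay {η} (A * G) (½ * ε) 0≤η η<1 0≤AG (½>0 0<ε))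
        where
        combine : (Eventually λ n → A * G * η ^ℚ n ≤ ½ * ε) → ∃ λ N → ∀ m n → N ℕ.≤ n → n ℕ.≤ m →
          Eventually λ l → ∣ seq (p m) l - seq (p n) l ∣ ≤ ε
        combine (N , h) = N , λ m n N≤n n≤m → eventually-map
          (λ l k → subst (_≤ ε) (sym (ℚ.0≤p⇒∣p∣≡p (0≤- (seq-p-mono l n≤m))))
            (subst (λ m → seq (p m) l - seq (p n) l ≤ ε) (ℕ.m∸n+n≡m n≤m)
              (ℚ.≤-trans k (subst (A * G * (η ^ℚ n - η ^ℚ (m ℕ.∸ n ℕ.+ n)) + ½ * ε ≤_) (½+½ ε)
                (ℚ.+-monoˡ-≤ (½ * ε) (ℚ.≤-trans
                  (*-monoˡ-≤ (A * G) 0≤AG (≤-by (0≤^ (m ℕ.∸ n ℕ.+ n) 0≤η)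
                    (solve 2 (λ x y → x := x :- y :+ y) refl (η ^ℚ n) (η ^ℚ (m ℕ.∸ n ℕ.+ n)))))
                  (h n N≤n)))))))
          (increment n (m ℕ.∸ n) (½ * ε) (½>0 0<ε))

      p-cauchy : IsCauchy p
      p-cauchy = mkCauchy λ ε 0<ε → proj₁ (ordered ε 0<ε) , λ m n N≤m N≤n → helper ε 0<ε m n N≤m N≤n (ℕ.≤-total n m)
        where
        helper : ∀ ε 0<ε m n → proj₁ (ordered ε 0<ε) ℕ.≤ m → proj₁ (ordered ε 0<ε) ℕ.≤ n →
          n ℕ.≤ m ⊎ m ℕ.≤ n → Eventually λ l → ∣ seq (p m) l - seq (p n) l ∣ ≤ ε
        helper ε 0<ε m n N≤m N≤n (inj₁ n≤m) = proj₂ (ordered ε 0<ε) m n N≤n n≤m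
        helper ε 0<ε m n N≤m N≤n (inj₂ m≤n) = eventually-map (λ l → ∣-∣-sym (seq (p n) l) (seq (p m) l))
          (proj₂ (ordered ε 0<ε) n m N≤m m≤n)

    absolutelyConvergent : AbsolutelyConvergent a
    absolutelyConvergent = limit p p-cauchy , ⟶-limit p p-cauchy

-- The Irwin sum and its series.

module Series (b : ℕ) .{{_ : NonTrivial b}} (d : Fin b) where
  open import Data.Rational.Base using (_+_; _*_; _-_; -_; _≤_; _<_; ∣_∣)
  open Base b
  open BaseLemmas b
  open DigitLemmas b d
  open Coefficients b d
  open Approximation b d
  open IrwinSums b d
  open Limits b d

  V : ℕ → ℕ → ℚ
  V k n = Σ< n λ i → irwinTerm d k (suc i)

  irwinTerm≡ : ∀ k i → irwinTerm d k (suc i) ≡ χ k (suc i) * rc (suc i)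
  irwinTerm≡ k i = helper (does (occurrences d (suc i) ℕ.≟ k))
    where
    helper : ∀ t → (if t then ℤ.+ 1 / suc i else 0ℚ) ≡ ⟦ t ⟧ * rc (suc i)
    helper true  = trans (recip-unique (0<fromℕ i) (trans (sym (/≡* (suc i) (suc i))) (n/n≡1 (suc i))))
      (sym (ℚ.*-identityˡ (rc (suc i))))
    helper false = sym (ℚ.*-zeroˡ (rc (suc i)))

  W≡V : ∀ k N → W k N ≡ V k (pred (b ℕ.^ N))
  W≡V k N = helper (b ℕ.^ N) (ℕ.m^n>0 b N)
    where
    helper : ∀ m → 1 ℕ.≤ m → Σ< m (λ n → χ k n * rc n) ≡ V k (pred m)
    helper (suc m) _ = trans (Σ<-first m (λ n → χ k n * rc n)) (trans (ℚ.+-identityˡ (Σ< m (λ n → χ k (suc n) * rc (suc n))))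
      (Σ<-cong m λ i _ → sym (irwinTerm≡ k i)))

  V-mono : ∀ k {m n} → m ℕ.≤ n → V k m ≤ V k n
  V-mono k {m} {n} = Σ<-monoˡ {m} {n} λ i → subst (0ℚ ≤_) (sym (irwinTerm≡ k i)) (0≤χrc k (suc i))

  n<b^n : ∀ n → n ℕ.< b ℕ.^ n
  n<b^n zero    = ℕ.s≤s ℕ.z≤n
  n<b^n (suc n) = ℕ.≤-trans (ℕ.s≤s (n<b^n n)) (ℕ.≤-trans
    (ℕ.+-monoˡ-≤ (b ℕ.^ n) (ℕ.m^n>0 b n))
    (subst (ℕ._≤ b ℕ.* b ℕ.^ n) (cong (b ℕ.^ n ℕ.+_) (ℕ.+-identityʳ (b ℕ.^ n)))
      (ℕ.*-monoˡ-≤ (b ℕ.^ n) (ℕ.nonTrivial⇒n>1 b))))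

  W≤V : ∀ k N n → b ℕ.^ N ℕ.≤ n → W k N ≤ V k n
  W≤V k N n b^N≤n = subst (_≤ V k n) (sym (W≡V k N)) (V-mono k (ℕ.≤-trans ℕ.pred[n]≤n b^N≤n))

  -- Since n < bⁿ, the first n terms are among those of `W k n`, to which `W-tail` applies.
  V≤W : ∀ k N n → b ℕ.^ N ℕ.≤ n → V k n ≤ W k N + tailBound k * ρ ^ℚ N
  V≤W k N n b^N≤n = ℚ.≤-trans
    (subst (V k n ≤_) (sym (W≡V k n)) (V-mono k (ℕ.≤-pred (subst (suc n ℕ.≤_)
      (sym (ℕ.suc-pred (b ℕ.^ n) {{ℕ.m^n≢0 b n}})) (n<b^n n)))))
    (subst (_≤ W k N + tailBound k * ρ ^ℚ N)
      (solve 2 (λ x y → x :+ (y :- x) := y) refl (W k N) (W k n))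
      (ℚ.+-monoʳ-≤ (W k N) (W-tail k (ℕ.≤-trans (ℕ.<⇒≤ (n<b^n N)) b^N≤n))))

  ∣V-W∣ : ∀ k N n → b ℕ.^ N ℕ.≤ n → ∣ W k N - V k n ∣ ≤ tailBound k * ρ ^ℚ N
  ∣V-W∣ k N n b^N≤n = ∣p∣≤
    (ℚ.≤-trans (≤-by (0≤- (W≤V k N n b^N≤n)) (solve 2 (λ w v → con 0ℚ := w :- v :+ (v :- w)) refl (W k N) (V k n)))
      (0≤* (0≤tailBound k) (0≤^ N 0≤ρ)))
    (≤-by (0≤- (V≤W k N n b^N≤n)) (solve 3 (λ w v τ → τ := :- (w :- v) :+ (w :+ τ :- v)) refl
      (W k N) (V k n) (tailBound k * ρ ^ℚ N)))

  ∣V-V∣ : ∀ k N m n → b ℕ.^ N ℕ.≤ m → b ℕ.^ N ℕ.≤ n → ∣ V k m - V k n ∣ ≤ tailBound k * ρ ^ℚ N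
  ∣V-V∣ k N m n b^N≤m b^N≤n = ∣p∣≤ (below m n b^N≤m b^N≤n) (subst (_≤ tailBound k * ρ ^ℚ N)
      (solve 2 (λ x y → y :- x := :- (x :- y)) refl (V k m) (V k n)) (below n m b^N≤n b^N≤m))
    where
    below : ∀ m n → b ℕ.^ N ℕ.≤ m → b ℕ.^ N ℕ.≤ n → V k m - V k n ≤ tailBound k * ρ ^ℚ N
    below m n p q = ≤-by (0≤+ (0≤- (V≤W k N m p)) (0≤- (W≤V k N n q)))
      (solve 4 (λ x y w τ → τ := x :- y :+ (w :+ τ :- x :+ (y :- w))) refl (V k m) (V k n) (W k N) (tailBound k * ρ ^ℚ N))

  tail-small : ∀ k ε → 0ℚ < ε → Eventually λ N → tailBound k * ρ ^ℚ N ≤ ε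
  tail-small k ε 0<ε = geometric-decay {ρ} (tailBound k) ε 0≤ρ ρ<1 (0≤tailBound k) 0<ε

  ½*ε<ε : ∀ {ε} → 0ℚ < ε → ½ * ε < ε
  ½*ε<ε {ε} 0<ε = subst₂ _<_ (ℚ.+-identityʳ (½ * ε)) (½+½ ε) (ℚ.+-monoʳ-< (½ * ε) (½>0 0<ε))

  -- The partial sums serve as the Cauchy sequence, with l terms at level l. Comparison with `W k N`
  -- therefore needs a level of at least `bᴺ`.
  irwinSum : ℕ → ℝ
  irwinSum k = mkℝ (V k) λ ε 0<ε → combine ε 0<ε (tail-small k (½ * ε) (½>0 0<ε))
    where
    combine : ∀ ε → 0ℚ < ε → (Eventually λ N → tailBound k * ρ ^ℚ N ≤ ½ * ε) →
      ∃ λ M → ∀ m n → M ℕ.≤ m → M ℕ.≤ n → ∣ V k m - V k n ∣ < ε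
    combine ε 0<ε (N , h) = b ℕ.^ N , λ m n p q →
      ℚ.≤-<-trans (ℚ.≤-trans (∣V-V∣ k N m n p q) (h N ℕ.≤-refl)) (½*ε<ε 0<ε)

  isIrwinSum : ∀ k → IsIrwinSum d k (irwinSum k)
  isIrwinSum k ε 0<ε = combine (tail-small k ε 0<ε)
    where
    combine : (Eventually λ N → tailBound k * ρ ^ℚ N ≤ ε) → ∃ λ M → ∀ n → M ℕ.≤ n →
      Defs.∣ Defs.Σ< n (λ i → fromℚ (irwinTerm d k (suc i))) Defs.- irwinSum k ∣ Defs.≤ fromℚ ε
    combine (N , h) = b ℕ.^ N , λ n p → mk≤ λ ε₂ 0<ε₂ → b ℕ.^ N , λ l q → ℚ.≤-trans
      (subst (λ s → ∣ s - V k l ∣ ≤ ε) (sym (seq-Σ< n (λ i → fromℚ (irwinTerm d k (suc i))) l))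
        (ℚ.≤-trans (∣V-V∣ k N n l p q) (h N ℕ.≤-refl)))
      (≤-by (ℚ.<⇒≤ 0<ε₂) refl)

  Σ<-T : ∀ k J N l (c : ℕ → ℚ) → Σ< J (λ i → c i * T k i N l) ≡
    Σ< (b ℕ.^ N) λ n → χ k n * Σ< J λ i → c i * append (h l i) n
  Σ<-T k J N l c = trans
    (Σ<-cong J λ i _ → trans (Σ<-*ˡ (b ℕ.^ N) (c i) (λ n → χ k n * append (h l i) n))
      (Σ<-cong (b ℕ.^ N) λ n _ → solve 3 (λ c x h → c :* (x :* h) := x :* (c :* h)) refl
        (c i) (χ k n) (append (h l i) n)))
    (trans (Σ<-comm J (b ℕ.^ N) (λ i n → χ k n * (c i * append (h l i) n)))
      (Σ<-cong (b ℕ.^ N) λ n _ → sym (Σ<-*ˡ J (χ k n) (λ i → c i * append (h l i) n))))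

  module _ {K : ℚ} (0≤K : 0ℚ ≤ K) where

    approximation-error : ℕ → ℚ
    approximation-error J = (fromℕ 20 * K + 1ℚ) * η ^ℚ J

    0≤20K+1 : 0ℚ ≤ fromℕ 20 * K + 1ℚ
    0≤20K+1 = 0≤+ (0≤* (0≤fromℕ 20) 0≤K) 0≤1

    -- The error of `approximation` at n is a constant multiple of 1/n, so summing over the n
    -- counted costs no more than `W k N`. The bound is uniform in N.
    ∣ΣT-W∣ : ∀ k J N l → (∀ i → i ℕ.< J → ∣ c^ l i ∣ ≤ K * r ^ℚ i) →
      ∣ Σ< J (λ i → c^ l i * T k i N l) - β * W k N ∣ ≤ approximation-error J * tailBound k
    ∣ΣT-W∣ k J N l bound = subst (λ s → ∣ s ∣ ≤ approximation-error J * tailBound k)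
      (sym (trans (cong₂ _-_ (Σ<-T k J N l (c^ l)) (Σ<-*ˡ (b ℕ.^ N) β (λ n → χ k n * rc n)))
        (sym (Σ<-- (b ℕ.^ N) (λ n → χ k n * A n) (λ n → β * (χ k n * rc n))))))
      (ℚ.≤-trans (∣Σ<∣ (b ℕ.^ N) (λ n → χ k n * A n - β * (χ k n * rc n)))
        (ℚ.≤-trans (Σ<-mono (b ℕ.^ N) λ n _ → term n)
          (subst (_≤ approximation-error J * tailBound k)
            (Σ<-*ˡ (b ℕ.^ N) (approximation-error J) (λ n → χ k n * rc n))
            (*-monoˡ-≤ (approximation-error J) (0≤* 0≤20K+1 (0≤^ J 0≤η)) (W-bound k N)))))
      where
      A : ℕ → ℚ
      A n = Σ< J λ i → c^ l i * append (h l i) n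
      term : ∀ n → ∣ χ k n * A n - β * (χ k n * rc n) ∣ ≤ approximation-error J * (χ k n * rc n)
      term zero    = ℚ.≤-reflexive (trans
        (cong ∣_∣ (solve 3 (λ a β r → con 0ℚ :* a :- β :* (con 0ℚ :* r) := con 0ℚ) refl (A 0) β (rc 0)))
        (solve 2 (λ e r → con 0ℚ := e :* (con 0ℚ :* r)) refl (approximation-error J) (rc 0)))
      term (suc n) = resp-∣-∣≤
        (solve 4 (λ x a β r → x :* (a :- β :* r) := x :* a :- β :* (x :* r)) refl (χ k (suc n)) (A (suc n)) β (rc (suc n)))
        (subst (∣ χ k (suc n) * (A (suc n) - β * rc (suc n)) ∣ ≤_)
          (solve 3 (λ x e r → x :* (e :* r) := e :* (x :* r)) refl (χ k (suc n)) (approximation-error J) (rc (suc n)))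
          (∣-∣-mono-* {χ k (suc n)} (ℚ.≤-reflexive (ℚ.0≤p⇒∣p∣≡p (0≤χ k (suc n))))
            (subst (λ s → ∣ s - β * rc (suc n) ∣ ≤ approximation-error J * rc (suc n))
              (Σ<-cong J λ i _ → cong (λ p → c^ l i * H l i p) (sym (fromℕ-append (suc n) d)))
              (approximation (fromℕ (suc n)) (1≤fromℕ n) l J 0≤K bound))))

    -- Here `r < B` is decisive: for n ≥ 1, `n b + d ≥ B ≥ B⁻`, so i of the i + 1 factors of `H`
    -- turn `rⁱ` into `ηⁱ`, and the remaining factor is at most 1/n.
    ∣cT∣ : ∀ k i N l → ∣ c^ l i ∣ ≤ K * r ^ℚ i → ∣ c^ l i * T k i N l ∣ ≤ K * tailBound k * η ^ℚ i
    ∣cT∣ k i N l bound = subst (∣ c^ l i * T k i N l ∣ ≤_)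
      (trans (solve 4 (λ K R τ P → K :* R :* (P :* τ) := K :* τ :* (R :* P)) refl K (r ^ℚ i) (tailBound k) (recip B⁻ ^ℚ i))
        (cong (K * tailBound k *_) (sym (ℚ^.^-distrib-* r (recip B⁻) i))))
      (∣-∣-mono-* {c^ l i} bound (subst (_≤ recip B⁻ ^ℚ i * tailBound k) (sym (ℚ.0≤p⇒∣p∣≡p (0≤Σ< (b ℕ.^ N) 0≤term)))
        (ℚ.≤-trans (Σ<-mono (b ℕ.^ N) λ n _ → term≤ n)
          (subst (_≤ recip B⁻ ^ℚ i * tailBound k)
            (Σ<-*ˡ (b ℕ.^ N) (recip B⁻ ^ℚ i) (λ n → χ k n * rc n))
            (*-monoˡ-≤ (recip B⁻ ^ℚ i) (0≤^ i (0≤recip 0<B⁻)) (W-bound k N))))))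
      where
      B≤ : ∀ n → B ≤ fromℕ (suc n ℕ.* b ℕ.+ toℕ d)
      B≤ n = subst (_≤ fromℕ (suc n ℕ.* b ℕ.+ toℕ d)) (sym (fromℕ-+ b (toℕ d)))
        (fromℕ-mono (ℕ.+-monoˡ-≤ (toℕ d) (ℕ.m≤m+n b (n ℕ.* b))))
      B⁻≤B : B⁻ ≤ B
      B⁻≤B = ≤-by (ℚ.≤ᵇ⇒≤ {0ℚ} {ℤ.+ 1 / 8} tt) (solve 1 (λ B → B := B :- con (ℤ.+ 1 / 8) :+ con (ℤ.+ 1 / 8)) refl B)
      1≤nb+d : ∀ n → 1ℚ ≤ fromℕ (suc n ℕ.* b ℕ.+ toℕ d)
      1≤nb+d n = ℚ.≤-trans 1≤B⁻ (ℚ.≤-trans B⁻≤B (B≤ n))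
      0≤term : ∀ n → 0ℚ ≤ χ k n * append (h l i) n
      0≤term zero    = ℚ.≤-reflexive (sym (ℚ.*-zeroˡ (append (h l i) 0)))
      0≤term (suc n) = 0≤* (0≤χ k (suc n)) (0≤H (1≤nb+d n) l i)
      term≤ : ∀ n → χ k n * append (h l i) n ≤ recip B⁻ ^ℚ i * (χ k n * rc n)
      term≤ zero    = ℚ.≤-reflexive (solve 3 (λ x P y → con 0ℚ :* x := P :* (con 0ℚ :* y)) refl
        (append (h l i) 0) (recip B⁻ ^ℚ i) (rc 0))
      term≤ (suc n) = subst (χ k (suc n) * append (h l i) (suc n) ≤_)
        (solve 3 (λ x R P → x :* (R :* P) := P :* (x :* R)) refl (χ k (suc n)) (rc (suc n)) (recip B⁻ ^ℚ i))
        (*-monoˡ-≤ (χ k (suc n)) (0≤χ k (suc n)) (ℚ.≤-trans (H≤ (1≤nb+d n) l i)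
          (*-mono-≤ 0≤R R≤rc (0≤^ i 0≤R) (^-mono i 0≤R (recip-antimono 0<B⁻ (ℚ.≤-trans B⁻≤B (B≤ n)))))))
        where
        0≤R : 0ℚ ≤ recip (fromℕ (suc n ℕ.* b ℕ.+ toℕ d))
        0≤R = 0≤recip (ℚ.<-≤-trans 0<1 (1≤nb+d n))
        R≤rc : recip (fromℕ (suc n ℕ.* b ℕ.+ toℕ d)) ≤ rc (suc n)
        R≤rc = ℚ.≤-trans (rc-append n d) (subst (_≤ rc (suc n)) (ℚ.*-comm (rc (suc n)) β) (p*q≤p (0≤rc (suc n)) β≤1))

    module _ (bound : ∀ J → Eventually λ l → ∀ i → i ℕ.< J → ∣ c^ l i ∣ ≤ K * r ^ℚ i)
             (k : ℕ) {Ψ : ℕ → ℕ → ℚ} (limits : ∀ i → T k i ⇝ λ _ l → Ψ l i)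
             (a : ℕ → ℝ) (seq-a : ∀ i l → seq (a i) l ≡ c^ l i * Ψ l i) where

      ∣cT-cΨ∣ : ∀ l i N {δ} → ∣ c^ l i ∣ ≤ K * r ^ℚ i → ∣ T k i N l - Ψ l i ∣ ≤ δ →
        ∣ c^ l i * T k i N l - c^ l i * Ψ l i ∣ ≤ K * r ^ℚ i * δ
      ∣cT-cΨ∣ l i N p q = resp-∣-∣≤
        (solve 3 (λ c x y → c :* (x :- y) := c :* x :- c :* y) refl (c^ l i) (T k i N l) (Ψ l i))
        (∣-∣-mono-* {c^ l i} p q)

      -- The bound `∣cT∣` at finite N passes to the limit `Ψ` with an arbitrarily small loss. As i
      -- is fixed, `T` can be taken close to `Ψ` relative to `K rⁱ`.
      dominated : ∀ i ε → 0ℚ < ε → Eventually λ l → ∣ seq (a i) l ∣ ≤ K * tailBound k * η ^ℚ i + ε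
      dominated i ε 0<ε = combine (share (K * r ^ℚ i) 0ℚ ε (0≤* 0≤K (0≤^ i 0≤r)) ℚ.≤-refl 0<ε)
        where
        finish : ∀ l N {δ} → (K * r ^ℚ i) * δ + δ * 0ℚ < ε → ∣ T k i N l - Ψ l i ∣ ≤ δ →
          (∀ j → j ℕ.< suc i → ∣ c^ l j ∣ ≤ K * r ^ℚ j) → ∣ seq (a i) l ∣ ≤ K * tailBound k * η ^ℚ i + ε
        finish l N {δ} small close bd = subst (λ s → ∣ s ∣ ≤ K * tailBound k * η ^ℚ i + ε) (sym (seq-a i l))
          (ℚ.≤-trans (∣p∣≤∣q∣+ (c^ l i * Ψ l i) (c^ l i * T k i N l))
            (ℚ.+-mono-≤ (∣cT∣ k i N l (bd i ℕ.≤-refl))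
              (∣-∣-sym (c^ l i * T k i N l) (c^ l i * Ψ l i) (ℚ.≤-trans (∣cT-cΨ∣ l i N (bd i ℕ.≤-refl) close)
                (ℚ.<⇒≤ (subst (_< ε) (solve 2 (λ x δ → x :* δ :+ δ :* con 0ℚ := x :* δ) refl (K * r ^ℚ i) δ) small))))))
        combine : (∃ λ δ → 0ℚ < δ × (K * r ^ℚ i) * δ + δ * 0ℚ < ε) →
          Eventually λ l → ∣ seq (a i) l ∣ ≤ K * tailBound k * η ^ℚ i + ε
        combine (δ , 0<δ , small) = at-N (within (limits i) δ 0<δ)
          where
          at-N : (Eventually λ N → Eventually λ l → ∣ T k i N l - Ψ l i ∣ ≤ δ) →
            Eventually λ l → ∣ seq (a i) l ∣ ≤ K * tailBound k * η ^ℚ i + ε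
          at-N (N , close) = eventually-map (λ l (p , q) → finish l N small p q)
            (eventually-× (close N ℕ.≤-refl) (bound (suc i)))

      absolute : AbsolutelyConvergent a
      absolute = absolutelyConvergent a (0≤* 0≤K (0≤tailBound k)) 0≤η η<1 dominated

      remainder-null : ∀ J ε → 0ℚ < ε → Eventually λ N → Eventually λ l →
        ∣ Σ< J (λ i → c^ l i * Ψ l i) - Σ< J (λ i → c^ l i * T k i N l) ∣ ≤ ε
      remainder-null J ε 0<ε = combine (share G 0ℚ ε 0≤G ℚ.≤-refl 0<ε)
        where
        G : ℚ
        G = Σ< J λ i → K * r ^ℚ i
        0≤G : 0ℚ ≤ G
        0≤G = 0≤Σ< J λ i → 0≤* 0≤K (0≤^ i 0≤r)
        finish : ∀ l N {δ} → G * δ + δ * 0ℚ < ε →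
          (∀ i → i ℕ.< J → ∣ T k i N l - Ψ l i ∣ ≤ δ) → (∀ i → i ℕ.< J → ∣ c^ l i ∣ ≤ K * r ^ℚ i) →
          ∣ Σ< J (λ i → c^ l i * Ψ l i) - Σ< J (λ i → c^ l i * T k i N l) ∣ ≤ ε
        finish l N {δ} small close bd = ∣-∣-sym (Σ< J (λ i → c^ l i * T k i N l)) (Σ< J (λ i → c^ l i * Ψ l i))
          (subst (λ s → ∣ s ∣ ≤ ε) (Σ<-- J (λ i → c^ l i * T k i N l) (λ i → c^ l i * Ψ l i))
            (ℚ.≤-trans (∣Σ<∣ J (λ i → c^ l i * T k i N l - c^ l i * Ψ l i))
              (ℚ.≤-trans (Σ<-mono J λ i i<J → ∣cT-cΨ∣ l i N (bd i i<J) (close i i<J))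
                (subst (_≤ ε) (Σ<-*ʳ J δ (λ i → K * r ^ℚ i))
                  (ℚ.<⇒≤ (subst (_< ε) (solve 2 (λ x δ → x :* δ :+ δ :* con 0ℚ := x :* δ) refl G δ) small))))))
        combine : (∃ λ δ → 0ℚ < δ × G * δ + δ * 0ℚ < ε) → Eventually λ N → Eventually λ l →
          ∣ Σ< J (λ i → c^ l i * Ψ l i) - Σ< J (λ i → c^ l i * T k i N l) ∣ ≤ ε
        combine (δ , 0<δ , small) = eventually-map
          (λ N close → eventually-map (λ l (p , q) → finish l N small p q)
            (eventually-× (eventually-∀< {λ i l → ∣ T k i N l - Ψ l i ∣ ≤ δ} J close) (bound J)))
          (eventually-∀< {λ i N → Eventually λ l → ∣ T k i N l - Ψ l i ∣ ≤ δ} J λ i _ → within (limits i) δ 0<δ)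

      -- J is determined by ε alone, through the uniform bound `∣ΣT-W∣`. The other two errors, from
      -- `Ψ` to `T` and from `W` to `V`, are charged to `ε₂` by choosing N and then the level.
      hasSum : HasSum a (fromℚ b⁻¹ Defs.* irwinSum k)
      hasSum ε 0<ε = combine (geometric-decay {η} ((fromℕ 20 * K + 1ℚ) * tailBound k) ε 0≤η η<1
          (0≤* 0≤20K+1 (0≤tailBound k)) 0<ε)
        where
        close : ∀ J → (fromℕ 20 * K + 1ℚ) * tailBound k * η ^ℚ J ≤ ε → ∀ ε₂ → 0ℚ < ε₂ →
          Eventually λ l → ∣ Σ< J (λ i → c^ l i * Ψ l i) - β * V k l ∣ ≤ ε + ε₂
        close J small ε₂ 0<ε₂ = at-N (eventually-× (remainder-null J (½ * ε₂) (½>0 0<ε₂)) (tail-small k (½ * ε₂) (½>0 0<ε₂)))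
          where
          at-N : (Eventually λ N → (Eventually λ l →
              ∣ Σ< J (λ i → c^ l i * Ψ l i) - Σ< J (λ i → c^ l i * T k i N l) ∣ ≤ ½ * ε₂) ×
              tailBound k * ρ ^ℚ N ≤ ½ * ε₂) →
            Eventually λ l → ∣ Σ< J (λ i → c^ l i * Ψ l i) - β * V k l ∣ ≤ ε + ε₂
          at-N (N , p) = eventually-map
            (λ l (first , bd , b^N≤l) → subst (∣ Σ< J (λ i → c^ l i * Ψ l i) - β * V k l ∣ ≤_)
              (trans (solve 2 (λ x y → x :+ y :+ x := y :+ (x :+ x)) refl (½ * ε₂) ε) (cong (ε +_) (½+½ ε₂)))
              (∣-∣-triangle₃ (Σ< J (λ i → c^ l i * Ψ l i)) (Σ< J (λ i → c^ l i * T k i N l)) (β * W k N) (β * V k l)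
                first
                (ℚ.≤-trans (∣ΣT-W∣ k J N l bd) (subst (_≤ ε)
                  (solve 3 (λ x τ P → x :* τ :* P := x :* P :* τ) refl (fromℕ 20 * K + 1ℚ) (tailBound k) (η ^ℚ J)) small))
                (resp-∣-∣≤ (solve 3 (λ β w v → β :* (w :- v) := β :* w :- β :* v) refl β (W k N) (V k l))
                  (ℚ.≤-trans
                    (∣-∣-mono-* {β} {W k N - V k l} (ℚ.≤-trans (ℚ.≤-reflexive (ℚ.0≤p⇒∣p∣≡p 0≤β)) β≤1)
                      (ℚ.≤-trans (∣V-W∣ k N l b^N≤l) (proj₂ (p N ℕ.≤-refl))))
                    (ℚ.≤-reflexive (ℚ.*-identityˡ (½ * ε₂)))))))
            (eventually-× (proj₁ (p N ℕ.≤-refl)) (eventually-× (bound J) (b ℕ.^ N , λ _ b^N≤l → b^N≤l)))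
        combine : (Eventually λ J → (fromℕ 20 * K + 1ℚ) * tailBound k * η ^ℚ J ≤ ε) →
          ∃ λ M → ∀ J → M ℕ.≤ J → Defs.∣ Defs.Σ< J a Defs.- fromℚ b⁻¹ Defs.* irwinSum k ∣ Defs.≤ fromℚ ε
        combine (M , h) = M , λ J M≤J → mk≤ λ ε₂ 0<ε₂ → eventually-map
          (λ l → subst (λ s → ∣ s - β * V k l ∣ ≤ ε + ε₂)
            (sym (trans (seq-Σ< J a l) (Σ<-cong J λ i _ → seq-a i l))))
          (close J (h J M≤J) ε₂ 0<ε₂)

  -- This undoes the shift by one level that came from splitting off the first digit in the
  -- integrals `F` and `F*`.
  seq-suc⇝ : ∀ x → (λ _ l → seq x (suc l)) ⇝ (λ _ l → seq x l)
  seq-suc⇝ x = mk⇝ λ ε 0<ε → 0 , λ _ _ → combine (cauchy x ε 0<ε)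
    where
    combine : ∀ {ε} → (∃ λ N → ∀ m n → N ℕ.≤ m → N ℕ.≤ n → ∣ seq x m - seq x n ∣ < ε) →
      Eventually λ l → ∣ seq x (suc l) - seq x l ∣ ≤ ε
    combine (N , h) = N , λ l N≤l → ℚ.<⇒≤ (h (suc l) l (ℕ.m≤n⇒m≤1+n N≤l) N≤l)

  conclusion : ∀ k (x : ℕ → ℝ) (μ : ℕ → ℚ) → (∀ i → T k i ⇝ λ _ l → μ i * seq (x i) (suc l)) →
    ∃ λ I → IsIrwinSum d k I ×
      HasAbsoluteSum (λ i → c d (suc i) Defs.* x i Defs.* fromℚ (μ i)) (fromℚ b⁻¹ Defs.* I)
  conclusion k x μ limits = irwinSum k , isIrwinSum k , helper coefficient-bound
    where
    limits′ : ∀ i → T k i ⇝ λ _ l → μ i * seq (x i) l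
    limits′ i = ⇝-trans (limits i) (⇝-* (μ i) (seq-suc⇝ (x i)))
    terms : ℕ → ℝ
    terms i = c d (suc i) Defs.* x i Defs.* fromℚ (μ i)
    seq-terms : ∀ i l → seq (terms i) l ≡ c^ l i * (μ i * seq (x i) l)
    seq-terms i l = trans (cong (λ s → s * seq (x i) l * μ i) (sym (c^≡ l i)))
      (solve 3 (λ c y m → c :* y :* m := c :* (m :* y)) refl (c^ l i) (seq (x i) l) (μ i))
    helper : (∃ λ K → 0ℚ ≤ K × ∀ J → Eventually λ l → ∀ i → i ℕ.< J → ∣ c^ l i ∣ ≤ K * r ^ℚ i) →
      HasAbsoluteSum terms (fromℚ b⁻¹ Defs.* irwinSum k)
    helper (K , 0≤K , bound) =
      absolute 0≤K bound k limits′ terms seq-terms , hasSum 0≤K bound k limits′ terms seq-terms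

  T-limit-F : ∀ k → 1 ℕ.≤ k ⊎ (k ≡ 0 × toℕ d ≡ 0) → ∀ i →
    T k i ⇝ λ _ l → λℚ (suc i) ^ℚ suc k * seq (F d (suc i)) (suc l)
  T-limit-F (suc k) _                  i = ⇝-trans (T-limit k i)
    (⇝-reflexive λ _ l → cong (Λ^ i ^ℚ suc (suc k) *_) (F^≡ l i))
  T-limit-F zero    (inj₁ ())
  T-limit-F zero    (inj₂ (_ , d≡0)) i = ⇝-trans (T₀-limit-F d≡0 i)
    (⇝-reflexive λ _ l → cong (Λ^ i ^ℚ 1 *_) (F^≡ l i))

  T-limit-F* : ∀ i → T 0 i ⇝ λ _ l → λℚ (suc i) * seq (F* d (suc i)) (suc l)
  T-limit-F* i = ⇝-trans (T₀-limit-F* i) (⇝-reflexive λ _ l → cong (Λ^ i *_) (F*^≡ l i))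

open Defs using (_*_)

theorem2 : (b : ℕ) .{{_ : NonTrivial b}} (d : Fin b) → let open Base b in
    ((k : ℕ) → 1 ℕ.≤ k ⊎ (k ≡ 0 × toℕ d ≡ 0) →
      ∃ λ I → IsIrwinSum d k I ×
        HasAbsoluteSum (λ i → c d (suc i) * F d (suc i) * fromℚ (λℚ (suc i) ^ℚ suc k))
          (fromℚ b⁻¹ * I))
    ×
    (0 ℕ.< toℕ d → ¬ (b ≡ 2 × toℕ d ≡ 1) →
      ∃ λ I → IsIrwinSum d 0 I ×
        HasAbsoluteSum (λ i → c d (suc i) * F* d (suc i) * fromℚ (λℚ (suc i)))
          (fromℚ b⁻¹ * I))
theorem2 b d =
  (λ k k≥1∨d≡0 → conclusion k (λ i → F d (suc i)) (λ i → λℚ (suc i) ^ℚ suc k) (T-limit-F k k≥1∨d≡0)) ,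
  (λ _ _ → conclusion 0 (λ i → F* d (suc i)) (λ i → λℚ (suc i)) T-limit-F*)
  where
  open Base b
  open Series b d
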